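{- For every integer $n\ge 6$, the maximum number of triples in a triple system on $n$ vertices that contains no Berge-$K_4$ is $$\mathrm{ex}_3(n,\mathcal{B})=f(n)=\left\lfloor\frac{n}{3}\right\rfloor\left\lfloor\frac{n+1}{3}\right\rfloor\left\lfloor\frac{n+2}{3}\right\rfloor,$$ which equals the number of triples of the balanced complete $3$-partite triple system on $n$ vertices (all triples $\{a,b,c\}$ with $a\in A,b\in B,c\in C$ for a partition $A,B,C$ of the $n$ vertices with $\lfloor n/3\rfloor=|A|\le|B|\le|C|=\lceil n/3\rceil$).
   Context: A triple system is a $3$-uniform hypergraph, i.e. a set $V$ of vertices together with a set of $3$-element subsets of $V$ (triples). A Berge-$K_4$ in a triple system is a configuration consisting of four distinct vertices $v_1,v_2,v_3,v_4$ and six distinct triples $e_{ij}$ ($1\le i<j\le 4$) of the system such that $\{v_i,v_j\}\subset e_{ij}$ for every $1\le i<j\le 4$. $\mathcal{B}$ denotes the family of all Berge-$K_4$ configurations. A triple system is $\mathcal{B}$-free if it contains no Berge-$K_4$. $\mathrm{ex}_3(n,\mathcal{F})$ denotes the maximum number of triples in a triple system on $n$ vertices containing no member of the family $\mathcal{F}$ as a subhypergraph. -}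

module Defs where

open import Data.Fin.Base using (Fin; _<_)
open import Data.Fin.Subset using (Subset; _∈_; _∪_; _∩_; ⁅_⁆; ⊤; ⊥; ∣_∣)
open import Data.List.Base using (List; length)
open import Data.List.Membership.Propositional using () renaming (_∈_ to _∈ₗ_)
open import Data.List.Relation.Unary.All using (All)
open import Data.List.Relation.Unary.Unique.Propositional using (Unique)
open import Data.Nat.Base using (ℕ; _+_; _*_; _≤_)
open import Data.Nat.DivMod using (_/_)
open import Data.Product.Base using (∃; ∃-syntax; _×_)
open import Function.Bundles using (_⇔_)
open import Function.Definitions using (Injective)
open import Relation.Binary.PropositionalEquality using (_≡_)
open import Relation.Nullary.Negation using (¬_)

-- The finite set of triples is a duplicate-free list, so that its cardinality
-- is the length of the list.
record TripleSystem (n : ℕ) : Set where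
  field
    triples : List (Subset n)
    unique  : Unique triples
    uniform : All (λ t → ∣ t ∣ ≡ 3) triples

open TripleSystem public

size : ∀ {n} → TripleSystem n → ℕ
size H = length (triples H)

-- Only the values e i j with i < j matter; the others are unconstrained.
record BergeK₄ {n : ℕ} (H : TripleSystem n) : Set where
  field
    v          : Fin 4 → Fin n
    v-distinct : Injective _≡_ _≡_ v
    e          : Fin 4 → Fin 4 → Subset n
    e-triple   : ∀ {i j} → i < j → e i j ∈ₗ triples H
    e-distinct : ∀ {i j k l} → i < j → k < l → e i j ≡ e k l → i ≡ k × j ≡ l
    e-contains : ∀ {i j} → i < j → v i ∈ e i j × v j ∈ e i j

𝓑-Free : ∀ {n} → TripleSystem n → Set
𝓑-Free H = ¬ BergeK₄ H

-- IsEx₃ n Free m says ex₃(n, 𝓕) = m, where Free H means that H contains no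
-- member of 𝓕.
record IsEx₃ (n : ℕ) (Free : TripleSystem n → Set) (m : ℕ) : Set where
  field
    attained : ∃[ H ] Free H × size H ≡ m
    maximal  : ∀ H → Free H → size H ≤ m

f : ℕ → ℕ
f n = (n / 3) * ((n + 1) / 3) * ((n + 2) / 3)

-- ⌈n/3⌉ is written (n + 2) / 3.
record IsBalancedPartition {n : ℕ} (A B C : Subset n) : Set where
  field
    cover : A ∪ B ∪ C ≡ ⊤
    A∩B   : A ∩ B ≡ ⊥
    A∩C   : A ∩ C ≡ ⊥
    B∩C   : B ∩ C ≡ ⊥
    ∣A∣   : ∣ A ∣ ≡ n / 3
    A≤B   : ∣ A ∣ ≤ ∣ B ∣
    B≤C   : ∣ B ∣ ≤ ∣ C ∣
    ∣C∣   : ∣ C ∣ ≡ (n + 2) / 3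

IsComplete3Partite : ∀ {n} (A B C : Subset n) → TripleSystem n → Set
IsComplete3Partite A B C H = ∀ t → t ∈ₗ triples H ⇔
  (∃[ a ] ∃[ b ] ∃[ c ]
    a ∈ A × b ∈ B × c ∈ C × t ≡ ⁅ a ⁆ ∪ ⁅ b ⁆ ∪ ⁅ c ⁆)

IsBalancedComplete3Partite : ∀ {n} → TripleSystem n → Set
IsBalancedComplete3Partite H =
  ∃[ A ] ∃[ B ] ∃[ C ] IsBalancedPartition A B C × IsComplete3Partite A B C H

{-# OPTIONS --safe #-}
-- Upper bound, n ≥ 9. Match as many triples as possible to pairs they contain.
-- Call a matched pair blue if it lies on an alternating path from an unmatched
-- triple, and red otherwise. The unmatched triples and those matched to blue
-- pairs contain only blue pairs; the other triples are as many as the red pairs.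
-- The red-blue graph has no K₄, as its edges are matched to distinct triples, so
-- it remains to bound #(red edges) + #(blue triangles) in a K₄-free graph. Let v
-- lie on the most red edges and blue triangles. Every blue triangle, and every
-- red edge not inside the (triangle-free) neighbourhood of v, meets a
-- non-neighbour of v; the bound follows with Mantel's theorem.
--
-- Upper bound, n ≤ 8. The previous inequality fails, but dense systems are rare:
-- by deleting a vertex of minimum degree, the Berge-K₄-free systems with at least
-- 0, 2, 4, 7, 12 triples on 3, 4, 5, 6, 7 vertices are found up to isomorphism by
-- extending those on one vertex less; there are 2, 3, 12, 11, 1 of them, and the
-- last one, K(2,2,3), does not extend to 19 triples on 8 vertices.
--
-- Lower bound. A triple of a complete 3-partite system has one vertex in each
-- part, while two of any four vertices lie in the same part.
module Submission where

open import Defs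
import Algebra.Properties.Semiring.Sum
open import Data.Bool.Base using (Bool; true; false; _∧_; _∨_; not; if_then_else_; T)
open import Data.Bool.ListAction using (any; all)
import Data.Bool.Properties as Boolₚ
open import Data.Fin.Base as Fin using (Fin; zero; suc; punchIn; punchOut)
open import Data.Fin.Patterns
open import Data.Fin.Properties as Finₚ using (suc-injective; punchIn-injective; punchInᵢ≢i)
open import Data.Fin.Subset using (Subset; _∪_; _∩_; ⁅_⁆; ∣_∣; inside; outside)
  renaming (⊥ to ∅; ⊤ to full; _∈_ to _∈ˢ_)
open import Data.Fin.Subset.Properties
  using (∪-comm; ∪-assoc; ∪-identityˡ; ∩-comm; x∈p∪q⁺; x∈p∪q⁻; x∈p∩q⁺; x∈⁅x⁆; x∈⁅y⁆⇒x≡y; ∣⁅x⁆∣≡1; ∉⊥)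
  renaming (_∈?_ to _∈ˢ?_)
open import Data.List.Base as List
  using (List; []; _∷_; _++_; map; length; tabulate; filterᵇ; cartesianProduct)
import Data.List.Membership.DecPropositional as DecMembership
open import Data.List.Membership.Propositional using (_∈_; _∉_; find)
open import Data.List.Membership.Propositional.Properties
  using (∈-++⁺ˡ; ∈-++⁺ʳ; ∈-++⁻; ∈-map⁻; ∈-map⁺; ∈-∃++; ∈-tabulate⁺; ∈-cartesianProduct⁺; ∈-cartesianProduct⁻)
open import Data.List.Membership.Propositional.Properties.WithK using (unique∧set⇒bag)
open import Data.List.Properties using (map-++; ++-assoc; length-map; length-++)
open import Data.List.Relation.Binary.BagAndSetEquality using (∼bag⇒↭)
open import Data.List.Relation.Binary.Permutation.Propositional
  using (_↭_; prep; swap; ↭-refl; ↭-sym; ↭-trans; ↭-reflexive; ↭⇒↭ₛ; module PermutationReasoning)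
open import Data.List.Relation.Binary.Permutation.Propositional.Properties
  using (++⁺ˡ; ++⁺ʳ; ++-comm; shift; shifts; map⁺; ↭-length; ∈-resp-↭; All-resp-↭)
import Data.List.Relation.Binary.Permutation.Setoid.Properties as PermSetoid
open import Data.List.Relation.Unary.All as All using (All; []; _∷_)
import Data.List.Relation.Unary.All.Properties as Allₚ
open import Data.List.Relation.Unary.AllPairs using ([]; _∷_)
open import Data.List.Relation.Unary.Any as Any using (Any; here; there)
import Data.List.Relation.Unary.Any.Properties as Anyₚ
open import Data.List.Relation.Unary.Unique.Propositional using (Unique)
import Data.List.Relation.Unary.Unique.Propositional.Properties as Uniqueₚ
open import Data.Nat.Base
  using (ℕ; zero; suc; pred; _+_; _*_; _∸_; _≤_; _<_; _≥_; _<ᵇ_; z≤n; s≤s)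
open import Data.Nat.DivMod using (_/_; /-monoˡ-≤; m/n≡1+[m∸n]/n)
open import Data.Nat.Properties hiding (suc-injective; _≟_)
import Data.Nat.Properties as ℕₚ
open import Data.Nat.Tactic.RingSolver using (solve-∀)
open import Data.Product.Base using (∃; ∃-syntax; _×_; _,_; proj₁; proj₂; uncurry)
open import Data.Sum.Base as Sum using (_⊎_; inj₁; inj₂)
open import Data.Unit.Base using (⊤; tt)
open import Data.Vec.Base as Vec using (Vec; []; _∷_)
import Data.Vec.Properties as Vecₚ
open import Function.Base using (_∘_; id; case_of_)
open import Function.Bundles using (mk⇔; Equivalence)
open import Function.Definitions using (Injective)
open import Relation.Binary.Definitions using (DecidableEquality; tri<; tri≈; tri>)
open import Relation.Binary.PropositionalEquality
open import Relation.Nullary.Decidable using (Dec; yes; no; does; ¬?; _×-dec_; _→-dec_; toWitness)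
open import Relation.Nullary.Negation using (¬_; contradiction)

open Algebra.Properties.Semiring.Sum +-*-semiring
  using (sum; sum-syntax; sum-cong-≗; sum-remove; ∑-distrib-+; ∑-comm; *-distribˡ-sum; *-distribʳ-sum)

-- The matching turns a Berge-K₄ into an ordinary K₄, and nothing is lost on the unmatched triples:
-- all their pairs are blue, so each of them is counted as a blue triangle. The count itself limits
-- the method: the balanced complete 3-partite graph, coloured all red, has `t₃ n` edges, and `t₃ n`
-- exceeds `f n` for n = 6, 7, 8.
--
-- The thresholds for these n are dictated from above. By averaging, some vertex can be deleted so
-- that at least the fraction (n - 3)/n of the triples survives. Hence 19 = `f 8` + 1 triples on 8
-- vertices leave 12 on 7, and these leave 7, 4 and 2 on 6, 5 and 4 vertices. The lists for 6 and 7
-- vertices then settle n = 6 and n = 7 as well.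
--
-- The search is evaluated during type checking, hence Boolean functions of ordered triples in place
-- of lists of subsets. Only soundness of the search is proved: a reported Berge-K₄ exists, and a
-- system reported as listed is isomorphic to a listed one. A miss could only make a check fail.

private variable
  m n : ℕ

-- Triple systems as Boolean functions of ordered triples.

Sys : ℕ → Set
Sys m = Fin m → Fin m → Fin m → Bool

Triple : ℕ → Set
Triple m = Fin m × Fin m × Fin m

holds : Sys m → Triple m → Set
holds H (x , y , z) = T (H x y z)

relabel : (Fin m → Fin n) → Sys n → Sys m
relabel σ H x y z = H (σ x) (σ y) (σ z)

mapT : (Fin m → Fin n) → Triple m → Triple n
mapT σ (x , y , z) = σ x , σ y , σ z

infix 4 _∈ₜ_ _⊆ₜ_
infix 7 _∈ᵇ_ _⊆ᵇ_

_∈ₜ_ : Fin m → Triple m → Set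
u ∈ₜ (x , y , z) = u ≡ x ⊎ u ≡ y ⊎ u ≡ z

-- Ordered triples stand for their sets of entries, so mutual inclusion takes the place of equality.
_⊆ₜ_ : Triple m → Triple m → Set
(x , y , z) ⊆ₜ t = x ∈ₜ t × y ∈ₜ t × z ∈ₜ t

⊆ₜ-∈ : ∀ {u} {s t : Triple m} → s ⊆ₜ t → u ∈ₜ s → u ∈ₜ t
⊆ₜ-∈ (p , q , r) (inj₁ refl) = p
⊆ₜ-∈ (p , q , r) (inj₂ (inj₁ refl)) = q
⊆ₜ-∈ (p , q , r) (inj₂ (inj₂ refl)) = r

⊆ₜ-trans : ∀ {s t u : Triple m} → s ⊆ₜ t → t ⊆ₜ u → s ⊆ₜ u
⊆ₜ-trans (p , q , r) h = ⊆ₜ-∈ h p , ⊆ₜ-∈ h q , ⊆ₜ-∈ h r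

∈ₜ-map⁺ : (σ : Fin m → Fin n) → ∀ {u} t → u ∈ₜ t → σ u ∈ₜ mapT σ t
∈ₜ-map⁺ σ t = Sum.map (cong σ) (Sum.map (cong σ) (cong σ))

∈ₜ-map⁻ : ∀ {σ : Fin m → Fin n} → Injective _≡_ _≡_ σ → ∀ {u} t → σ u ∈ₜ mapT σ t → u ∈ₜ t
∈ₜ-map⁻ inj t = Sum.map inj (Sum.map inj inj)

⊆ₜ-map⁺ : (σ : Fin m → Fin n) → ∀ s t → s ⊆ₜ t → mapT σ s ⊆ₜ mapT σ t
⊆ₜ-map⁺ σ s t (p , q , r) = ∈ₜ-map⁺ σ t p , ∈ₜ-map⁺ σ t q , ∈ₜ-map⁺ σ t r

⊆ₜ-map⁻ : ∀ {σ : Fin m → Fin n} → Injective _≡_ _≡_ σ → ∀ s t → mapT σ s ⊆ₜ mapT σ t → s ⊆ₜ t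
⊆ₜ-map⁻ inj s t (p , q , r) = ∈ₜ-map⁻ inj t p , ∈ₜ-map⁻ inj t q , ∈ₜ-map⁻ inj t r

lo hi : Fin 6 → Fin 4
lo = Vec.lookup (0F ∷ 0F ∷ 0F ∷ 1F ∷ 1F ∷ 2F ∷ [])
hi = Vec.lookup (1F ∷ 2F ∷ 3F ∷ 2F ∷ 3F ∷ 3F ∷ [])

-- The pairs of core vertices are numbered 0,…,5; pair p is {lo p , hi p}.
record Berge (H : Sys m) : Set where
  field
    core     : Fin 4 → Fin m
    core-inj : Injective _≡_ _≡_ core
    edge     : Fin 6 → Triple m
    edge-in  : ∀ p → holds H (edge p)
    lo∈      : ∀ p → core (lo p) ∈ₜ edge p
    hi∈      : ∀ p → core (hi p) ∈ₜ edge p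
    edge-inj : ∀ p q → edge p ⊆ₜ edge q → edge q ⊆ₜ edge p → p ≡ q

record Good (H : Sys m) : Set where
  field
    swap₁₂ : ∀ x y z → H x y z ≡ H y x z
    swap₂₃ : ∀ x y z → H x y z ≡ H x z y
    irrefl : ∀ x z → ¬ T (H x x z)
    free   : ¬ Berge H

relabel-good : ∀ {σ : Fin m → Fin n} → Injective _≡_ _≡_ σ → ∀ {H} → Good H → Good (relabel σ H)
relabel-good {σ = σ} inj {H} g = record
  { swap₁₂ = λ x y z → swap₁₂ (σ x) (σ y) (σ z)
  ; swap₂₃ = λ x y z → swap₂₃ (σ x) (σ y) (σ z)
  ; irrefl = λ x z → irrefl (σ x) (σ z)
  ; free = λ b → let open Berge b in free record
      { core = σ ∘ core
      ; core-inj = core-inj ∘ inj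
      ; edge = mapT σ ∘ edge
      ; edge-in = edge-in
      ; lo∈ = λ p → ∈ₜ-map⁺ σ (edge p) (lo∈ p)
      ; hi∈ = λ p → ∈ₜ-map⁺ σ (edge p) (hi∈ p)
      ; edge-inj = λ p q s t → edge-inj p q (⊆ₜ-map⁻ inj _ _ s) (⊆ₜ-map⁻ inj _ _ t)
      }
  }
  where open Good g

module _ {H : Sys m} (g : Good H) where
  open Good g

  holds⇒distinct : ∀ {x y z} → T (H x y z) → x ≢ y × x ≢ z × y ≢ z
  holds⇒distinct {x} {y} {z} h =
      (λ { refl → irrefl x z h })
    , (λ { refl → irrefl x y (subst T (swap₂₃ x y x) h) })
    , (λ { refl → irrefl y x (subst T (trans (swap₁₂ x y y) (swap₂₃ y x y)) h) })

  -- Three distinct entries of `t` exhaust it, so `(x , y , z)` is one of its six orderings, each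
  -- reached by the two transpositions. All other patterns of positions repeat a vertex.
  holds-⊆ : ∀ {x y z} t → x ≢ y → x ≢ z → y ≢ z → (x , y , z) ⊆ₜ t → holds H t → T (H x y z)
  holds-⊆ t xy xz yz (inj₁ refl , inj₁ refl , r) h = contradiction refl xy
  holds-⊆ t xy xz yz (inj₁ refl , inj₂ q , inj₁ refl) h = contradiction refl xz
  holds-⊆ t xy xz yz (inj₁ refl , inj₂ (inj₁ refl) , inj₂ (inj₁ refl)) h = contradiction refl yz
  holds-⊆ t xy xz yz (inj₁ refl , inj₂ (inj₁ refl) , inj₂ (inj₂ refl)) h = h
  holds-⊆ t xy xz yz (inj₁ refl , inj₂ (inj₂ refl) , inj₂ (inj₁ refl)) h = subst T (swap₂₃ _ _ _) h
  holds-⊆ t xy xz yz (inj₁ refl , inj₂ (inj₂ refl) , inj₂ (inj₂ refl)) h = contradiction refl yz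
  holds-⊆ t xy xz yz (inj₂ (inj₁ refl) , inj₁ refl , inj₁ refl) h = contradiction refl yz
  holds-⊆ t xy xz yz (inj₂ (inj₁ refl) , inj₁ refl , inj₂ (inj₁ refl)) h = contradiction refl xz
  holds-⊆ t xy xz yz (inj₂ (inj₁ refl) , inj₁ refl , inj₂ (inj₂ refl)) h = subst T (swap₁₂ _ _ _) h
  holds-⊆ t xy xz yz (inj₂ (inj₁ refl) , inj₂ (inj₁ refl) , r) h = contradiction refl xy
  holds-⊆ t xy xz yz (inj₂ (inj₁ refl) , inj₂ (inj₂ refl) , inj₁ refl) h =
    subst T (trans (swap₁₂ _ _ _) (swap₂₃ _ _ _)) h
  holds-⊆ t xy xz yz (inj₂ (inj₁ refl) , inj₂ (inj₂ refl) , inj₂ (inj₁ refl)) h = contradiction refl xz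
  holds-⊆ t xy xz yz (inj₂ (inj₁ refl) , inj₂ (inj₂ refl) , inj₂ (inj₂ refl)) h = contradiction refl yz
  holds-⊆ t xy xz yz (inj₂ (inj₂ refl) , inj₁ refl , inj₁ refl) h = contradiction refl yz
  holds-⊆ t xy xz yz (inj₂ (inj₂ refl) , inj₁ refl , inj₂ (inj₁ refl)) h =
    subst T (trans (swap₂₃ _ _ _) (swap₁₂ _ _ _)) h
  holds-⊆ t xy xz yz (inj₂ (inj₂ refl) , inj₁ refl , inj₂ (inj₂ refl)) h = contradiction refl xz
  holds-⊆ t xy xz yz (inj₂ (inj₂ refl) , inj₂ (inj₁ refl) , inj₁ refl) h =
    subst T (trans (swap₁₂ _ _ _) (trans (swap₂₃ _ _ _) (swap₁₂ _ _ _))) h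
  holds-⊆ t xy xz yz (inj₂ (inj₂ refl) , inj₂ (inj₁ refl) , inj₂ (inj₁ refl)) h = contradiction refl yz
  holds-⊆ t xy xz yz (inj₂ (inj₂ refl) , inj₂ (inj₁ refl) , inj₂ (inj₂ refl)) h = contradiction refl xz
  holds-⊆ t xy xz yz (inj₂ (inj₂ refl) , inj₂ (inj₂ refl) , r) h = contradiction refl xy

-- A Boolean search for Berge-K₄s in a list of triples.

eqF : Fin m → Fin m → Bool
eqF zero zero = true
eqF zero (suc _) = false
eqF (suc _) zero = false
eqF (suc i) (suc j) = eqF i j

eqF-sound : ∀ (i j : Fin m) → T (eqF i j) → i ≡ j
eqF-sound zero zero _ = refl
eqF-sound (suc i) (suc j) h = cong suc (eqF-sound i j h)

eqF-complete : ∀ (i : Fin m) → T (eqF i i)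
eqF-complete zero = tt
eqF-complete (suc i) = eqF-complete i

T-not : ∀ {b} → T (not b) → ¬ T b
T-not {false} _ ()

∧-elim : ∀ a {b} → T (a ∧ b) → T a × T b
∧-elim true h = tt , h

∨-elim : ∀ a {b} → T (a ∨ b) → T a ⊎ T b
∨-elim true h = inj₁ tt
∨-elim false h = inj₂ h

∨-intro₂ : ∀ a {b} → T b → T (a ∨ b)
∨-intro₂ true h = tt
∨-intro₂ false h = h

_∈ᵇ_ : Fin m → Triple m → Bool
u ∈ᵇ (x , y , z) = eqF u x ∨ eqF u y ∨ eqF u z

_⊆ᵇ_ : Triple m → Triple m → Bool
(x , y , z) ⊆ᵇ t = x ∈ᵇ t ∧ y ∈ᵇ t ∧ z ∈ᵇ t

∈ᵇ-sound : ∀ (u : Fin m) t → T (u ∈ᵇ t) → u ∈ₜ t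
∈ᵇ-sound u (x , y , z) h with ∨-elim (eqF u x) h
... | inj₁ p = inj₁ (eqF-sound u x p)
... | inj₂ h with ∨-elim (eqF u y) h
... | inj₁ p = inj₂ (inj₁ (eqF-sound u y p))
... | inj₂ p = inj₂ (inj₂ (eqF-sound u z p))

∈ᵇ-complete : ∀ (u : Fin m) t → u ∈ₜ t → T (u ∈ᵇ t)
∈ᵇ-complete u (x , y , z) (inj₁ refl) with eqF u u | eqF-complete u
... | true | _ = tt
∈ᵇ-complete u (x , y , z) (inj₂ (inj₁ refl)) with eqF u u | eqF-complete u
... | true | _ = ∨-intro₂ (eqF u x) tt
∈ᵇ-complete u (x , y , z) (inj₂ (inj₂ refl)) =
  ∨-intro₂ (eqF u x) (∨-intro₂ (eqF u y) (eqF-complete u))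

⊆ᵇ-sound : ∀ (s t : Triple m) → T (s ⊆ᵇ t) → s ⊆ₜ t
⊆ᵇ-sound (x , y , z) t h =
  let hx , h′ = ∧-elim (x ∈ᵇ t) h ; hy , hz = ∧-elim (y ∈ᵇ t) h′
  in ∈ᵇ-sound x t hx , ∈ᵇ-sound y t hy , ∈ᵇ-sound z t hz

∧-intro : ∀ {a b} → T a → T b → T (a ∧ b)
∧-intro {true} {true} _ _ = tt

⊆ᵇ-complete : ∀ (s t : Triple m) → s ⊆ₜ t → T (s ⊆ᵇ t)
⊆ᵇ-complete (x , y , z) t (p , q , r) =
  ∧-intro (∈ᵇ-complete x t p) (∧-intro (∈ᵇ-complete y t q) (∈ᵇ-complete z t r))

any-find : ∀ {A : Set} (p : A → Bool) xs → T (any p xs) → ∃[ x ] x ∈ xs × T (p x)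
any-find p (x ∷ xs) h with ∨-elim (p x) h
... | inj₁ q = x , here refl , q
... | inj₂ q = let y , y∈ , r = any-find p xs q in y , there y∈ , r

any-miss : ∀ {A : Set} (p : A → Bool) xs → ¬ T (any p xs) → All (λ x → ¬ T (p x)) xs
any-miss p [] h = []
any-miss p (x ∷ xs) h with p x in eq
... | true = contradiction tt h
... | false = (λ q → subst T eq q) ∷ any-miss p xs h

all-All : ∀ {A : Set} (p : A → Bool) xs → T (all p xs) → All (T ∘ p) xs
all-All p [] h = []
all-All p (x ∷ xs) h = let q , r = ∧-elim (p x) h in q ∷ all-All p xs r

filterᵇ-∈ : ∀ {A : Set} (p : A → Bool) xs {x} → x ∈ filterᵇ p xs → x ∈ xs × T (p x)
filterᵇ-∈ p (y ∷ ys) x∈ with p y in eq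
... | false = let q , r = filterᵇ-∈ p ys x∈ in there q , r
filterᵇ-∈ p (y ∷ ys) (here refl) | true = here refl , subst T (sym eq) tt
filterᵇ-∈ p (y ∷ ys) (there x∈) | true = let q , r = filterᵇ-∈ p ys x∈ in there q , r

-- In a slot (i , j , k , l), the pair i j is to be covered by a triple and k, l
-- are the other two core vertices. A triple through i and j that avoids k and l
-- covers no other pair of the core, so when there is one it may be used.
Slot : ℕ → Set
Slot m = Fin m × Fin m × Fin m × Fin m

preferOutside : Fin m → Fin m → List (Triple m) → List (Triple m) → List (Triple m)
preferOutside k l xs [] = xs
preferOutside k l xs (e ∷ es) = if k ∈ᵇ e ∨ l ∈ᵇ e then preferOutside k l xs es else e ∷ []

preferOutside-∈ : ∀ (k l : Fin m) xs es {e} → (∀ {x} → x ∈ es → x ∈ xs) →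
                  e ∈ preferOutside k l xs es → e ∈ xs
preferOutside-∈ k l xs [] sub e∈ = e∈
preferOutside-∈ k l xs (x ∷ es) sub e∈ with k ∈ᵇ x ∨ l ∈ᵇ x
preferOutside-∈ k l xs (x ∷ es) sub e∈ | true = preferOutside-∈ k l xs es (sub ∘ there) e∈
preferOutside-∈ k l xs (x ∷ es) sub (here refl) | false = sub (here refl)

covers : Fin m → Fin m → Triple m → Bool
covers i j e = i ∈ᵇ e ∧ j ∈ᵇ e

candidates : List (Triple m) → Slot m → List (Triple m)
candidates acc (i , j , k , l) = let es = filterᵇ (covers i j) acc in preferOutside k l es es

-- Backtracking for a system of distinct representatives, one triple per slot. Not being included in
-- a used triple already makes `e` different from it as a set.
representable : List (Triple m) → Vec (Slot m) n → List (Triple m) → Bool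
tryAll : List (Triple m) → Vec (Slot m) n → List (Triple m) → List (Triple m) → Bool
representable acc [] used = true
representable acc (s ∷ ss) used = tryAll acc ss used (candidates acc s)
tryAll acc ss used [] = false
tryAll acc ss used (e ∷ es) =
  (not (any (e ⊆ᵇ_) used) ∧ representable acc ss (e ∷ used)) ∨ tryAll acc ss used es

tryAll-find : ∀ acc (ss : Vec (Slot m) n) used es → T (tryAll acc ss used es) →
              ∃[ e ] e ∈ es × ¬ T (any (e ⊆ᵇ_) used) × T (representable acc ss (e ∷ used))
tryAll-find acc ss used (e ∷ es) h with ∨-elim (not (any (e ⊆ᵇ_) used) ∧ representable acc ss (e ∷ used)) h
... | inj₁ p = let q , r = ∧-elim (not (any (e ⊆ᵇ_) used)) p in e , here refl , T-not q , r
... | inj₂ p = let e′ , e∈ , q , r = tryAll-find acc ss used es p in e′ , there e∈ , q , r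

record Representation (acc : List (Triple m)) (ss : Vec (Slot m) n) (used : List (Triple m)) : Set where
  field
    rep     : Fin n → Triple m
    rep∈    : ∀ p → rep p ∈ acc
    first∈  : ∀ p → proj₁ (Vec.lookup ss p) ∈ₜ rep p
    second∈ : ∀ p → proj₁ (proj₂ (Vec.lookup ss p)) ∈ₜ rep p
    fresh   : ∀ p → All (λ u → ¬ rep p ⊆ₜ u) used
    rep-inj : ∀ p q → rep p ⊆ₜ rep q → rep q ⊆ₜ rep p → p ≡ q

representable-sound : ∀ acc (ss : Vec (Slot m) n) used → T (representable acc ss used) →
                      Representation acc ss used
representable-sound acc [] used h = record
  { rep = λ () ; rep∈ = λ () ; first∈ = λ () ; second∈ = λ () ; fresh = λ () ; rep-inj = λ () }
representable-sound acc (s@(i , j , k , l) ∷ ss) used h = record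
  { rep = λ { zero → e ; (suc p) → R.rep p }
  ; rep∈ = λ { zero → proj₁ e∈acc ; (suc p) → R.rep∈ p }
  ; first∈ = λ { zero → ∈ᵇ-sound i e (proj₁ e∋ij) ; (suc p) → R.first∈ p }
  ; second∈ = λ { zero → ∈ᵇ-sound j e (proj₂ e∋ij) ; (suc p) → R.second∈ p }
  ; fresh = λ { zero → All.map (λ {u} ¬s s → ¬s (⊆ᵇ-complete e u s)) (any-miss (e ⊆ᵇ_) used new)
              ; (suc p) → All.tail (R.fresh p) }
  ; rep-inj = λ { zero zero s t → refl
                ; zero (suc q) s t → contradiction t (All.head (R.fresh q))
                ; (suc p) zero s t → contradiction s (All.head (R.fresh p))
                ; (suc p) (suc q) s t → cong suc (R.rep-inj p q s t) }
  }
  where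
  es = filterᵇ (covers i j) acc
  found = tryAll-find acc ss used (candidates acc s) h
  e = proj₁ found
  new = proj₁ (proj₂ (proj₂ found))
  e∈acc = filterᵇ-∈ (covers i j) acc (preferOutside-∈ k l es es id (proj₁ (proj₂ found)))
  e∋ij = ∧-elim (i ∈ᵇ e) (proj₂ e∈acc)
  module R = Representation (representable-sound acc ss (e ∷ used) (proj₂ (proj₂ (proj₂ found))))

slots : Slot m → Vec (Slot m) 6
slots (a , b , c , d) =
  (a , b , c , d) ∷ (a , c , b , d) ∷ (a , d , b , c) ∷
  (b , c , a , d) ∷ (b , d , a , c) ∷ (c , d , a , b) ∷ []

distinct : Slot m → Bool
distinct (a , b , c , d) =
  not (eqF a b) ∧ not (eqF a c) ∧ not (eqF a d) ∧ not (eqF b c) ∧ not (eqF b d) ∧ not (eqF c d)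

vertex : Slot m → Fin 4 → Fin m
vertex (a , b , c , d) = Vec.lookup (a ∷ b ∷ c ∷ d ∷ [])

distinct-sound : ∀ (s : Slot m) → T (distinct s) → Injective _≡_ _≡_ (vertex s)
distinct-sound {m = m} (a , b , c , d) h {i} {j} = go i j
  where
  ne : ∀ {x y : Fin m} → T (not (eqF x y)) → x ≢ y
  ne {x} p refl = T-not p (eqF-complete x)
  h₁ = ∧-elim (not (eqF a b)) h
  h₂ = ∧-elim (not (eqF a c)) (proj₂ h₁)
  h₃ = ∧-elim (not (eqF a d)) (proj₂ h₂)
  h₄ = ∧-elim (not (eqF b c)) (proj₂ h₃)
  h₅ = ∧-elim (not (eqF b d)) (proj₂ h₄)
  go : ∀ i j → vertex (a , b , c , d) i ≡ vertex (a , b , c , d) j → i ≡ j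
  go 0F 0F e = refl
  go 0F 1F e = contradiction e (ne (proj₁ h₁))
  go 0F 2F e = contradiction e (ne (proj₁ h₂))
  go 0F 3F e = contradiction e (ne (proj₁ h₃))
  go 1F 0F e = contradiction (sym e) (ne (proj₁ h₁))
  go 1F 1F e = refl
  go 1F 2F e = contradiction e (ne (proj₁ h₄))
  go 1F 3F e = contradiction e (ne (proj₁ h₅))
  go 2F 0F e = contradiction (sym e) (ne (proj₁ h₂))
  go 2F 1F e = contradiction (sym e) (ne (proj₁ h₄))
  go 2F 2F e = refl
  go 2F 3F e = contradiction e (ne (proj₂ h₅))
  go 3F 0F e = contradiction (sym e) (ne (proj₁ h₃))
  go 3F 1F e = contradiction (sym e) (ne (proj₁ h₅))
  go 3F 2F e = contradiction (sym e) (ne (proj₂ h₅))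
  go 3F 3F e = refl

bit : Bool → ℕ
bit true = 1
bit false = 0

-- Only the cores with two vertices in t can become Berge-K₄s when t is added.
meetsTwice : Triple m → Slot m → Bool
meetsTwice t (a , b , c , d) = 1 <ᵇ bit (a ∈ᵇ t) + (bit (b ∈ᵇ t) + (bit (c ∈ᵇ t) + bit (d ∈ᵇ t)))

bergeAt : List (Slot m) → List (Triple m) → Triple m → Bool
bergeAt cores acc t = any (λ s → meetsTwice t s ∧ (representable acc (slots s) [] ∧ distinct s)) cores

bergeAt-sound : ∀ {H : Sys m} cores acc t → All (holds H) acc → T (bergeAt cores acc t) → Berge H
bergeAt-sound cores acc t acc⊆H h = record
  { core = vertex s
  ; core-inj = distinct-sound s (proj₂ p₂)
  ; edge = rep
  ; edge-in = λ p → All.lookup acc⊆H (rep∈ p)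
  ; lo∈ = λ p → subst (_∈ₜ rep p) (lo≡ s p) (first∈ p)
  ; hi∈ = λ p → subst (_∈ₜ rep p) (hi≡ s p) (second∈ p)
  ; edge-inj = rep-inj
  }
  where
  found = any-find (λ s → meetsTwice t s ∧ (representable acc (slots s) [] ∧ distinct s)) cores h
  s = proj₁ found
  p₁ = ∧-elim (meetsTwice t s) (proj₂ (proj₂ found))
  p₂ = ∧-elim (representable acc (slots s) []) (proj₂ p₁)
  open Representation (representable-sound acc (slots s) [] (proj₁ p₂))
  lo≡ : ∀ (s : Slot _) p → proj₁ (Vec.lookup (slots s) p) ≡ vertex s (lo p)
  lo≡ s 0F = refl
  lo≡ s 1F = refl
  lo≡ s 2F = refl
  lo≡ s 3F = refl
  lo≡ s 4F = refl
  lo≡ s 5F = refl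
  hi≡ : ∀ (s : Slot _) p → proj₁ (proj₂ (Vec.lookup (slots s) p)) ≡ vertex s (hi p)
  hi≡ s 0F = refl
  hi≡ s 1F = refl
  hi≡ s 2F = refl
  hi≡ s 3F = refl
  hi≡ s 4F = refl
  hi≡ s 5F = refl

-- Counting ordered triples, relabelling and deleting a vertex.

private
  thrice : ∀ l s → l + (l + (l + s)) ≡ 3 * l + s
  thrice = solve-∀

  twice : ∀ a b → a + (a + 2 * b) ≡ 2 * (a + b)
  twice = solve-∀

  deletion-sum : ∀ j s → (3 + j) * s + (3 + j) ≡ (3 + j) * suc s
  deletion-sum = solve-∀

  deletion-product : ∀ j d s → (3 + j) * (3 * d + s) ≡ 3 * ((3 + j) * d) + (3 + j) * s
  deletion-product = solve-∀

sum-mono : ∀ {n} {f g : Fin n → ℕ} → (∀ i → f i ≤ g i) → sum f ≤ sum g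
sum-mono {zero} h = z≤n
sum-mono {suc n} h = +-mono-≤ (h zero) (sum-mono (h ∘ suc))

sum-const : ∀ n c → ∑[ i < n ] c ≡ n * c
sum-const zero c = refl
sum-const (suc n) c = cong (c +_) (sum-const n c)

argmin : ∀ {n} (f : Fin (suc n) → ℕ) → ∃[ v ] ∀ u → f v ≤ f u
argmin {zero} f = zero , λ { zero → ≤-refl }
argmin {suc n} f with argmin (f ∘ suc)
... | v , least with ≤-total (f zero) (f (suc v))
... | inj₁ le = zero , λ { zero → ≤-refl ; (suc u) → ≤-trans le (least u) }
... | inj₂ ge = suc v , λ { zero → ge ; (suc u) → least u }

argmin-average : ∀ {n} (f : Fin (suc n) → ℕ) → ∃[ v ] suc n * f v ≤ sum f
argmin-average {n} f with argmin f
... | v , least = v , subst (_≤ sum f) (sum-const (suc n) (f v)) (sum-mono least)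

-- Every triple is counted six times.
S : Sys m → ℕ
S {m} H = ∑[ x < m ] ∑[ y < m ] ∑[ z < m ] bit (H x y z)

-- Injectivity transports Berge-K₄s and invariance of sums transports `S`; carrying both spares the
-- construction of inverses.
record IsPerm (σ : Fin n → Fin n) : Set where
  field
    injective : Injective _≡_ _≡_ σ
    sum-invariant : ∀ f → sum (f ∘ σ) ≡ sum f
open IsPerm

id-perm : IsPerm {n} id
id-perm = record { injective = id ; sum-invariant = λ f → refl }

∘-perm : ∀ {σ ρ : Fin n → Fin n} → IsPerm σ → IsPerm ρ → IsPerm (σ ∘ ρ)
∘-perm {σ = σ} p q = record
  { injective = injective q ∘ injective p
  ; sum-invariant = λ f → trans (sum-invariant q (f ∘ σ)) (sum-invariant p f)
  }

-- Puts `v` in place zero and lets `σ` arrange the other vertices. With `σ = id` it brings a vertex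
-- to be deleted to the front.
extend : Fin (suc n) → (Fin n → Fin n) → Fin (suc n) → Fin (suc n)
extend v σ zero = v
extend v σ (suc i) = punchIn v (σ i)

extend-perm : ∀ v {σ : Fin n → Fin n} → IsPerm σ → IsPerm (extend v σ)
extend-perm v {σ} p = record
  { injective = λ {i} {j} → inj i j
  ; sum-invariant = λ f → trans (cong (f v +_) (sum-invariant p (f ∘ punchIn v))) (sym (sum-remove f))
  }
  where
  inj : ∀ i j → extend v σ i ≡ extend v σ j → i ≡ j
  inj zero zero e = refl
  inj zero (suc j) e = contradiction (sym e) (punchInᵢ≢i v (σ j))
  inj (suc i) zero e = contradiction e (punchInᵢ≢i v (σ i))
  inj (suc i) (suc j) e = cong suc (injective p (punchIn-injective v (σ i) (σ j) e))

-- Lehmer codes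
Code : ℕ → Set
Code zero = ⊤
Code (suc n) = Fin (suc n) × Code n

act : Code n → Fin n → Fin n
act {suc n} (v , c) = extend v (act c)

act-perm : (c : Code n) → IsPerm (act c)
act-perm {zero} c = record { injective = λ { {()} } ; sum-invariant = λ f → refl }
act-perm {suc n} (v , c) = extend-perm v (act-perm c)

S-relabel : ∀ {σ : Fin m → Fin m} → IsPerm σ → ∀ H → S (relabel σ H) ≡ S H
S-relabel {m} {σ} p H = begin
  S (relabel σ H)
    ≡⟨ sum-cong-≗ (λ x → sum-cong-≗ λ y → sum-invariant p (λ z → bit (H (σ x) (σ y) z))) ⟩
  ∑[ x < m ] ∑[ y < m ] ∑[ z < m ] bit (H (σ x) (σ y) z)
    ≡⟨ sum-cong-≗ (λ x → sum-invariant p (λ y → ∑[ z < m ] bit (H (σ x) y z))) ⟩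
  ∑[ x < m ] ∑[ y < m ] ∑[ z < m ] bit (H (σ x) y z)
    ≡⟨ sum-invariant p (λ x → ∑[ y < m ] ∑[ z < m ] bit (H x y z)) ⟩
  S H ∎
  where open ≡-Reasoning

degree : Sys m → Fin m → ℕ
degree {m} H x = ∑[ y < m ] ∑[ z < m ] bit (H x y z)

link : Sys (suc m) → ℕ
link {m} H = ∑[ x < m ] ∑[ y < m ] bit (H zero (suc x) (suc y))

bit-false : ∀ {b} → ¬ T b → bit b ≡ 0
bit-false {false} h = refl
bit-false {true} h = contradiction tt h

bit-true : ∀ {b} → T b → bit b ≡ 1
bit-true {true} _ = refl

module _ {H : Sys (suc m)} (g : Good H) where
  open Good g

  private
    xxz : ∀ x z → bit (H x x z) ≡ 0
    xxz x z = bit-false (irrefl x z)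
    xyx : ∀ x y → bit (H x y x) ≡ 0
    xyx x y = bit-false (λ h → proj₁ (proj₂ (holds⇒distinct g h)) refl)
    xyy : ∀ x y → bit (H x y y) ≡ 0
    xyy x y = bit-false (λ h → proj₂ (proj₂ (holds⇒distinct g h)) refl)

    sum-zero : ∀ {n} {f : Fin n → ℕ} → (∀ i → f i ≡ 0) → sum f ≡ 0
    sum-zero {n} h = trans (sum-cong-≗ h) (trans (sum-const n 0) (*-zeroʳ n))

  degree-zero : degree H zero ≡ link H
  degree-zero = cong₂ _+_
    (sum-zero (xxz zero))
    (sum-cong-≗ λ y → cong (_+ ∑[ z < m ] bit (H zero (suc y) (suc z))) (xyx zero (suc y)))

  -- Vertex zero can stand in any of the three places, and each place contributes `link H`; the last
  -- summand collects the triples that avoid it.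
  S-link : S H ≡ 3 * link H + S (relabel suc H)
  S-link = begin
    degree H zero + ∑[ x < m ] degree H (suc x)
      ≡⟨ cong₂ _+_ degree-zero (sum-cong-≗ degree-suc) ⟩
    link H + ∑[ x < m ] (∑[ y < m ] G x y + (∑[ y < m ] G x y + ∑[ y < m ] ∑[ z < m ] K x y z))
      ≡⟨ cong (link H +_) (trans (∑-distrib-+ (λ x → ∑[ y < m ] G x y) _)
           (cong (link H +_) (∑-distrib-+ (λ x → ∑[ y < m ] G x y) _))) ⟩
    link H + (link H + (link H + S (relabel suc H)))
      ≡⟨ thrice (link H) (S (relabel suc H)) ⟩
    3 * link H + S (relabel suc H) ∎
    where
    open ≡-Reasoning
    G : Fin m → Fin m → ℕ
    G x y = bit (H zero (suc x) (suc y))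
    K : Fin m → Fin m → Fin m → ℕ
    K x y z = bit (H (suc x) (suc y) (suc z))
    degree-suc : ∀ x → degree H (suc x) ≡ ∑[ y < m ] G x y + (∑[ y < m ] G x y + ∑[ y < m ] ∑[ z < m ] K x y z)
    degree-suc x = cong₂ _+_
      (cong₂ _+_ (xyy (suc x) zero) (sum-cong-≗ λ z → cong bit (swap₁₂ (suc x) zero (suc z))))
      (trans (∑-distrib-+ (λ y → bit (H (suc x) (suc y) zero)) _)
        (cong (_+ ∑[ y < m ] ∑[ z < m ] K x y z)
          (sum-cong-≗ λ y → cong bit (trans (swap₂₃ (suc x) (suc y) zero) (swap₁₂ (suc x) zero (suc y))))))

-- Here `t` and `s` are the values of `S` before and after deleting a vertex of least degree `d`.
-- The loss 3 d is at most 3 t / (3 + j), so (3 + j) s ≥ j t ≥ j a′. The last hypothesis says that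
-- `a` is at most j a′ / (3 + j) rounded up.
deletion-bound : ∀ j {a a′ t d s} → a′ ≤ t → (3 + j) * d ≤ t → t ≡ 3 * d + s →
                 (3 + j) * a < j * a′ + (3 + j) → a ≤ s
deletion-bound j {a} {a′} {t} {d} {s} a′≤t avg total num = m<1+n⇒m≤n (*-cancelˡ-< (3 + j) a (suc s) (begin-strict
    (3 + j) * a           <⟨ num ⟩
    j * a′ + (3 + j)      ≤⟨ +-monoˡ-≤ (3 + j) (≤-trans (*-monoʳ-≤ j a′≤t) key) ⟩
    (3 + j) * s + (3 + j) ≡⟨ deletion-sum j s ⟩
    (3 + j) * suc s ∎))
  where
  open ≤-Reasoning
  key : j * t ≤ (3 + j) * s
  key = +-cancelˡ-≤ (3 * t) _ _ (begin
    3 * t + j * t ≡⟨ sym (*-distribʳ-+ t 3 j) ⟩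
    (3 + j) * t ≡⟨ cong ((3 + j) *_) total ⟩
    (3 + j) * (3 * d + s) ≡⟨ deletion-product j d s ⟩
    3 * ((3 + j) * d) + (3 + j) * s ≤⟨ +-monoˡ-≤ ((3 + j) * s) (*-monoʳ-≤ 3 avg) ⟩
    3 * t + (3 + j) * s ∎)

S-delete : ∀ {H : Sys (suc m)} → Good H → ∀ v → S H ≡ 3 * degree H v + S (relabel (punchIn v) H)
S-delete {m} {H} g v =
  trans (sym (S-relabel p H)) (trans (S-link g′) (cong (λ d → 3 * d + S (relabel (punchIn v) H)) (sym degree≡)))
  where
  σ = extend v id
  p = extend-perm v id-perm
  g′ = relabel-good (injective p) g
  degree≡ : degree H v ≡ link (relabel σ H)
  degree≡ = trans (sym (trans (sum-cong-≗ λ y → sum-invariant p (λ z → bit (H v (σ y) z)))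
                    (sum-invariant p λ y → ∑[ z < suc m ] bit (H v y z))))
                  (degree-zero g′)

good-deletion : ∀ j {a a′} (H : Sys (3 + j)) → Good H → a′ ≤ S H → (3 + j) * a < j * a′ + (3 + j) →
                ∃[ v ] a ≤ S (relabel (punchIn v) H)
good-deletion j H g a′≤ num =
  let v , avg = argmin-average (degree H)
  in v , deletion-bound j {d = degree H v} {s = S (relabel (punchIn v) H)} a′≤ avg (S-delete g v) num

-- Sums over lists and over unordered pairs.

weight : {A : Set} → (A → ℕ) → List A → ℕ
weight f [] = 0
weight f (x ∷ xs) = f x + weight f xs

weight-++ : ∀ {A : Set} (f : A → ℕ) xs ys → weight f (xs ++ ys) ≡ weight f xs + weight f ys
weight-++ f [] ys = refl
weight-++ f (x ∷ xs) ys = trans (cong (f x +_) (weight-++ f xs ys)) (sym (+-assoc (f x) _ _))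

weight-map : ∀ {A B : Set} (f : B → ℕ) (h : A → B) xs → weight f (map h xs) ≡ weight (f ∘ h) xs
weight-map f h [] = refl
weight-map f h (x ∷ xs) = cong (f (h x) +_) (weight-map f h xs)

weight-tabulate : ∀ {A : Set} (f : A → ℕ) (h : Fin n → A) → weight f (tabulate h) ≡ sum (f ∘ h)
weight-tabulate {zero} f h = refl
weight-tabulate {suc n} f h = cong (f (h zero) +_) (weight-tabulate f (h ∘ suc))

pairs : ∀ m → List (Fin m × Fin m)
pairs zero = []
pairs (suc m) = tabulate (λ y → zero , suc y) ++ map (λ (x , y) → suc x , suc y) (pairs m)

pairs-complete : ∀ (x y : Fin m) → x ≢ y → (x , y) ∈ pairs m ⊎ (y , x) ∈ pairs m
pairs-complete zero zero x≢y = contradiction refl x≢y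
pairs-complete zero (suc y) x≢y = inj₁ (∈-++⁺ˡ (∈-tabulate⁺ y))
pairs-complete (suc x) zero x≢y = inj₂ (∈-++⁺ˡ (∈-tabulate⁺ x))
pairs-complete (suc x) (suc y) x≢y =
  Sum.map (∈-++⁺ʳ _ ∘ ∈-map⁺ _) (∈-++⁺ʳ _ ∘ ∈-map⁺ _) (pairs-complete x y (x≢y ∘ cong suc))

pairs-sum : ∀ (g : Fin m → Fin m → ℕ) → (∀ x y → g x y ≡ g y x) → (∀ x → g x x ≡ 0) →
            ∑[ x < m ] ∑[ y < m ] g x y ≡ 2 * weight (λ (x , y) → g x y) (pairs m)
pairs-sum {zero} g gsym girr = refl
pairs-sum {suc m} g gsym girr = begin
  g zero zero + A + ∑[ x < m ] (g (suc x) zero + ∑[ y < m ] g (suc x) (suc y))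
    ≡⟨ cong₂ _+_ (cong (_+ A) (girr zero)) (∑-distrib-+ (λ x → g (suc x) zero) _) ⟩
  A + (∑[ x < m ] g (suc x) zero + ∑[ x < m ] ∑[ y < m ] g (suc x) (suc y))
    ≡⟨ cong (A +_) (cong₂ _+_ (sum-cong-≗ λ x → gsym (suc x) zero)
         (pairs-sum (λ x y → g (suc x) (suc y)) (λ x y → gsym _ _) (girr ∘ suc))) ⟩
  A + (A + 2 * B)
    ≡⟨ twice A B ⟩
  2 * (A + B)
    ≡⟨ cong (2 *_) (sym (cong₂ _+_ (weight-tabulate (λ (x , y) → g x y) (λ (y : Fin m) → zero , suc y))
         (weight-map (λ (x , y) → g x y) (λ (x , y) → suc x , suc y) (pairs m)))) ⟩
  2 * (weight _ (tabulate {n = m} (λ y → zero , suc y)) + weight _ (map (λ (x , y) → suc x , suc y) (pairs m)))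
    ≡⟨ cong (2 *_) (sym (weight-++ (λ (x , y) → g x y) (tabulate {n = m} (λ y → zero , suc y)) _)) ⟩
  2 * weight (λ (x , y) → g x y) (pairs (suc m)) ∎
  where
  open ≡-Reasoning
  A = ∑[ y < m ] g zero (suc y)
  B = weight (λ (x , y) → g (suc x) (suc y)) (pairs m)

-- Classifying dense systems by one-vertex extensions.

record Presents (R : List (Triple m)) (σ : Fin m → Fin m) (H : Sys m) : Set where
  field
    sound    : All (holds H ∘ mapT σ) R
    complete : ∀ t → holds H (mapT σ t) → Any (t ⊆ₜ_) R

Classified : ∀ m → ℕ → List (List (Triple m)) → Set
Classified m a Rs = ∀ (H : Sys m) → Good H → a ≤ S H →
  ∃[ R ] R ∈ Rs × ∃[ σ ] IsPerm σ × Presents R σ H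

-- The codes are hints: only these relabellings are tried, so that no isomorphism test has to be
-- run.
Table : ℕ → Set
Table m = List (List (Triple m) × List (Code m))

distinctₜ : Triple m → Bool
distinctₜ (x , y , z) = not (eqF x y) ∧ not (eqF x z) ∧ not (eqF y z)

_∈~_ : Triple m → List (Triple m) → Bool
t ∈~ R = any (t ⊆ᵇ_) R

-- The image of `R` and `acc` are compared in both directions. Distinctness of the image entries
-- makes an inclusion in a triple of `acc` a reordering of that triple.
isPresentation : List (Triple m) → List (Triple m) → (Fin m → Fin m) → Bool
isPresentation acc R ρ =
  all (λ r → (mapT ρ r ∈~ acc) ∧ distinctₜ (mapT ρ r)) R ∧ all (λ u → u ∈~ map (mapT ρ) R) acc

listed : Table m → List (Triple m) → Bool
listed tab acc = any (λ (R , cs) → any (λ c → isPresentation acc R (act c)) cs) tab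

-- Decides one candidate after the other, with `acc` the triples taken so far. `need` is a lower
-- bound for six times the number of candidates still to be taken. A branch is cut by a Berge-K₄ or
-- by a lack of candidates; any leaf left must be a listed system.
search : Table m → List (Slot m) → List (Triple m) → List (Triple m) → ℕ → Bool
search tab cores acc [] need = (0 <ᵇ need) ∨ listed tab acc
search tab cores acc (c ∷ cs) need =
  (bergeAt cores (c ∷ acc) c ∨ search tab cores (c ∷ acc) cs (need ∸ 6)) ∧
  ((6 * length cs <ᵇ need) ∨ search tab cores acc cs need)

∈~-sound : ∀ (t : Triple m) R → T (t ∈~ R) → Any (t ⊆ₜ_) R
∈~-sound t R h =
  let u , u∈ , q = any-find (t ⊆ᵇ_) R h in Any.map (λ { refl → ⊆ᵇ-sound t u q }) u∈

module _ {H : Sys m} (g : Good H) where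

  isPresentation-sound : ∀ acc R {ρ} → IsPerm ρ → T (isPresentation acc R ρ) →
    All (holds H) acc → (∀ t → holds H t → Any (t ⊆ₜ_) acc) → Presents R ρ H
  isPresentation-sound acc R {ρ} p h acc⊆H H⊆acc = record
    { sound = All.map (λ {r} → sound′ r) (all-All _ R (proj₁ h′))
    ; complete = λ t ht → complete′ t (H⊆acc _ ht)
    }
    where
    h′ = ∧-elim (all (λ r → (mapT ρ r ∈~ acc) ∧ distinctₜ (mapT ρ r)) R) h
    sound′ : ∀ r → T ((mapT ρ r ∈~ acc) ∧ distinctₜ (mapT ρ r)) → holds H (mapT ρ r)
    sound′ r@(x , y , z) q =
      let q₁ , q₂ = ∧-elim (mapT ρ r ∈~ acc) q
          d₁ , d′ = ∧-elim (not (eqF (ρ x) (ρ y))) q₂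
          d₂ , d₃ = ∧-elim (not (eqF (ρ x) (ρ z))) d′
          u , u∈ , s = find (∈~-sound (mapT ρ r) acc q₁)
      in holds-⊆ g u (ne d₁) (ne d₂) (ne d₃) s (All.lookup acc⊆H u∈)
      where
      ne : ∀ {x y : Fin m} → T (not (eqF x y)) → x ≢ y
      ne {x} p refl = T-not p (eqF-complete x)
    complete′ : ∀ t → Any (mapT ρ t ⊆ₜ_) acc → Any (t ⊆ₜ_) R
    complete′ t any-acc =
      let u , u∈ , s = find any-acc
          u∈~ = All.lookup (all-All _ acc (proj₂ h′)) u∈
          r = Anyₚ.map⁻ (∈~-sound u (map (mapT ρ) R) u∈~)
      in Any.map (λ {r} s′ → ⊆ₜ-map⁻ (injective p) t r (⊆ₜ-trans {s = mapT ρ t} {u} {mapT ρ r} s s′)) r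

  listed-sound : ∀ tab acc → T (listed tab acc) →
    All (holds H) acc → (∀ t → holds H t → Any (t ⊆ₜ_) acc) →
    ∃[ R ] R ∈ map proj₁ tab × ∃[ σ ] IsPerm σ × Presents R σ H
  listed-sound tab acc h acc⊆H H⊆acc =
    let (R , cs) , R∈ , h₁ = any-find _ tab h
        c , _ , h₂ = any-find _ cs h₁
    in R , ∈-map⁺ proj₁ R∈ , act c , act-perm c , isPresentation-sound acc R (act-perm c) h₂ acc⊆H H⊆acc

  count : List (Triple m) → ℕ
  count = weight (λ (x , y , z) → bit (H x y z))

  count≤length : ∀ cs → count cs ≤ length cs
  count≤length [] = z≤n
  count≤length ((x , y , z) ∷ cs) with H x y z
  ... | true = s≤s (count≤length cs)
  ... | false = m≤n⇒m≤1+n (count≤length cs)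

  -- The proof follows the one branch whose decisions agree with `H`. Neither kind of cut can occur
  -- on it, so it ends in a listed system.
  search-sound : ∀ tab cores acc cs need → T (search tab cores acc cs need) →
    All (holds H) acc → (∀ t → holds H t → Any (t ⊆ₜ_) acc ⊎ Any (λ u → t ⊆ₜ u × holds H u) cs) →
    need ≤ 6 * count cs →
    ∃[ R ] R ∈ map proj₁ tab × ∃[ σ ] IsPerm σ × Presents R σ H
  search-sound tab cores acc [] need h acc⊆H cover le with ∨-elim (0 <ᵇ need) h
  ... | inj₁ p = contradiction (<-≤-trans (<ᵇ⇒< 0 need p) le) λ ()
  ... | inj₂ p = listed-sound tab acc p acc⊆H λ t ht → Sum.[ id , (λ ()) ] (cover t ht)
  search-sound tab cores acc (c@(x , y , z) ∷ cs) need h acc⊆H cover le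
    with ∧-elim (bergeAt cores (c ∷ acc) c ∨ search tab cores (c ∷ acc) cs (need ∸ 6)) h | H x y z in eq
  ... | h₁ , h₂ | true with ∨-elim (bergeAt cores (c ∷ acc) c) h₁
  ... | inj₁ p = contradiction (bergeAt-sound cores (c ∷ acc) c (subst T (sym eq) tt ∷ acc⊆H) p) (Good.free g)
  ... | inj₂ p = search-sound tab cores (c ∷ acc) cs (need ∸ 6) p (subst T (sym eq) tt ∷ acc⊆H)
    (λ t ht → Sum.[ inj₁ ∘ there , (λ { (here (s , _)) → inj₁ (here s) ; (there q) → inj₂ q }) ] (cover t ht))
    (m≤n+o⇒m∸n≤o need 6 (≤-trans le (≤-reflexive (*-suc 6 (count cs)))))
  search-sound tab cores acc (c@(x , y , z) ∷ cs) need h acc⊆H cover le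
    | h₁ , h₂ | false with ∨-elim (6 * length cs <ᵇ need) h₂
  ... | inj₁ p = contradiction (<ᵇ⇒< _ need p) (≤⇒≯ (≤-trans le (*-monoʳ-≤ 6 (count≤length cs))))
  ... | inj₂ p = search-sound tab cores acc cs need p acc⊆H
    (λ t ht → Sum.map₂ (λ { (here (_ , hc)) → contradiction hc (subst T eq) ; (there q) → q }) (cover t ht))
    le

subsets : ∀ k m → List (Vec (Fin m) k)
subsets zero m = [] ∷ []
subsets (suc k) zero = []
subsets (suc k) (suc m) =
  map (λ v → zero ∷ Vec.map suc v) (subsets k m) ++ map (Vec.map suc) (subsets (suc k) m)

cores : ∀ m → List (Slot m)
cores m = map (λ { (a ∷ b ∷ c ∷ d ∷ []) → a , b , c , d }) (subsets 4 m)

system : List (Triple m) → Sys m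
system R x y z = distinctₜ (x , y , z) ∧ (x , y , z) ∈~ R

linkCandidates : ∀ m → List (Triple (suc m))
linkCandidates m = map (λ (x , y) → zero , suc x , suc y) (pairs m)

-- The new vertex is zero and the old system is shifted by `suc`. The old triples contribute at most
-- `S (system R)`, so the triples through zero must supply the rest of `a`.
extensions : Table (suc m) → ℕ → List (Slot (suc m)) → List (Triple (suc m)) → List (Triple m) → Bool
extensions tab a cs links R = search tab cs (map (mapT suc) R) links (a ∸ S (system R))

allExtensions : ∀ m → ℕ → List (List (Triple m)) → Table (suc m) → Bool
allExtensions m a Rs tab = all (extensions tab a (cores (suc m)) (linkCandidates m)) Rs

any-complete : ∀ {A : Set} (p : A → Bool) {xs} → Any (T ∘ p) xs → T (any p xs)
any-complete p {x ∷ xs} (here q) with p x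
... | true = tt
any-complete p {x ∷ xs} (there q) = ∨-intro₂ (p x) (any-complete p q)

T-not⁺ : ∀ {b} → ¬ T b → T (not b)
T-not⁺ {true} h = contradiction tt h
T-not⁺ {false} h = tt

bit-mono : ∀ {b c} → (T b → T c) → bit b ≤ bit c
bit-mono {false} h = z≤n
bit-mono {true} {true} h = ≤-refl
bit-mono {true} {false} h = contradiction (h tt) λ ()

-- Bounds the unknown system by a number that is computed from the list.
Presents-S : ∀ {R} {σ : Fin m → Fin m} {H} → Good H → IsPerm σ → Presents R σ H → S H ≤ S (system R)
Presents-S {R = R} {σ} {H} g p pr = ≤-trans (≤-reflexive (sym (S-relabel p H)))
  (sum-mono λ x → sum-mono λ y → sum-mono λ z → bit-mono (in-system x y z))
  where
  in-system : ∀ x y z → T (relabel σ H x y z) → T (system R x y z)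
  in-system x y z h =
    let xy , xz , yz = holds⇒distinct (relabel-good (injective p) g) h
    in ∧-intro
      (∧-intro (T-not⁺ (xy ∘ eqF-sound x y)) (∧-intro (T-not⁺ (xz ∘ eqF-sound x z)) (T-not⁺ (yz ∘ eqF-sound y z))))
      (any-complete _ (Any.map (λ {u} → ⊆ᵇ-complete (x , y , z) u) (Presents.complete pr (x , y , z) h)))

module _ {H : Sys (suc m)} (g : Good H) (R : List (Triple m)) (pr : Presents R id (relabel suc H)) where
  open Good g

  private
    links = linkCandidates m

    link≤ : link H ≡ 2 * count g links
    link≤ = trans
      (pairs-sum (λ x y → bit (H zero (suc x) (suc y)))
        (λ x y → cong bit (swap₂₃ zero (suc x) (suc y)))
        (λ x → bit-false λ h → proj₂ (proj₂ (holds⇒distinct g h)) refl))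
      (cong (2 *_) (sym (weight-map _ (λ (x , y) → zero , suc x , suc y) (pairs m))))

    cover : ∀ t → holds H t → Any (t ⊆ₜ_) (map (mapT suc) R) ⊎ Any (λ u → t ⊆ₜ u × holds H u) links
    cover (zero , zero , z) h = contradiction h (irrefl zero z)
    cover (zero , suc y , zero) h = contradiction refl (proj₁ (proj₂ (holds⇒distinct g h)))
    cover (suc x , zero , zero) h = contradiction refl (proj₂ (proj₂ (holds⇒distinct g h)))
    cover (zero , suc y , suc z) h
      with pairs-complete y z (proj₂ (proj₂ (holds⇒distinct g h)) ∘ cong suc)
    ... | inj₁ p = inj₂ (Any.map (λ { refl → (inj₁ refl , inj₂ (inj₁ refl) , inj₂ (inj₂ refl)) , h }) (∈-map⁺ _ p))
    ... | inj₂ p = inj₂ (Any.map (λ { refl → (inj₁ refl , inj₂ (inj₂ refl) , inj₂ (inj₁ refl)) ,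
                                             subst T (swap₂₃ _ _ _) h }) (∈-map⁺ _ p))
    cover (suc x , zero , suc z) h
      with pairs-complete x z (proj₁ (proj₂ (holds⇒distinct g h)) ∘ cong suc)
    ... | inj₁ p = inj₂ (Any.map (λ { refl → (inj₂ (inj₁ refl) , inj₁ refl , inj₂ (inj₂ refl)) ,
                                             subst T (swap₁₂ _ _ _) h }) (∈-map⁺ _ p))
    ... | inj₂ p = inj₂ (Any.map (λ { refl → (inj₂ (inj₂ refl) , inj₁ refl , inj₂ (inj₁ refl)) ,
                                             subst T (trans (swap₁₂ _ _ _) (swap₂₃ _ _ _)) h }) (∈-map⁺ _ p))
    cover (suc x , suc y , zero) h
      with pairs-complete x y (proj₁ (holds⇒distinct g h) ∘ cong suc)
    ... | inj₁ p = inj₂ (Any.map (λ { refl → (inj₂ (inj₁ refl) , inj₂ (inj₂ refl) , inj₁ refl) ,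
                                             subst T (trans (swap₂₃ _ _ _) (swap₁₂ _ _ _)) h }) (∈-map⁺ _ p))
    ... | inj₂ p = inj₂ (Any.map (λ { refl → (inj₂ (inj₂ refl) , inj₂ (inj₁ refl) , inj₁ refl) ,
                                             subst T (trans (swap₂₃ _ _ _) (trans (swap₁₂ _ _ _) (swap₂₃ _ _ _))) h })
                                    (∈-map⁺ _ p))
    cover (suc x , suc y , suc z) h =
      inj₁ (Anyₚ.map⁺ (Any.map (λ {u} → ⊆ₜ-map⁺ suc (x , y , z) u) (Presents.complete pr (x , y , z) h)))

  extensions-sound : ∀ tab a → a ≤ S H → T (extensions tab a (cores (suc m)) links R) →
    ∃[ R′ ] R′ ∈ map proj₁ tab × ∃[ σ ] IsPerm σ × Presents R′ σ H
  extensions-sound tab a a≤ h = search-sound g tab (cores (suc m)) _ links _ h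
    (Allₚ.map⁺ (Presents.sound pr)) cover (m≤n+o⇒m∸n≤o a (S (system R)) (begin
      a ≤⟨ a≤ ⟩
      S H ≡⟨ S-link g ⟩
      3 * link H + S (relabel suc H) ≡⟨ cong (λ l → 3 * l + S (relabel suc H)) link≤ ⟩
      3 * (2 * c) + S (relabel suc H) ≡⟨ cong (_+ S (relabel suc H)) (sym (*-assoc 3 2 c)) ⟩
      6 * c + S (relabel suc H)
        ≤⟨ +-monoʳ-≤ (6 * c) (Presents-S (relabel-good suc-injective g) id-perm pr) ⟩
      6 * c + S (system R) ≡⟨ +-comm (6 * c) _ ⟩
      S (system R) + 6 * c ∎))
    where
    open ≤-Reasoning
    c = count g links

-- If `R` and `σ` present the system without `v`, then `extend v σ` makes `v` vertex zero and puts
-- `R` on the others, which is where the search starts. Its relabelling `ρ` is composed with this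
-- one.
classify-extend : ∀ {m a Rs} → Classified m a Rs → ∀ {a′} tab →
  (∀ H → Good H → a′ ≤ S H → ∃[ v ] a ≤ S (relabel (punchIn v) H)) →
  T (allExtensions m a′ Rs tab) → Classified (suc m) a′ (map proj₁ tab)
classify-extend {m} {a} {Rs} cl {a′} tab delete h H g a′≤ =
  let v , a≤ = delete H g a′≤
      R , R∈ , σ , p , pr = cl (relabel (punchIn v) H) (relabel-good (punchIn-injective v _ _) g) a≤
      τ = extend v σ
      q = extend-perm v p
      g′ = relabel-good (injective q) g
      ext = All.lookup (all-All (extensions tab a′ (cores (suc m)) (linkCandidates m)) Rs h) R∈
      -- By definition `τ ∘ suc` is `punchIn v ∘ σ`, so the fields of `pr` fit unchanged; only the
      -- record type differs.
      R′ , R′∈ , ρ , r , pr′ = extensions-sound g′ R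
        (record { sound = Presents.sound pr ; complete = Presents.complete pr }) tab a′
        (≤-trans a′≤ (≤-reflexive (sym (S-relabel q H)))) ext
  in R′ , R′∈ , τ ∘ ρ , ∘-perm q r , record { sound = Presents.sound pr′ ; complete = Presents.complete pr′ }

-- For closed data both Boolean premises hold by evaluation: the averaging inequality and the whole
-- search.
classify-step : ∀ j {a Rs} → Classified (2 + j) a Rs → ∀ a′ tab →
  T ((3 + j) * a <ᵇ j * a′ + (3 + j)) → T (allExtensions (2 + j) a′ Rs tab) →
  Classified (3 + j) a′ (map proj₁ tab)
classify-step j {a} {Rs} cl a′ tab num h =
  classify-extend {2 + j} {a} {Rs} cl {a′} tab
    (λ H g a′≤ → good-deletion j {a} {a′} H g a′≤ (<ᵇ⇒< ((3 + j) * a) (j * a′ + (3 + j)) num)) h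

-- The classification on 2 to 8 vertices.

classified-2 : Classified 2 0 ([] ∷ [])
classified-2 H g _ = [] , here refl , id , id-perm , record { sound = [] ; complete = none }
  where
  none : ∀ t → holds H (mapT id t) → Any (t ⊆ₜ_) []
  none (0F , 0F , z) h = contradiction h (Good.irrefl g 0F z)
  none (1F , 1F , z) h = contradiction h (Good.irrefl g 1F z)
  none (0F , 1F , 0F) h = contradiction refl (proj₁ (proj₂ (holds⇒distinct g h)))
  none (0F , 1F , 1F) h = contradiction refl (proj₂ (proj₂ (holds⇒distinct g h)))
  none (1F , 0F , 0F) h = contradiction refl (proj₂ (proj₂ (holds⇒distinct g h)))
  none (1F , 0F , 1F) h = contradiction refl (proj₁ (proj₂ (holds⇒distinct g h)))

-- Found by computer: each system comes with the relabellings that take it to the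
-- extensions met by the search.
table-3 : Table 3
table-3 =
  ((0F , 1F , 2F) ∷ [] ,
    (0F , 0F , 0F , tt) ∷ []) ∷
  ([] ,
    (0F , 0F , 0F , tt) ∷ []) ∷
  []

table-4 : Table 4
table-4 =
  ((0F , 1F , 2F) ∷ (0F , 1F , 3F) ∷ (0F , 2F , 3F) ∷ (1F , 2F , 3F) ∷ [] ,
    (0F , 0F , 0F , 0F , tt) ∷ []) ∷
  ((0F , 1F , 2F) ∷ (0F , 1F , 3F) ∷ (1F , 2F , 3F) ∷ [] ,
    (0F , 0F , 0F , 0F , tt) ∷ (0F , 1F , 0F , 0F , tt) ∷ (0F , 2F , 0F , 0F , tt) ∷ (1F , 0F , 0F , 0F , tt) ∷ []) ∷
  ((0F , 1F , 2F) ∷ (1F , 2F , 3F) ∷ [] ,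
    (0F , 0F , 0F , 0F , tt) ∷ (0F , 0F , 1F , 0F , tt) ∷ (0F , 1F , 1F , 0F , tt) ∷ (2F , 0F , 0F , 0F , tt) ∷
    (1F , 0F , 0F , 0F , tt) ∷ (1F , 0F , 1F , 0F , tt) ∷ []) ∷
  []

table-5 : Table 5
table-5 =
  ((0F , 1F , 2F) ∷ (1F , 2F , 3F) ∷ (1F , 2F , 4F) ∷ (1F , 3F , 4F) ∷ (2F , 3F , 4F) ∷ [] ,
    (0F , 0F , 0F , 0F , 0F , tt) ∷ (0F , 0F , 1F , 0F , 0F , tt) ∷ (0F , 0F , 2F , 0F , 0F , tt) ∷
    (0F , 1F , 1F , 0F , 0F , tt) ∷ (0F , 1F , 2F , 0F , 0F , tt) ∷ (0F , 2F , 2F , 0F , 0F , tt) ∷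
    (4F , 2F , 2F , 0F , 0F , tt) ∷ (1F , 1F , 1F , 0F , 0F , tt) ∷ []) ∷
  ((1F , 2F , 3F) ∷ (1F , 2F , 4F) ∷ (1F , 3F , 4F) ∷ (2F , 3F , 4F) ∷ [] ,
    (0F , 0F , 0F , 0F , 0F , tt) ∷ []) ∷
  ((0F , 1F , 2F) ∷ (0F , 1F , 3F) ∷ (1F , 2F , 3F) ∷ (1F , 2F , 4F) ∷ (2F , 3F , 4F) ∷ [] ,
    (0F , 0F , 0F , 0F , 0F , tt) ∷ (0F , 0F , 0F , 1F , 0F , tt) ∷ (0F , 2F , 1F , 0F , 0F , tt) ∷
    (0F , 3F , 1F , 0F , 0F , tt) ∷ (0F , 2F , 1F , 1F , 0F , tt) ∷ (0F , 3F , 1F , 1F , 0F , tt) ∷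
    (1F , 1F , 1F , 0F , 0F , tt) ∷ (1F , 2F , 1F , 0F , 0F , tt) ∷ []) ∷
  ((0F , 1F , 2F) ∷ (0F , 2F , 3F) ∷ (1F , 2F , 3F) ∷ (1F , 2F , 4F) ∷ (2F , 3F , 4F) ∷ [] ,
    (0F , 0F , 0F , 0F , 0F , tt) ∷ (0F , 0F , 0F , 1F , 0F , tt) ∷ (0F , 2F , 1F , 1F , 0F , tt) ∷
    (1F , 0F , 0F , 0F , 0F , tt) ∷ (1F , 0F , 1F , 0F , 0F , tt) ∷ []) ∷
  ((0F , 1F , 2F) ∷ (0F , 3F , 4F) ∷ (1F , 2F , 3F) ∷ (1F , 2F , 4F) ∷ (2F , 3F , 4F) ∷ [] ,
    (0F , 0F , 0F , 0F , 0F , tt) ∷ (0F , 3F , 1F , 0F , 0F , tt) ∷ (0F , 2F , 1F , 0F , 0F , tt) ∷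
    (4F , 0F , 0F , 0F , 0F , tt) ∷ (4F , 3F , 2F , 0F , 0F , tt) ∷ (4F , 2F , 2F , 0F , 0F , tt) ∷
    (1F , 2F , 1F , 0F , 0F , tt) ∷ (1F , 1F , 1F , 0F , 0F , tt) ∷ (1F , 0F , 2F , 0F , 0F , tt) ∷ []) ∷
  ((0F , 1F , 2F) ∷ (1F , 2F , 3F) ∷ (1F , 2F , 4F) ∷ (2F , 3F , 4F) ∷ [] ,
    (0F , 0F , 0F , 0F , 0F , tt) ∷ (0F , 2F , 1F , 0F , 0F , tt) ∷ (0F , 3F , 1F , 0F , 0F , tt) ∷
    (4F , 3F , 2F , 0F , 0F , tt) ∷ (4F , 2F , 2F , 0F , 0F , tt) ∷ (1F , 2F , 1F , 0F , 0F , tt) ∷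
    (1F , 1F , 1F , 0F , 0F , tt) ∷ []) ∷
  ((0F , 1F , 3F) ∷ (0F , 1F , 4F) ∷ (1F , 2F , 3F) ∷ (1F , 2F , 4F) ∷ (2F , 3F , 4F) ∷ [] ,
    (0F , 0F , 0F , 0F , 0F , tt) ∷ (0F , 2F , 1F , 0F , 0F , tt) ∷ (0F , 3F , 1F , 0F , 0F , tt) ∷
    (4F , 2F , 1F , 0F , 0F , tt) ∷ (4F , 3F , 1F , 0F , 0F , tt) ∷ (3F , 2F , 0F , 0F , 0F , tt) ∷
    (1F , 1F , 2F , 0F , 0F , tt) ∷ (2F , 2F , 0F , 0F , 0F , tt) ∷ (1F , 2F , 2F , 0F , 0F , tt) ∷ []) ∷
  ((0F , 1F , 3F) ∷ (1F , 2F , 3F) ∷ (1F , 2F , 4F) ∷ (2F , 3F , 4F) ∷ [] ,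
    (0F , 0F , 0F , 0F , 0F , tt) ∷ (0F , 0F , 0F , 1F , 0F , tt) ∷ (0F , 2F , 1F , 1F , 0F , tt) ∷
    (4F , 2F , 1F , 1F , 0F , tt) ∷ (1F , 1F , 2F , 1F , 0F , tt) ∷ []) ∷
  ((0F , 1F , 2F) ∷ (0F , 1F , 4F) ∷ (0F , 3F , 4F) ∷ (1F , 2F , 3F) ∷ (2F , 3F , 4F) ∷ [] ,
    (0F , 0F , 0F , 0F , 0F , tt) ∷ (0F , 0F , 1F , 0F , 0F , tt) ∷ []) ∷
  ((0F , 1F , 2F) ∷ (0F , 1F , 4F) ∷ (1F , 2F , 3F) ∷ (2F , 3F , 4F) ∷ [] ,
    (0F , 0F , 0F , 0F , 0F , tt) ∷ (1F , 1F , 1F , 1F , 0F , tt) ∷ (0F , 0F , 1F , 0F , 0F , tt) ∷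
    (1F , 2F , 1F , 1F , 0F , tt) ∷ (0F , 3F , 1F , 1F , 0F , tt) ∷ (0F , 3F , 2F , 1F , 0F , tt) ∷ []) ∷
  ((0F , 1F , 2F) ∷ (0F , 2F , 4F) ∷ (1F , 2F , 3F) ∷ (2F , 3F , 4F) ∷ [] ,
    (0F , 0F , 0F , 0F , 0F , tt) ∷ (0F , 0F , 1F , 0F , 0F , tt) ∷ []) ∷
  ((0F , 1F , 4F) ∷ (0F , 2F , 3F) ∷ (1F , 2F , 3F) ∷ (2F , 3F , 4F) ∷ [] ,
    (0F , 0F , 0F , 0F , 0F , tt) ∷ []) ∷
  []

table-6 : Table 6
table-6 =
  ((0F , 1F , 2F) ∷ (0F , 1F , 3F) ∷ (0F , 2F , 3F) ∷ (1F , 2F , 3F) ∷ (2F , 3F , 4F) ∷ (2F , 3F , 5F) ∷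
   (2F , 4F , 5F) ∷ (3F , 4F , 5F) ∷ [] ,
    (0F , 0F , 0F , 0F , 0F , 0F , tt) ∷ []) ∷
  ((0F , 1F , 2F) ∷ (0F , 1F , 3F) ∷ (1F , 2F , 3F) ∷ (2F , 3F , 4F) ∷ (2F , 3F , 5F) ∷ (2F , 4F , 5F) ∷
   (3F , 4F , 5F) ∷ [] ,
    (0F , 0F , 0F , 0F , 0F , 0F , tt) ∷ (1F , 0F , 0F , 0F , 0F , 0F , tt) ∷
    (1F , 0F , 0F , 1F , 0F , 0F , tt) ∷ (1F , 0F , 0F , 2F , 0F , 0F , tt) ∷
    (1F , 0F , 1F , 1F , 0F , 0F , tt) ∷ (1F , 0F , 1F , 2F , 0F , 0F , tt) ∷
    (1F , 0F , 2F , 2F , 0F , 0F , tt) ∷ (5F , 3F , 2F , 2F , 0F , 0F , tt) ∷ []) ∷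
  ((0F , 1F , 2F) ∷ (0F , 2F , 3F) ∷ (1F , 2F , 3F) ∷ (2F , 3F , 4F) ∷ (2F , 3F , 5F) ∷ (2F , 4F , 5F) ∷
   (3F , 4F , 5F) ∷ [] ,
    (0F , 0F , 0F , 0F , 0F , 0F , tt) ∷ (0F , 0F , 1F , 0F , 0F , 0F , tt) ∷
    (4F , 4F , 3F , 2F , 0F , 0F , tt) ∷ []) ∷
  ((0F , 1F , 4F) ∷ (0F , 2F , 3F) ∷ (1F , 2F , 3F) ∷ (2F , 3F , 4F) ∷ (2F , 3F , 5F) ∷ (2F , 4F , 5F) ∷
   (3F , 4F , 5F) ∷ [] ,
    (0F , 0F , 0F , 0F , 0F , 0F , tt) ∷ (0F , 0F , 0F , 0F , 1F , 0F , tt) ∷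
    (2F , 4F , 2F , 2F , 1F , 0F , tt) ∷ (1F , 4F , 2F , 2F , 1F , 0F , tt) ∷
    (1F , 1F , 1F , 1F , 1F , 0F , tt) ∷ []) ∷
  ((0F , 2F , 3F) ∷ (0F , 2F , 4F) ∷ (1F , 2F , 3F) ∷ (1F , 2F , 4F) ∷ (2F , 3F , 4F) ∷ (2F , 3F , 5F) ∷
   (3F , 4F , 5F) ∷ [] ,
    (0F , 0F , 0F , 0F , 0F , 0F , tt) ∷ (0F , 4F , 2F , 1F , 1F , 0F , tt) ∷
    (1F , 4F , 2F , 1F , 1F , 0F , tt) ∷ (1F , 4F , 2F , 2F , 1F , 0F , tt) ∷ []) ∷
  ((0F , 2F , 4F) ∷ (0F , 3F , 4F) ∷ (1F , 2F , 3F) ∷ (1F , 2F , 4F) ∷ (2F , 3F , 4F) ∷ (2F , 3F , 5F) ∷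
   (3F , 4F , 5F) ∷ [] ,
    (0F , 0F , 0F , 0F , 0F , 0F , tt) ∷ []) ∷
  ((0F , 2F , 3F) ∷ (0F , 3F , 4F) ∷ (1F , 2F , 3F) ∷ (1F , 3F , 4F) ∷ (2F , 3F , 4F) ∷ (2F , 3F , 5F) ∷
   (3F , 4F , 5F) ∷ [] ,
    (0F , 0F , 0F , 0F , 0F , 0F , tt) ∷ []) ∷
  ((0F , 2F , 3F) ∷ (0F , 4F , 5F) ∷ (1F , 2F , 3F) ∷ (1F , 4F , 5F) ∷ (2F , 3F , 4F) ∷ (2F , 3F , 5F) ∷
   (3F , 4F , 5F) ∷ [] ,
    (0F , 0F , 0F , 0F , 0F , 0F , tt) ∷ []) ∷
  ((0F , 2F , 4F) ∷ (0F , 2F , 5F) ∷ (1F , 2F , 4F) ∷ (1F , 2F , 5F) ∷ (2F , 3F , 4F) ∷ (2F , 3F , 5F) ∷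
   (3F , 4F , 5F) ∷ [] ,
    (0F , 0F , 0F , 0F , 0F , 0F , tt) ∷ (2F , 4F , 2F , 0F , 0F , 0F , tt) ∷
    (1F , 3F , 2F , 0F , 0F , 0F , tt) ∷ []) ∷
  ((0F , 1F , 2F) ∷ (0F , 1F , 5F) ∷ (0F , 2F , 4F) ∷ (0F , 4F , 5F) ∷ (1F , 2F , 3F) ∷ (1F , 3F , 5F) ∷
   (2F , 3F , 4F) ∷ (3F , 4F , 5F) ∷ [] ,
    (0F , 0F , 0F , 0F , 0F , 0F , tt) ∷ []) ∷
  ((0F , 1F , 2F) ∷ (0F , 1F , 5F) ∷ (0F , 2F , 4F) ∷ (1F , 2F , 3F) ∷ (1F , 3F , 5F) ∷ (2F , 3F , 4F) ∷
   (3F , 4F , 5F) ∷ [] ,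
    (0F , 0F , 0F , 0F , 0F , 0F , tt) ∷ (0F , 0F , 3F , 1F , 1F , 0F , tt) ∷
    (0F , 1F , 2F , 1F , 1F , 0F , tt) ∷ (0F , 3F , 3F , 2F , 0F , 0F , tt) ∷ []) ∷
  []

table-7 : Table 7
table-7 =
  ((0F , 1F , 2F) ∷ (0F , 1F , 5F) ∷ (0F , 2F , 4F) ∷ (0F , 4F , 5F) ∷ (1F , 2F , 3F) ∷ (1F , 2F , 6F) ∷
   (1F , 3F , 5F) ∷ (1F , 5F , 6F) ∷ (2F , 3F , 4F) ∷ (2F , 4F , 6F) ∷ (3F , 4F , 5F) ∷ (4F , 5F , 6F) ∷ [] ,
    (0F , 0F , 0F , 0F , 0F , 0F , 0F , tt) ∷ (0F , 0F , 1F , 0F , 0F , 1F , 0F , tt) ∷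
    (0F , 1F , 1F , 0F , 1F , 1F , 0F , tt) ∷ []) ∷
  []

-- With s triples, S is 6 s: the bounds 7, 19, 37, 67 are 6 m − 5 for m = 2, 4, 7, 12.
classified-3 : Classified 3 0 (map proj₁ table-3)
classified-3 = classify-step 0 classified-2 0 table-3 tt tt

classified-4 : Classified 4 7 (map proj₁ table-4)
classified-4 = classify-step 1 classified-3 7 table-4 tt tt

classified-5 : Classified 5 19 (map proj₁ table-5)
classified-5 = classify-step 2 classified-4 19 table-5 tt tt

classified-6 : Classified 6 37 (map proj₁ table-6)
classified-6 = classify-step 3 classified-5 37 table-6 tt tt

classified-7 : Classified 7 67 (map proj₁ table-7)
classified-7 = classify-step 4 classified-6 67 table-7 tt tt

-- A system below the threshold `a` is below `b` anyway; any other is bounded by the listed system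
-- that presents it.
classification-bound : ∀ {m a b Rs} → Classified m a Rs → a ≤ b → T (all (λ R → S (system R) <ᵇ b) Rs) →
                       ∀ (H : Sys m) → Good H → S H < b
classification-bound {a = a} {b} {Rs} cl a≤b h H g with a ≤? S H
... | no a≰ = <-≤-trans (≰⇒> a≰) a≤b
... | yes a≤ =
  let R , R∈ , σ , p , pr = cl H g a≤
  in ≤-<-trans (Presents-S g p pr) (<ᵇ⇒< (S (system R)) b (All.lookup (all-All (λ R → S (system R) <ᵇ b) Rs h) R∈))

-- The numbers 49, 73 and 109 are 6 f(n) + 1 for n = 6, 7, 8, so that no divisibility of `S` by six
-- has to be shown.
S-bound-6 : ∀ (H : Sys 6) → Good H → S H < 49
S-bound-6 = classification-bound classified-6 (m≤m+n 37 12) tt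

S-bound-7 : ∀ (H : Sys 7) → Good H → S H < 73
S-bound-7 = classification-bound classified-7 (m≤m+n 67 6) tt

S-bound-8 : ∀ (H : Sys 8) → Good H → S H < 109
-- With an empty table every leaf of the search has to be refuted: no system reaches 109.
S-bound-8 = classification-bound (classify-step 5 classified-7 109 [] tt tt) ≤-refl tt

-- Matchings in a bipartite graph by alternating search.

Unique-↭ : ∀ {A : Set} {xs ys : List A} → xs ↭ ys → Unique xs → Unique ys
Unique-↭ {A} p = PermSetoid.Unique-resp-↭ (setoid A) (↭⇒↭ₛ p)

∉⇒All≢ : ∀ {A : Set} {p : A} {P} → p ∉ P → All (λ q → ¬ p ≡ q) P
∉⇒All≢ h = All.tabulate λ q∈ p≡q → h (subst (_∈ _) (sym p≡q) q∈)

module Matching {A B : Set} (_~_ : A → B → Set) (_≟_ : DecidableEquality B)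
  (escape : ∀ a (P : List B) → (∀ p → a ~ p → p ∈ P) ⊎ ∃[ p ] a ~ p × p ∉ P) where

  open import Data.List.Membership.DecPropositional _≟_ using (_∈?_)

  -- The elements of L outside `loose` are matched; `blue` is the part of the
  -- matching that saturates every neighbour of its own elements and of the
  -- loose ones.
  record Matched (L : List A) : Set where
    field
      loose    : List A
      blue red : List (A × B)
      parts    : L ↭ loose ++ map proj₁ blue ++ map proj₁ red
      edges    : All (uncurry _~_) (blue ++ red)
      unique₂  : Unique (map proj₂ blue ++ map proj₂ red)
      closed   : ∀ {a p} → a ∈ loose ++ map proj₁ blue → a ~ p → p ∈ map proj₂ blue

  escapes : ∀ T (P : List B) → (∀ {a p} → a ∈ T → a ~ p → p ∈ P) ⊎ ∃[ a ] ∃[ p ] a ∈ T × a ~ p × p ∉ P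
  escapes [] P = inj₁ λ ()
  escapes (t ∷ T) P with escape t P
  ... | inj₂ (p , t~p , p∉) = inj₂ (t , p , here refl , t~p , p∉)
  ... | inj₁ c with escapes T P
  ... | inj₂ (a , p , a∈ , a~p , p∉) = inj₂ (a , p , there a∈ , a~p , p∉)
  ... | inj₁ cs = inj₁ λ { (here refl) → c _ ; (there a∈) → cs a∈ }

  module Augment (L : List A) (loose : List A) (blue : List (A × B))
    (blue~ : All (uncurry _~_) blue)
    (closed : ∀ {a p} → a ∈ loose ++ map proj₁ blue → a ~ p → p ∈ map proj₂ blue) where

    MatchesAllBut : List A → List B → A → Set
    MatchesAllBut T P v = ∃[ N ] (v ∷ map proj₁ N ↭ T) × map proj₂ N ≡ P × All (uncurry _~_) N

    -- Alternating search: each element of T can be left out and the others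
    -- matched onto P.
    augment : ∀ n (red : List (A × B)) → length red ≡ n → All (uncurry _~_) red →
      ∀ t₀ T P → (∀ v → v ∈ t₀ ∷ T → MatchesAllBut (t₀ ∷ T) P v) →
      L ↭ loose ++ map proj₁ blue ++ (t₀ ∷ T) ++ map proj₁ red →
      Unique (map proj₂ blue ++ P ++ map proj₂ red) → Matched L
    augment n red len red~ t₀ T P match parts uniq
      with escapes (t₀ ∷ T) (map proj₂ blue ++ P)
    -- The alternating tree cannot grow. Its root `t₀` becomes loose, and the other elements,
    -- matched onto `P`, become blue.
    ... | inj₁ all-closed = let N , perm , N≡P , N~ = match t₀ (here refl) in record
      { loose = t₀ ∷ loose
      ; blue = N ++ blue
      ; red = red
      ; parts = ↭-trans parts (begin
          loose ++ map proj₁ blue ++ (t₀ ∷ T) ++ map proj₁ red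
            ↭⟨ ++⁺ˡ loose (++⁺ˡ (map proj₁ blue) (++⁺ʳ (map proj₁ red) (↭-sym perm))) ⟩
          loose ++ map proj₁ blue ++ (t₀ ∷ map proj₁ N) ++ map proj₁ red
            ↭⟨ ++⁺ˡ loose (shifts (map proj₁ blue) (t₀ ∷ map proj₁ N)) ⟩
          loose ++ t₀ ∷ map proj₁ N ++ map proj₁ blue ++ map proj₁ red
            ↭⟨ shift t₀ loose _ ⟩
          t₀ ∷ loose ++ map proj₁ N ++ map proj₁ blue ++ map proj₁ red
            ≡⟨ cong (λ z → t₀ ∷ loose ++ z) (sym (++-assoc (map proj₁ N) _ _)) ⟩
          t₀ ∷ loose ++ (map proj₁ N ++ map proj₁ blue) ++ map proj₁ red
            ≡⟨ cong (λ z → t₀ ∷ loose ++ z ++ map proj₁ red) (sym (map-++ proj₁ N blue)) ⟩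
          t₀ ∷ loose ++ map proj₁ (N ++ blue) ++ map proj₁ red ∎)
      ; edges = Allₚ.++⁺ (Allₚ.++⁺ N~ blue~) red~
      ; unique₂ = Unique-↭ (begin
          map proj₂ blue ++ P ++ map proj₂ red ↭⟨ shifts (map proj₂ blue) P ⟩
          P ++ map proj₂ blue ++ map proj₂ red ≡⟨ sym (++-assoc P _ _) ⟩
          (P ++ map proj₂ blue) ++ map proj₂ red
            ≡⟨ cong (λ z → (z ++ map proj₂ blue) ++ map proj₂ red) (sym N≡P) ⟩
          (map proj₂ N ++ map proj₂ blue) ++ map proj₂ red
            ≡⟨ cong (_++ map proj₂ red) (sym (map-++ proj₂ N blue)) ⟩
          map proj₂ (N ++ blue) ++ map proj₂ red ∎) uniq
      ; closed = λ {a} {p} a∈ a~p → subst (p ∈_)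
          (trans (cong (_++ map proj₂ blue) (sym N≡P)) (sym (map-++ proj₂ N blue)))
          (reorder (back perm a∈ a~p))
      }
      where
      open PermutationReasoning
      reorder : ∀ {p} → p ∈ map proj₂ blue ++ P → p ∈ P ++ map proj₂ blue
      reorder = ∈-resp-↭ (++-comm (map proj₂ blue) P)
      back : ∀ {N} → t₀ ∷ map proj₁ N ↭ t₀ ∷ T → ∀ {a p} →
             a ∈ t₀ ∷ loose ++ map proj₁ (N ++ blue) → a ~ p → p ∈ map proj₂ blue ++ P
      back perm (here refl) a~p = all-closed (here refl) a~p
      back {N} perm (there a∈) a~p with ∈-++⁻ loose a∈
      ... | inj₁ a∈l = ∈-++⁺ˡ (closed (∈-++⁺ˡ a∈l) a~p)
      ... | inj₂ a∈m with ∈-++⁻ (map proj₁ N) (subst (_ ∈_) (map-++ proj₁ N blue) a∈m)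
      ... | inj₁ a∈N = all-closed (∈-resp-↭ perm (there a∈N)) a~p
      ... | inj₂ a∈b = ∈-++⁺ˡ (closed (∈-++⁺ʳ loose a∈b) a~p)
    ... | inj₂ (v , p , v∈ , v~p , p∉) with p ∈? map proj₂ red
    -- An augmenting path: `v` takes the unsaturated `p`, and the rest of the tree is rematched onto
    -- `P`.
    ... | no p∉red = let N , perm , N≡P , N~ = match v v∈ in record
      { loose = loose
      ; blue = blue
      ; red = (v , p) ∷ N ++ red
      ; parts = ↭-trans parts (++⁺ˡ loose (++⁺ˡ (map proj₁ blue) (begin
          (t₀ ∷ T) ++ map proj₁ red ↭⟨ ++⁺ʳ (map proj₁ red) (↭-sym perm) ⟩
          (v ∷ map proj₁ N) ++ map proj₁ red ≡⟨ cong (v ∷_) (sym (map-++ proj₁ N red)) ⟩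
          map proj₁ ((v , p) ∷ N ++ red) ∎)))
      ; edges = Allₚ.++⁺ blue~ (v~p ∷ Allₚ.++⁺ N~ red~)
      ; unique₂ = Unique-↭ (begin
          p ∷ map proj₂ blue ++ P ++ map proj₂ red ↭⟨ ↭-sym (shift p (map proj₂ blue) _) ⟩
          map proj₂ blue ++ p ∷ P ++ map proj₂ red
            ≡⟨ cong (λ z → map proj₂ blue ++ p ∷ z ++ map proj₂ red) (sym N≡P) ⟩
          map proj₂ blue ++ p ∷ map proj₂ N ++ map proj₂ red
            ≡⟨ cong (λ z → map proj₂ blue ++ p ∷ z) (sym (map-++ proj₂ N red)) ⟩
          map proj₂ blue ++ map proj₂ ((v , p) ∷ N ++ red) ∎)
          (∉⇒All≢ (λ p∈ → Sum.[ (λ q → p∉ (∈-++⁺ˡ q)) , (λ q → Sum.[ (λ r → p∉ (∈-++⁺ʳ _ r)) , p∉red ] (∈-++⁻ P q)) ]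
                     (∈-++⁻ (map proj₂ blue) p∈)) ∷ uniq)
      ; closed = closed
      }
      where open PermutationReasoning
    ... | yes p∈red with ∈-map⁻ proj₂ p∈red
    ... | (t′ , .p) , e∈ , refl with ∈-∃++ e∈
    augment zero red len red~ t₀ T P match parts uniq
      | inj₂ (v , p , v∈ , v~p , p∉) | yes p∈red | (t′ , .p) , e∈ , refl | [] , zs , refl = contradiction len λ ()
    augment zero red len red~ t₀ T P match parts uniq
      | inj₂ (v , p , v∈ , v~p , p∉) | yes p∈red | (t′ , .p) , e∈ , refl | _ ∷ _ , zs , refl = contradiction len λ ()
    -- Here `p` is matched to `t′`, and this edge moves from `red` into the tree. The length of
    -- `red`, kept in `n`, drops, which gives termination.
    augment (suc n) red len red~ t₀ T P match parts uniq
      | inj₂ (v , p , v∈ , v~p , p∉) | yes p∈red | (t′ , .p) , e∈ , refl | ys , zs , refl =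
      augment n red′ (ℕₚ.suc-injective (trans (sym (↭-length red↭)) len))
        (All.tail red~′) t′ (t₀ ∷ T) (p ∷ P) match′
        (↭-trans parts (++⁺ˡ loose (++⁺ˡ (map proj₁ blue) (begin
          (t₀ ∷ T) ++ map proj₁ red ↭⟨ ++⁺ˡ (t₀ ∷ T) (map⁺ proj₁ red↭) ⟩
          (t₀ ∷ T) ++ t′ ∷ map proj₁ red′ ↭⟨ shift t′ (t₀ ∷ T) _ ⟩
          t′ ∷ (t₀ ∷ T) ++ map proj₁ red′ ∎))))
        (Unique-↭ (++⁺ˡ (map proj₂ blue) (begin
          P ++ map proj₂ red ↭⟨ ++⁺ˡ P (map⁺ proj₂ red↭) ⟩
          P ++ p ∷ map proj₂ red′ ↭⟨ shift p P _ ⟩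
          p ∷ P ++ map proj₂ red′ ∎)) uniq)
      where
      open PermutationReasoning
      red′ = ys ++ zs
      red↭ : red ↭ (t′ , p) ∷ red′
      red↭ = shift (t′ , p) ys zs
      red~′ : All (uncurry _~_) ((t′ , p) ∷ red′)
      red~′ = All-resp-↭ red↭ red~
      -- When `t′` itself is left out, `v` takes over `p`; otherwise `t′` keeps `p`.
      match′ : ∀ u → u ∈ t′ ∷ t₀ ∷ T → MatchesAllBut (t′ ∷ t₀ ∷ T) (p ∷ P) u
      match′ u (here refl) =
        let N , perm , N≡P , N~ = match v v∈
        in (v , p) ∷ N , prep u perm , cong (p ∷_) N≡P , v~p ∷ N~
      match′ u (there u∈) =
        let N , perm , N≡P , N~ = match u u∈
        in (t′ , p) ∷ N , ↭-trans (swap u t′ ↭-refl) (prep t′ perm) , cong (p ∷_) N≡P , All.head red~′ ∷ N~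

  -- Elements are inserted one at a time, each as the root of a new tree. The tree never uses blue
  -- vertices, so the closed part survives every insertion.
  matched : ∀ L → Matched L
  matched [] = record
    { loose = [] ; blue = [] ; red = [] ; parts = ↭-refl ; edges = [] ; unique₂ = [] ; closed = λ () }
  matched (t ∷ L) =
    Augment.augment (t ∷ L) loose blue (Allₚ.++⁻ˡ blue edges) closed (length red) red refl
      (Allₚ.++⁻ʳ blue edges) t [] []
      (λ { v (here refl) → [] , ↭-refl , refl , [] })
      (↭-trans (prep t parts) (↭-trans (↭-sym (shift t loose _)) (++⁺ˡ loose (↭-sym (shift t (map proj₁ blue) _)))))
      unique₂
    where open Matched (matched L)

-- Arithmetic of `f`, `t₃` and ⌊n²/4⌋.

data Thirds (n : ℕ) : ℕ → ℕ → ℕ → Set where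
  ≡0 : ∀ k → n ≡ 3 * k → Thirds n k k k
  ≡1 : ∀ k → n ≡ 1 + 3 * k → Thirds n k k (suc k)
  ≡2 : ∀ k → n ≡ 2 + 3 * k → Thirds n k (suc k) (suc k)

3+n/3 : ∀ n → (3 + n) / 3 ≡ suc (n / 3)
3+n/3 n = m/n≡1+[m∸n]/n {3 + n} {3} (m≤m+n 3 n)

thirds : ∀ n → Thirds n (n / 3) ((n + 1) / 3) ((n + 2) / 3)
thirds 0 = ≡0 0 refl
thirds 1 = ≡1 0 refl
thirds 2 = ≡2 0 refl
thirds (suc (suc (suc n)))
  rewrite 3+n/3 n | 3+n/3 (n + 1) | 3+n/3 (n + 2) with n / 3 | (n + 1) / 3 | (n + 2) / 3 | thirds n
... | _ | _ | _ | ≡0 k refl = ≡0 (suc k) (sym (*-suc 3 k))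
... | _ | _ | _ | ≡1 k refl = ≡1 (suc k) (cong suc (sym (*-suc 3 k)))
... | _ | _ | _ | ≡2 k refl = ≡2 (suc k) (cong (2 +_) (sym (*-suc 3 k)))

thirds-sum : ∀ n → n / 3 + (n + 1) / 3 + (n + 2) / 3 ≡ n
thirds-sum n with n / 3 | (n + 1) / 3 | (n + 2) / 3 | thirds n
... | _ | _ | _ | ≡0 k refl = eq k
  where
  eq : ∀ k → k + k + k ≡ 3 * k
  eq = solve-∀
... | _ | _ | _ | ≡1 k refl = eq k
  where
  eq : ∀ k → k + k + suc k ≡ 1 + 3 * k
  eq = solve-∀
... | _ | _ | _ | ≡2 k refl = eq k
  where
  eq : ∀ k → k + suc k + suc k ≡ 2 + 3 * k
  eq = solve-∀

-- The numbers of edges of the complete tripartite graphs, general and balanced.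
e₂ : ℕ → ℕ → ℕ → ℕ
e₂ a b c = a * b + a * c + b * c

t₃ : ℕ → ℕ
t₃ n = e₂ (n / 3) ((n + 1) / 3) ((n + 2) / 3)

-- This is (x - y)² ≥ 0, proved without subtraction by lowering both numbers together.
2xy≤x²+y² : ∀ x y → 2 * (x * y) ≤ x * x + y * y
2xy≤x²+y² zero y = z≤n
2xy≤x²+y² (suc x) zero rewrite *-zeroʳ x = z≤n
2xy≤x²+y² (suc x) (suc y) = begin
  2 * (suc x * suc y) ≡⟨ lhs x y ⟩
  2 * (x * y) + (2 * x + 2 * y + 2) ≤⟨ +-monoˡ-≤ _ (2xy≤x²+y² x y) ⟩
  x * x + y * y + (2 * x + 2 * y + 2) ≡⟨ rhs x y ⟩
  suc x * suc x + suc y * suc y ∎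
  where
  open ≤-Reasoning
  lhs : ∀ x y → 2 * (suc x * suc y) ≡ 2 * (x * y) + (2 * x + 2 * y + 2)
  lhs = solve-∀
  rhs : ∀ x y → x * x + y * y + (2 * x + 2 * y + 2) ≡ suc x * suc x + suc y * suc y
  rhs = solve-∀

3e₂≤n² : ∀ a b c → 3 * e₂ a b c ≤ (a + b + c) * (a + b + c)
3e₂≤n² a b c = *-cancelˡ-≤ 2 (begin
  2 * (3 * e₂ a b c) ≡⟨ lhs a b c ⟩
  2 * (a * b) + 2 * (a * c) + 2 * (b * c) + 4 * e₂ a b c
    ≤⟨ +-monoˡ-≤ _ (+-mono-≤ (+-mono-≤ (2xy≤x²+y² a b) (2xy≤x²+y² a c)) (2xy≤x²+y² b c)) ⟩
  (a * a + b * b) + (a * a + c * c) + (b * b + c * c) + 4 * e₂ a b c ≡⟨ rhs a b c ⟩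
  2 * ((a + b + c) * (a + b + c)) ∎)
  where
  open ≤-Reasoning
  lhs : ∀ a b c → 2 * (3 * (a * b + a * c + b * c)) ≡
        2 * (a * b) + 2 * (a * c) + 2 * (b * c) + 4 * (a * b + a * c + b * c)
  lhs = solve-∀
  rhs : ∀ a b c → (a * a + b * b) + (a * a + c * c) + (b * b + c * c) + 4 * (a * b + a * c + b * c) ≡
        2 * ((a + b + c) * (a + b + c))
  rhs = solve-∀

n²≤3t₃+1 : ∀ n → n * n ≤ 3 * t₃ n + 1
n²≤3t₃+1 n with n / 3 | (n + 1) / 3 | (n + 2) / 3 | thirds n
... | _ | _ | _ | ≡0 k refl = m≤n⇒m≤n+o 1 (≤-reflexive (eq k))
  where
  eq : ∀ k → (3 * k) * (3 * k) ≡ 3 * (k * k + k * k + k * k)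
  eq = solve-∀
... | _ | _ | _ | ≡1 k refl = ≤-reflexive (eq k)
  where
  eq : ∀ k → (1 + 3 * k) * (1 + 3 * k) ≡ 3 * (k * k + k * suc k + k * suc k) + 1
  eq = solve-∀
... | _ | _ | _ | ≡2 k refl = ≤-reflexive (eq k)
  where
  eq : ∀ k → (2 + 3 * k) * (2 + 3 * k) ≡ 3 * (k * suc k + k * suc k + suc k * suc k) + 1
  eq = solve-∀

-- With n = a + b + c, the chain 3 e₂ ≤ n² ≤ 3 t₃ + 1 leaves no room for e₂ ≥ t₃ + 1.
e₂≤t₃ : ∀ a b c → e₂ a b c ≤ t₃ (a + b + c)
e₂≤t₃ a b c = m<1+n⇒m≤n (*-cancelˡ-< 3 _ _ (begin-strict
  3 * e₂ a b c ≤⟨ ≤-trans (3e₂≤n² a b c) (n²≤3t₃+1 (a + b + c)) ⟩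
  3 * t + 1 <⟨ +-monoʳ-< (3 * t) (s≤s (s≤s z≤n)) ⟩
  3 * t + 3 ≡⟨ trans (+-comm (3 * t) 3) (sym (*-suc 3 t)) ⟩
  3 * suc t ∎))
  where
  open ≤-Reasoning
  t = t₃ (a + b + c)

f-3+ : ∀ n → f (3 + n) ≡ f n + t₃ n + n + 1
f-3+ n = begin
  f (3 + n)
    ≡⟨ cong₂ _*_ (cong₂ _*_ (3+n/3 n) (3+n/3 (n + 1))) (3+n/3 (n + 2)) ⟩
  suc (n / 3) * suc ((n + 1) / 3) * suc ((n + 2) / 3)
    ≡⟨ expand (n / 3) ((n + 1) / 3) ((n + 2) / 3) ⟩
  f n + t₃ n + (n / 3 + (n + 1) / 3 + (n + 2) / 3) + 1
    ≡⟨ cong (λ z → f n + t₃ n + z + 1) (thirds-sum n) ⟩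
  f n + t₃ n + n + 1 ∎
  where
  open ≡-Reasoning
  expand : ∀ a b c → suc a * suc b * suc c ≡ a * b * c + (a * b + a * c + b * c) + (a + b + c) + 1
  expand = solve-∀

-- Taking one vertex from each part removes e₂ + n′ + 1 triples, where n′ vertices remain and e₂
-- refers to the remaining parts. By `f-3+` and `e₂≤t₃` the balanced system loses at least as many.
abc≤f : ∀ a b c → a * b * c ≤ f (a + b + c)
abc≤f zero b c = z≤n
abc≤f (suc a) zero c rewrite *-zeroʳ a = z≤n
abc≤f (suc a) (suc b) zero rewrite *-zeroʳ (suc a * suc b) = z≤n
abc≤f (suc a) (suc b) (suc c) = begin
  suc a * suc b * suc c ≡⟨ expand a b c ⟩
  a * b * c + e₂ a b c + (a + b + c) + 1
    ≤⟨ +-monoˡ-≤ 1 (+-monoˡ-≤ (a + b + c) (+-mono-≤ (abc≤f a b c) (e₂≤t₃ a b c))) ⟩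
  f (a + b + c) + t₃ (a + b + c) + (a + b + c) + 1 ≡⟨ sym (f-3+ (a + b + c)) ⟩
  f (3 + (a + b + c)) ≡⟨ cong f (total a b c) ⟩
  f (suc a + suc b + suc c) ∎
  where
  open ≤-Reasoning
  expand : ∀ a b c → suc a * suc b * suc c ≡ a * b * c + (a * b + a * c + b * c) + (a + b + c) + 1
  expand = solve-∀
  total : ∀ a b c → 3 + (a + b + c) ≡ suc a + suc b + suc c
  total = solve-∀

≤-by : ∀ {m n} o → m + o ≡ n → m ≤ n
≤-by {m} o eq = subst (m ≤_) eq (m≤m+n m o)

-- For n < 9 the bound fails: t₃ 8 = 21 and f 8 = 18.
t₃≤f : ∀ n → 9 ≤ n → t₃ n ≤ f n
t₃≤f n 9≤n with n / 3 | (n + 1) / 3 | (n + 2) / 3 | thirds n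
-- With smallest third 3 + k, the difference of `f` and `t₃` is a polynomial in k with nonnegative
-- coefficients, given as the witness of `≤-by`.
t₃≤f .(3 * (3 + k)) 9≤n | _ | _ | _ | ≡0 (suc (suc (suc k))) refl = ≤-by (k * ((3 + k) * (3 + k))) (eq k)
  where
  eq : ∀ k → (3 + k) * (3 + k) + (3 + k) * (3 + k) + (3 + k) * (3 + k) + k * ((3 + k) * (3 + k)) ≡
       (3 + k) * (3 + k) * (3 + k)
  eq = solve-∀
t₃≤f .(1 + 3 * (3 + k)) 9≤n | _ | _ | _ | ≡1 (suc (suc (suc k))) refl =
  ≤-by ((3 + k) * (k * k + 4 * k + 1)) (eq k)
  where
  eq : ∀ k → (3 + k) * (3 + k) + (3 + k) * (4 + k) + (3 + k) * (4 + k) + (3 + k) * (k * k + 4 * k + 1) ≡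
       (3 + k) * (3 + k) * (4 + k)
  eq = solve-∀
t₃≤f .(2 + 3 * (3 + k)) 9≤n | _ | _ | _ | ≡2 (suc (suc (suc k))) refl =
  ≤-by ((4 + k) * (k * k + 4 * k + 2)) (eq k)
  where
  eq : ∀ k → (3 + k) * (4 + k) + (3 + k) * (4 + k) + (4 + k) * (4 + k) + (4 + k) * (k * k + 4 * k + 2) ≡
       (3 + k) * (4 + k) * (4 + k)
  eq = solve-∀
t₃≤f _ 9≤n | _ | _ | _ | ≡0 0 refl = contradiction 9≤n λ ()
t₃≤f _ 9≤n | _ | _ | _ | ≡0 1 refl = contradiction 9≤n (<⇒≱ (s≤s (s≤s (s≤s (s≤s z≤n)))))
t₃≤f _ 9≤n | _ | _ | _ | ≡0 2 refl = contradiction 9≤n (<⇒≱ (m≤m+n 7 2))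
t₃≤f _ 9≤n | _ | _ | _ | ≡1 0 refl = contradiction 9≤n (<⇒≱ (m≤m+n 2 7))
t₃≤f _ 9≤n | _ | _ | _ | ≡1 1 refl = contradiction 9≤n (<⇒≱ (m≤m+n 5 4))
t₃≤f _ 9≤n | _ | _ | _ | ≡1 2 refl = contradiction 9≤n (<⇒≱ (m≤m+n 8 1))
t₃≤f _ 9≤n | _ | _ | _ | ≡2 0 refl = contradiction 9≤n (<⇒≱ (m≤m+n 3 6))
t₃≤f _ 9≤n | _ | _ | _ | ≡2 1 refl = contradiction 9≤n (<⇒≱ (m≤m+n 6 3))
t₃≤f _ 9≤n | _ | _ | _ | ≡2 2 refl = contradiction 9≤n (<⇒≱ (m≤m+n 9 0))

⌊_²/4⌋ : ℕ → ℕ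
⌊ 0 ²/4⌋ = 0
⌊ 1 ²/4⌋ = 0
⌊ suc (suc n) ²/4⌋ = ⌊ n ²/4⌋ + n + 1

product≤ : ∀ a b → a * b ≤ ⌊ a + b ²/4⌋
product≤ zero b = z≤n
product≤ (suc a) zero rewrite *-zeroʳ a = z≤n
product≤ (suc a) (suc b) rewrite +-suc a b = begin
  suc a * suc b ≡⟨ expand a b ⟩
  a * b + (a + b) + 1 ≤⟨ +-monoˡ-≤ 1 (+-monoˡ-≤ (a + b) (product≤ a b)) ⟩
  ⌊ a + b ²/4⌋ + (a + b) + 1 ∎
  where
  open ≤-Reasoning
  expand : ∀ a b → suc a * suc b ≡ a * b + (a + b) + 1
  expand = solve-∀

-- Allows ⌊n²/4⌋ to be read as the product of two part sizes, so that the bounds for three parts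
-- apply to it.
product-attained : ∀ n → ∃[ a ] ∃[ b ] a + b ≡ n × a * b ≡ ⌊ n ²/4⌋
product-attained 0 = 0 , 0 , refl , refl
product-attained 1 = 0 , 1 , refl , refl
product-attained (suc (suc n)) with product-attained n
... | a , b , refl , eq = suc a , suc b , cong suc (+-suc a b) , 
  trans (expand a b) (cong (λ z → z + (a + b) + 1) eq)
  where
  expand : ∀ a b → suc a * suc b ≡ a * b + (a + b) + 1
  expand = solve-∀

-- With d = p + h + k and M = ⌊d²/4⌋, the left-hand side times d is at most
-- p (s d + M) + (h + k) s M, and both s d + M and s M are at most f (s + d).
weighted-bound : ∀ s p h k → 9 ≤ suc s + (p + (h + k)) →
  suc s * p + s * (h * k) + ⌊ p + (h + k) ²/4⌋ ≤ f (suc s + (p + (h + k)))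
weighted-bound s p h k 9≤n = go d refl
  where
  open ≤-Reasoning
  d = p + (h + k)
  M = ⌊ d ²/4⌋
  F = f (suc s + d)
  -- With M = a b and a + b = d, the left side is the number of edges of the complete 3-partite
  -- graph with parts `suc s`, a, b. The hypothesis 9 ≤ n enters through `t₃≤f`.
  sd+M≤F : suc s * d + M ≤ F
  sd+M≤F with product-attained d
  ... | a , b , a+b≡d , ab≡M = begin
    suc s * d + M ≡⟨ cong₂ (λ x y → suc s * x + y) (sym a+b≡d) (sym ab≡M) ⟩
    suc s * (a + b) + a * b ≡⟨ cong (_+ a * b) (*-distribˡ-+ (suc s) a b) ⟩
    e₂ (suc s) a b ≤⟨ e₂≤t₃ (suc s) a b ⟩
    t₃ (suc s + a + b) ≡⟨ cong t₃ n≡ ⟩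
    t₃ (suc s + d) ≤⟨ t₃≤f (suc s + d) 9≤n ⟩
    F ∎
    where n≡ = trans (+-assoc (suc s) a b) (cong (suc s +_) a+b≡d)
  -- This is the number of triples of the complete 3-partite system with the same parts.
  sM≤F : suc s * M ≤ F
  sM≤F with product-attained d
  ... | a , b , a+b≡d , ab≡M = begin
    suc s * M ≡⟨ cong (suc s *_) (sym ab≡M) ⟩
    suc s * (a * b) ≡⟨ sym (*-assoc (suc s) a b) ⟩
    suc s * a * b ≤⟨ abc≤f (suc s) a b ⟩
    f (suc s + a + b) ≡⟨ cong f (trans (+-assoc (suc s) a b) (cong (suc s +_) a+b≡d)) ⟩
    F ∎
  hM : (h + p) * k ≤ M
  hM = ≤-trans (product≤ (h + p) k) (≤-reflexive (cong ⌊_²/4⌋ (reorder h p k)))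
    where
    reorder : ∀ h p k → h + p + k ≡ p + (h + k)
    reorder = solve-∀
  kM : h * (k + p) ≤ M
  kM = ≤-trans (product≤ h (k + p)) (≤-reflexive (cong ⌊_²/4⌋ (reorder h p k)))
    where
    reorder : ∀ h p k → h + (k + p) ≡ p + (h + k)
    reorder = solve-∀
  -- After adding p h k, the left side splits into h times (h + p) k and k times h (k + p). Both are
  -- multiples of products of two numbers with sum `d`.
  dhk : d * (h * k) ≤ (h + k) * M
  dhk = begin
    d * (h * k) ≤⟨ m≤m+n _ (p * (h * k)) ⟩
    d * (h * k) + p * (h * k) ≡⟨ split h p k ⟩
    h * ((h + p) * k) + k * (h * (k + p)) ≤⟨ +-mono-≤ (*-monoʳ-≤ h hM) (*-monoʳ-≤ k kM) ⟩
    h * M + k * M ≡⟨ sym (*-distribʳ-+ M h k) ⟩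
    (h + k) * M ∎
    where
    split : ∀ h p k → (p + (h + k)) * (h * k) + p * (h * k) ≡ h * ((h + p) * k) + k * (h * (k + p))
    split = solve-∀
  main : d * (suc s * p + s * (h * k) + M) ≤ d * F
  main = begin
    d * (suc s * p + s * (h * k) + M) ≡⟨ expand d s p (h * k) M ⟩
    suc s * d * p + s * (d * (h * k)) + d * M ≤⟨ +-monoˡ-≤ (d * M) (+-monoʳ-≤ (suc s * d * p) (*-monoʳ-≤ s dhk)) ⟩
    suc s * d * p + s * ((h + k) * M) + d * M ≡⟨ interpolate s p (h + k) M ⟩
    p * (suc s * d + M) + (h + k) * (suc s * M) ≤⟨ +-mono-≤ (*-monoʳ-≤ p sd+M≤F) (*-monoʳ-≤ (h + k) sM≤F) ⟩
    p * F + (h + k) * F ≡⟨ sym (*-distribʳ-+ F p (h + k)) ⟩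
    d * F ∎
    where
    expand : ∀ d s p x m → d * (suc s * p + s * x + m) ≡ suc s * d * p + s * (d * x) + d * m
    expand = solve-∀
    interpolate : ∀ s p q m → suc s * (p + q) * p + s * (q * m) + (p + q) * m ≡
                  p * (suc s * (p + q) + m) + q * (suc s * m)
    interpolate = solve-∀
  -- The inequality was multiplied by `d`, so d = 0 is treated apart: then p, h and k vanish and so
  -- does the left side.
  go : ∀ d′ → d′ ≡ d → suc s * p + s * (h * k) + M ≤ F
  go zero 0≡d with m+n≡0⇒m≡0 p (sym 0≡d) | m+n≡0⇒n≡0 p (sym 0≡d)
  ... | refl | h+k≡0 with m+n≡0⇒m≡0 h h+k≡0 | m+n≡0⇒n≡0 h h+k≡0
  ... | refl | refl = subst (_≤ F) (sym (eq s)) z≤n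
    where
    eq : ∀ s → suc s * 0 + s * 0 + 0 ≡ 0
    eq = solve-∀
  go (suc d′) eq = *-cancelˡ-≤ (suc d′) (subst (λ z → z * (suc s * p + s * (h * k) + M) ≤ z * F) (sym eq) main)

-- Finite sums and Mantel's theorem.

argmax : ∀ {n} (g : Fin (suc n) → ℕ) → ∃[ v ] ∀ u → g u ≤ g v
argmax {zero} g = zero , λ { zero → ≤-refl }
argmax {suc n} g with argmax (g ∘ suc)
... | v , greatest with ≤-total (g zero) (g (suc v))
... | inj₁ le = suc v , λ { zero → le ; (suc u) → greatest u }
... | inj₂ ge = zero , λ { zero → ≤-refl ; (suc u) → ≤-trans (greatest u) ge }

term≤sum : ∀ (i : Fin n) g → g i ≤ sum g
term≤sum zero g = m≤m+n _ _
term≤sum (suc i) g = m≤n⇒m≤o+n (g zero) (term≤sum i (g ∘ suc))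

bit-∧ : ∀ a b → bit (a ∧ b) ≡ bit a * bit b
bit-∧ true b = sym (+-identityʳ (bit b))
bit-∧ false b = refl

bit-∨ : ∀ a b → ¬ (T a × T b) → bit (a ∨ b) ≡ bit a + bit b
bit-∨ true true h = contradiction (tt , tt) h
bit-∨ true false h = refl
bit-∨ false b h = refl

bit-not : ∀ a → bit a + bit (not a) ≡ 1
bit-not true = refl
bit-not false = refl

sum-bit-not : ∀ (μ : Fin n → Bool) → sum (bit ∘ μ) + sum (bit ∘ not ∘ μ) ≡ n
sum-bit-not {n} μ = begin
  sum (bit ∘ μ) + sum (bit ∘ not ∘ μ) ≡⟨ sym (∑-distrib-+ (bit ∘ μ) (bit ∘ not ∘ μ)) ⟩
  sum (λ x → bit (μ x) + bit (not (μ x))) ≡⟨ sum-cong-≗ (λ x → bit-not (μ x)) ⟩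
  sum {n} (λ _ → 1) ≡⟨ sum-const n 1 ⟩
  n * 1 ≡⟨ *-identityʳ n ⟩
  n ∎
  where open ≡-Reasoning

sum₂ : (Fin n → Fin n → ℕ) → ℕ
sum₂ {n} g = ∑[ x < n ] ∑[ y < n ] g x y

sum₃ : (Fin n → Fin n → Fin n → ℕ) → ℕ
sum₃ {n} g = ∑[ x < n ] sum₂ (g x)

sum₂-cong : ∀ {g h : Fin n → Fin n → ℕ} → (∀ x y → g x y ≡ h x y) → sum₂ g ≡ sum₂ h
sum₂-cong eq = sum-cong-≗ λ x → sum-cong-≗ λ y → eq x y

sum₂-mono : ∀ {g h : Fin n → Fin n → ℕ} → (∀ x y → g x y ≤ h x y) → sum₂ g ≤ sum₂ h
sum₂-mono le = sum-mono λ x → sum-mono λ y → le x y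

sum₂-+ : ∀ (g h : Fin n → Fin n → ℕ) → sum₂ (λ x y → g x y + h x y) ≡ sum₂ g + sum₂ h
sum₂-+ {n} g h = trans (sum-cong-≗ λ x → ∑-distrib-+ (g x) (h x))
  (∑-distrib-+ (λ x → ∑[ y < n ] g x y) (λ x → ∑[ y < n ] h x y))

sum₃-+ : ∀ (g h : Fin n → Fin n → Fin n → ℕ) → sum₃ (λ x y z → g x y z + h x y z) ≡ sum₃ g + sum₃ h
sum₃-+ g h = trans (sum-cong-≗ λ x → sum₂-+ (g x) (h x)) (∑-distrib-+ (λ x → sum₂ (g x)) (λ x → sum₂ (h x)))

sum₂-factor : ∀ (c : Fin n → ℕ) (g : Fin n → Fin n → ℕ) →
              sum₂ (λ x y → c x * g x y) ≡ ∑[ x < n ] (c x * ∑[ y < n ] g x y)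
sum₂-factor c g = sum-cong-≗ λ x → sym (*-distribˡ-sum (c x) (g x))

-- Mantel's theorem for the graph E, in the form that follows from a vertex of
-- maximum degree k: its neighbourhood is independent.
mantel : (E : Fin (suc n) → Fin (suc n) → Bool) →
  (∀ x y → E x y ≡ E y x) →
  (∀ x y z → T (E x y) → T (E x z) → ¬ T (E y z)) →
  (μ : Fin (suc n) → Bool) → (∀ x y → T (E x y) → T (μ x)) →
  ∃[ h ] ∃[ k ] h + k ≡ sum (bit ∘ μ) × sum₂ (λ x y → bit (E x y)) ≤ 2 * (h * k)
mantel {n} E E-sym E-free μ E⊆μ with argmax (λ x → ∑[ y < suc n ] bit (E x y))
... | u , greatest = h , k , total , bound
  where
  open ≤-Reasoning
  deg : Fin (suc n) → ℕ
  deg x = ∑[ y < suc n ] bit (E x y)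
  k = deg u
  μ′ : Fin (suc n) → Bool
  μ′ x = μ x ∧ not (E u x)
  h = sum (bit ∘ μ′)
  total : h + k ≡ sum (bit ∘ μ)
  total = trans (sym (∑-distrib-+ (bit ∘ μ′) (λ x → bit (E u x)))) (sum-cong-≗ λ x → pointwise x)
    where
    pointwise : ∀ x → bit (μ′ x) + bit (E u x) ≡ bit (μ x)
    pointwise x with μ x in eq | E u x in eq′
    ... | true | true = refl
    ... | true | false = refl
    ... | false | false = refl
    ... | false | true = contradiction (E⊆μ x u (subst T (trans (sym eq′) (E-sym u x)) tt)) (subst T eq)
  -- The neighbourhood of `u` is independent, so every edge has an end among the `h` vertices of
  -- `μ′`, each of degree at most `k`.
  covered : ∀ x y → bit (E x y) ≤ bit (μ′ x) * bit (E x y) + bit (μ′ y) * bit (E y x)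
  covered x y with E x y in xy | E y x in yx | E u x in ux | E u y in uy | μ x in μx | μ y in μy
  ... | false | _ | _ | _ | _ | _ = z≤n
  ... | true | false | _ | _ | _ | _ = contradiction (trans (sym xy) (trans (E-sym x y) yx)) λ ()
  ... | true | true | _ | _ | false | _ = contradiction (E⊆μ x y (subst T (sym xy) tt)) (subst T μx)
  ... | true | true | _ | _ | true | false = contradiction (E⊆μ y x (subst T (sym yx) tt)) (subst T μy)
  ... | true | true | false | _ | true | true = s≤s z≤n
  ... | true | true | true | false | true | true = s≤s z≤n
  ... | true | true | true | true | true | true =
    contradiction (subst T (sym xy) tt) (E-free u x y (subst T (sym ux) tt) (subst T (sym uy) tt))
  half : ℕ
  half = sum₂ (λ x y → bit (μ′ x) * bit (E x y))
  half≤ : half ≤ h * k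
  half≤ = begin
    half ≡⟨ sum₂-factor (bit ∘ μ′) (λ x y → bit (E x y)) ⟩
    ∑[ x < suc n ] (bit (μ′ x) * deg x) ≤⟨ sum-mono (λ x → *-monoʳ-≤ (bit (μ′ x)) (greatest x)) ⟩
    ∑[ x < suc n ] (bit (μ′ x) * k) ≡⟨ sym (*-distribʳ-sum k (bit ∘ μ′)) ⟩
    h * k ∎
  bound : sum₂ (λ x y → bit (E x y)) ≤ 2 * (h * k)
  bound = begin
    sum₂ (λ x y → bit (E x y)) ≤⟨ sum₂-mono covered ⟩
    sum₂ (λ x y → bit (μ′ x) * bit (E x y) + bit (μ′ y) * bit (E y x))
      ≡⟨ sum₂-+ (λ x y → bit (μ′ x) * bit (E x y)) (λ x y → bit (μ′ y) * bit (E y x)) ⟩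
    half + sum₂ (λ x y → bit (μ′ y) * bit (E y x))
      ≡⟨ cong (half +_) (∑-comm {suc n} {suc n} (λ x y → bit (μ′ y) * bit (E y x))) ⟩
    half + half ≤⟨ +-mono-≤ half≤ half≤ ⟩
    h * k + h * k ≡⟨ cong (h * k +_) (sym (+-identityʳ (h * k))) ⟩
    2 * (h * k) ∎

-- Red edges and blue triangles in a K₄-free graph.

module RedBlue {n} (9≤n : 9 ≤ suc n) (R B : Fin (suc n) → Fin (suc n) → Bool)
  (R-sym : ∀ x y → R x y ≡ R y x) (B-sym : ∀ x y → B x y ≡ B y x)
  (irrefl : ∀ x → ¬ T (R x x ∨ B x x))
  (disjoint : ∀ x y → ¬ (T (R x y) × T (B x y)))
  (K₄-free : ∀ w x y z → T (R w x ∨ B w x) → T (R w y ∨ B w y) → T (R w z ∨ B w z) →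
             T (R x y ∨ B x y) → T (R x z ∨ B x z) → ¬ T (R y z ∨ B y z))
  where

  V = Fin (suc n)

  r b : V → V → ℕ
  r x y = bit (R x y)
  b x y = bit (B x y)

  E : V → V → Bool
  E x y = R x y ∨ B x y

  E-sym : ∀ x y → E x y ≡ E y x
  E-sym x y = cong₂ _∨_ (R-sym x y) (B-sym x y)

  tri : V → V → V → ℕ
  tri x y z = b x y * (b x z * b y z)

  -- `tri-at` counts every blue triangle at `x` twice, in both orders of the other two vertices;
  -- hence the factor 2 on the red degree.
  degᵣ tri-at weight-at : V → ℕ
  degᵣ x = ∑[ y < suc n ] r x y
  tri-at x = sum₂ (tri x)
  weight-at x = 2 * degᵣ x + tri-at x

  private
    max = argmax weight-at
    v = proj₁ max
    ν ν̄ : V → ℕ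
    ν x = bit (E v x)
    ν̄ x = bit (not (E v x))

    inner : V → V → Bool
    inner x y = E v x ∧ (E v y ∧ E x y)

    inner-sym : ∀ x y → inner x y ≡ inner y x
    inner-sym x y with E v x | E v y
    ... | true | true = E-sym x y
    ... | true | false = refl
    ... | false | true = refl
    ... | false | false = refl

    inner-elim : ∀ x y → T (inner x y) → T (E v x) × T (E v y) × T (E x y)
    inner-elim x y h = let p , q = ∧-elim (E v x) h ; s , t = ∧-elim (E v y) q in p , s , t

    inner-free : ∀ x y z → T (inner x y) → T (inner x z) → ¬ T (inner y z)
    inner-free x y z xy xz yz =
      let vx , vy , exy = inner-elim x y xy
          _ , vz , exz = inner-elim x z xz
          _ , _ , eyz = inner-elim y z yz
      in K₄-free v x y z vx vy vz exy exz eyz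

    -- Its edges are the blue triangles at `v`. Only blue neighbours of `v` carry edges, so Mantel's
    -- theorem gives `h + k` equal to the blue degree `q`.
    blue-link : V → V → Bool
    blue-link x y = B v x ∧ (B v y ∧ B x y)

    B⇒E : ∀ x y → T (B x y) → T (E x y)
    B⇒E x y = ∨-intro₂ (R x y)

    blue-link⇒inner : ∀ x y → T (blue-link x y) → T (inner x y)
    blue-link⇒inner x y h =
      let p , q = ∧-elim (B v x) h ; s , t = ∧-elim (B v y) q
      in ∧-intro (B⇒E v x p) (∧-intro (B⇒E v y s) (B⇒E x y t))

    blue-link-sym : ∀ x y → blue-link x y ≡ blue-link y x
    blue-link-sym x y with B v x | B v y
    ... | true | true = B-sym x y
    ... | true | false = refl
    ... | false | true = refl
    ... | false | false = refl

    inner-mantel = mantel inner inner-sym inner-free (E v) (λ x y → proj₁ ∘ ∧-elim (E v x))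
    blue-mantel = mantel blue-link blue-link-sym
      (λ x y z xy xz yz → inner-free x y z (blue-link⇒inner x y xy) (blue-link⇒inner x z xz) (blue-link⇒inner y z yz))
      (B v) (λ x y → proj₁ ∘ ∧-elim (B v x))

    p q s d Y ρ h k : ℕ
    p = degᵣ v
    q = sum (b v)
    s = sum ν̄
    d = sum ν
    Y = tri-at v
    ρ = sum₂ (λ x y → ν x * (ν y * r x y))
    h = proj₁ blue-mantel
    k = proj₁ (proj₂ blue-mantel)

    h+k≡q : h + k ≡ q
    h+k≡q = proj₁ (proj₂ (proj₂ blue-mantel))

    Y≤2hk : Y ≤ 2 * (h * k)
    Y≤2hk = ≤-trans (≤-reflexive (sum₂-cong λ x y → sym (trans (bit-∧ (B v x) (B v y ∧ B x y))
        (cong (b v x *_) (bit-∧ (B v y) (B x y))))))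
      (proj₂ (proj₂ (proj₂ blue-mantel)))

    p+q≡d : p + q ≡ d
    p+q≡d = trans (sym (∑-distrib-+ (r v) (b v))) (sum-cong-≗ λ x → sym (bit-∨ (R v x) (B v x) (disjoint v x)))

    d+s≡n : d + s ≡ suc n
    d+s≡n = sum-bit-not (E v)

    -- The pairs counted by `Y` are blue and those counted by `ρ` are red, so together they are
    -- different edges of `inner`. That graph is triangle-free, because `v` would complete a
    -- triangle to a K₄.
    Y+ρ≤2M : Y + ρ ≤ 2 * ⌊ d ²/4⌋
    Y+ρ≤2M = begin
      Y + ρ ≡⟨ sym (sum₂-+ (tri v) (λ x y → ν x * (ν y * r x y))) ⟩
      sum₂ (λ x y → tri v x y + ν x * (ν y * r x y)) ≤⟨ sum₂-mono pointwise ⟩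
      sum₂ (λ x y → bit (inner x y)) ≤⟨ proj₂ (proj₂ (proj₂ inner-mantel)) ⟩
      2 * (h′ * k′) ≤⟨ *-monoʳ-≤ 2 (product≤ h′ k′) ⟩
      2 * ⌊ h′ + k′ ²/4⌋ ≡⟨ cong (λ z → 2 * ⌊ z ²/4⌋) (proj₁ (proj₂ (proj₂ inner-mantel))) ⟩
      2 * ⌊ d ²/4⌋ ∎
      where
      open ≤-Reasoning
      h′ = proj₁ inner-mantel
      k′ = proj₁ (proj₂ inner-mantel)
      pointwise : ∀ x y → tri v x y + ν x * (ν y * r x y) ≤ bit (inner x y)
      pointwise x y with R v x | B v x | R v y | B v y | R x y | B x y | disjoint x y
      ... | false | false | _ | _ | _ | _ | _ = z≤n
      ... | false | true | false | false | _ | _ | _ = z≤n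
      ... | false | true | false | true | false | false | _ = z≤n
      ... | false | true | false | true | false | true | _ = s≤s z≤n
      ... | false | true | false | true | true | false | _ = s≤s z≤n
      ... | false | true | false | true | true | true | D = contradiction (tt , tt) D
      ... | false | true | true | false | false | _ | _ = z≤n
      ... | false | true | true | false | true | _ | _ = s≤s z≤n
      ... | false | true | true | true | false | false | _ = z≤n
      ... | false | true | true | true | false | true | _ = s≤s z≤n
      ... | false | true | true | true | true | false | _ = s≤s z≤n
      ... | false | true | true | true | true | true | D = contradiction (tt , tt) D
      ... | true | false | false | false | _ | _ | _ = z≤n
      ... | true | false | false | true | false | _ | _ = z≤n
      ... | true | false | false | true | true | _ | _ = s≤s z≤n
      ... | true | false | true | _ | false | _ | _ = z≤n
      ... | true | false | true | _ | true | _ | _ = s≤s z≤n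
      ... | true | true | false | false | _ | _ | _ = z≤n
      ... | true | true | false | true | false | false | _ = z≤n
      ... | true | true | false | true | false | true | _ = s≤s z≤n
      ... | true | true | false | true | true | false | _ = s≤s z≤n
      ... | true | true | false | true | true | true | D = contradiction (tt , tt) D
      ... | true | true | true | false | false | _ | _ = z≤n
      ... | true | true | true | false | true | _ | _ = s≤s z≤n
      ... | true | true | true | true | false | false | _ = z≤n
      ... | true | true | true | true | false | true | _ = s≤s z≤n
      ... | true | true | true | true | true | false | _ = s≤s z≤n
      ... | true | true | true | true | true | true | D = contradiction (tt , tt) D

    edges≤ : sum₂ r ≤ 2 * (∑[ x < suc n ] (ν̄ x * degᵣ x)) + ρ
    edges≤ = begin
      sum₂ r ≤⟨ sum₂-mono pointwise ⟩
      sum₂ (λ x y → ν̄ x * r x y + ν̄ y * r y x + ν x * (ν y * r x y))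
        ≡⟨ trans (sum₂-+ (λ x y → ν̄ x * r x y + ν̄ y * r y x) (λ x y → ν x * (ν y * r x y)))
             (cong (_+ ρ) (sum₂-+ (λ x y → ν̄ x * r x y) (λ x y → ν̄ y * r y x))) ⟩
      A + sum₂ (λ x y → ν̄ y * r y x) + ρ
        ≡⟨ cong (λ z → A + z + ρ) (∑-comm {suc n} {suc n} (λ x y → ν̄ y * r y x)) ⟩
      A + A + ρ ≡⟨ cong (_+ ρ) (cong (A +_) (sym (+-identityʳ A))) ⟩
      2 * A + ρ ≡⟨ cong (λ z → 2 * z + ρ) (sum₂-factor ν̄ r) ⟩
      2 * (∑[ x < suc n ] (ν̄ x * degᵣ x)) + ρ ∎
      where
      open ≤-Reasoning
      A = sum₂ (λ x y → ν̄ x * r x y)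
      pointwise : ∀ x y → r x y ≤ ν̄ x * r x y + ν̄ y * r y x + ν x * (ν y * r x y)
      pointwise x y with R x y in xy | R y x in yx | E v x | E v y
      ... | false | _ | _ | _ = z≤n
      ... | true | false | _ | _ = contradiction (trans (sym xy) (trans (R-sym x y) yx)) λ ()
      ... | true | true | false | _ = s≤s z≤n
      ... | true | true | true | false = s≤s z≤n
      ... | true | true | true | true = s≤s z≤n

    -- A blue triangle inside the neighbourhood of `v` would form a K₄ with `v`. The factor 3
    -- accounts for the place of the non-neighbour.
    triangles≤ : sum₃ tri ≤ 3 * (∑[ x < suc n ] (ν̄ x * tri-at x))
    triangles≤ = begin
      sum₃ tri ≤⟨ sum-mono (λ x → sum₂-mono (pointwise x)) ⟩
      sum₃ (λ x y z → ν̄ x * tri x y z + ν̄ y * tri x y z + ν̄ z * tri x y z)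
        ≡⟨ trans (sum₃-+ (λ x y z → ν̄ x * tri x y z + ν̄ y * tri x y z) (λ x y z → ν̄ z * tri x y z))
             (cong (_+ A₃) (sum₃-+ (λ x y z → ν̄ x * tri x y z) (λ x y z → ν̄ y * tri x y z))) ⟩
      A₁ + A₂ + A₃ ≡⟨ cong₂ (λ x y → A₁ + x + y) A₂≡A₁ (trans A₃≡A₂ A₂≡A₁) ⟩
      A₁ + A₁ + A₁ ≡⟨ triple A₁ ⟩
      3 * A₁ ≡⟨ cong (3 *_) A₁≡ ⟩
      3 * (∑[ x < suc n ] (ν̄ x * tri-at x)) ∎
      where
      open ≤-Reasoning
      triple : ∀ a → a + a + a ≡ 3 * a
      triple = solve-∀
      A₁ = sum₃ (λ x y z → ν̄ x * tri x y z)
      A₂ = sum₃ (λ x y z → ν̄ y * tri x y z)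
      A₃ = sum₃ (λ x y z → ν̄ z * tri x y z)
      tri-swap₁₂ : ∀ x y z → tri x y z ≡ tri y x z
      tri-swap₁₂ x y z = cong₂ _*_ (cong bit (B-sym x y)) (*-comm (b x z) (b y z))
      tri-swap₂₃ : ∀ x y z → tri x y z ≡ tri x z y
      tri-swap₂₃ x y z = trans (rearrange (b x y) (b x z) (b y z)) (cong (λ e → b x z * (b x y * bit e)) (B-sym y z))
        where
        rearrange : ∀ a c e → a * (c * e) ≡ c * (a * e)
        rearrange = solve-∀
      A₂≡A₁ : A₂ ≡ A₁
      A₂≡A₁ = trans (∑-comm {suc n} {suc n} (λ x y → ∑[ z < suc n ] (ν̄ y * tri x y z)))
        (sum-cong-≗ λ y → sum₂-cong λ x z → cong (ν̄ y *_) (tri-swap₁₂ x y z))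
      A₃≡A₂ : A₃ ≡ A₂
      A₃≡A₂ = sum-cong-≗ λ x → trans (∑-comm {suc n} {suc n} (λ y z → ν̄ z * tri x y z))
        (sum₂-cong λ z y → cong (ν̄ z *_) (tri-swap₂₃ x y z))
      A₁≡ : A₁ ≡ ∑[ x < suc n ] (ν̄ x * tri-at x)
      A₁≡ = sum-cong-≗ λ x → trans (sum₂-factor (λ _ → ν̄ x) (tri x)) (sym (*-distribˡ-sum (ν̄ x) (λ y → sum (tri x y))))
      pointwise : ∀ x y z → tri x y z ≤ ν̄ x * tri x y z + ν̄ y * tri x y z + ν̄ z * tri x y z
      pointwise x y z with B x y in xy | B x z in xz | B y z in yz | E v x in vx | E v y in vy | E v z in vz
      ... | false | _ | _ | _ | _ | _ = z≤n
      ... | true | false | _ | _ | _ | _ = z≤n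
      ... | true | true | false | _ | _ | _ = z≤n
      ... | true | true | true | false | _ | _ = s≤s z≤n
      ... | true | true | true | true | false | _ = s≤s z≤n
      ... | true | true | true | true | true | false = s≤s z≤n
      ... | true | true | true | true | true | true = contradiction (B⇒E y z (is yz))
        (K₄-free v x y z (is vx) (is vy) (is vz) (B⇒E x y (is xy)) (B⇒E x z (is xz)))
        where
        is : ∀ {c} → c ≡ true → T c
        is refl = tt

    -- `v` is not adjacent to itself and so is counted by `s`.
    s≡suc : ∃[ s′ ] s ≡ suc s′
    s≡suc with s | term≤sum v ν̄
    ... | suc s′ | _ = s′ , refl
    ... | zero | le = contradiction (≤-trans (≤-reflexive (sym (bit-true (T-not⁺ (irrefl v))))) le) λ ()

  -- In this scale each red edge, met in 2 orders, and each blue triangle, met in 6 orders, weighs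
  -- 6.
  red-blue-bound : 3 * sum₂ r + sum₃ tri ≤ 6 * f (suc n)
  red-blue-bound = begin
    3 * sum₂ r + sum₃ tri
      ≤⟨ +-mono-≤ (*-monoʳ-≤ 3 edges≤) triangles≤ ⟩
    3 * (2 * D + ρ) + 3 * Tr ≡⟨ collect D ρ Tr ⟩
    3 * ((2 * D + Tr) + ρ) ≤⟨ *-monoʳ-≤ 3 (+-monoˡ-≤ ρ weights≤) ⟩
    3 * (s * (2 * p + Y) + ρ) ≤⟨ *-monoʳ-≤ 3 (final s′ (proj₂ s≡suc)) ⟩
    3 * (2 * f (suc n)) ≡⟨ sym (*-assoc 3 2 (f (suc n))) ⟩
    6 * f (suc n) ∎
    where
    open ≤-Reasoning
    s′ = proj₁ s≡suc
    D = ∑[ x < suc n ] (ν̄ x * degᵣ x)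
    Tr = ∑[ x < suc n ] (ν̄ x * tri-at x)
    collect : ∀ d r t → 3 * (2 * d + r) + 3 * t ≡ 3 * ((2 * d + t) + r)
    collect = solve-∀
    weights≤ : 2 * D + Tr ≤ s * (2 * p + Y)
    weights≤ = begin
      2 * D + Tr ≡⟨ cong (_+ Tr) (*-distribˡ-sum 2 (λ x → ν̄ x * degᵣ x)) ⟩
      ∑[ x < suc n ] (2 * (ν̄ x * degᵣ x)) + Tr
        ≡⟨ sym (∑-distrib-+ (λ x → 2 * (ν̄ x * degᵣ x)) (λ x → ν̄ x * tri-at x)) ⟩
      ∑[ x < suc n ] (2 * (ν̄ x * degᵣ x) + ν̄ x * tri-at x)
        ≡⟨ sum-cong-≗ (λ x → factor (ν̄ x) (degᵣ x) (tri-at x)) ⟩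
      ∑[ x < suc n ] (ν̄ x * weight-at x)
        ≤⟨ sum-mono (λ x → *-monoʳ-≤ (ν̄ x) (proj₂ max x)) ⟩
      ∑[ x < suc n ] (ν̄ x * weight-at v) ≡⟨ sym (*-distribʳ-sum (weight-at v) ν̄) ⟩
      s * (2 * p + Y) ∎
      where
      factor : ∀ c d t → 2 * (c * d) + c * t ≡ c * (2 * d + t)
      factor = solve-∀
    final : ∀ s′ → s ≡ suc s′ → s * (2 * p + Y) + ρ ≤ 2 * f (suc n)
    final s′ s≡ = begin
      s * (2 * p + Y) + ρ ≡⟨ cong (λ z → z * (2 * p + Y) + ρ) s≡ ⟩
      -- One of the `suc s′` copies of `Y` is set aside to be bounded jointly with `ρ`; each of the
      -- others is bounded by 2 h k. This is why `weighted-bound` has `s` and not `suc s` before h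
      -- k.
      suc s′ * (2 * p + Y) + ρ ≡⟨ regroup s′ p Y ρ ⟩
      2 * (suc s′ * p) + s′ * Y + (Y + ρ)
        ≤⟨ +-mono-≤ (+-monoʳ-≤ (2 * (suc s′ * p)) (*-monoʳ-≤ s′ Y≤2hk)) Y+ρ≤2M ⟩
      2 * (suc s′ * p) + s′ * (2 * (h * k)) + 2 * ⌊ d ²/4⌋ ≡⟨ halve (suc s′ * p) s′ (h * k) ⌊ d ²/4⌋ ⟩
      2 * (suc s′ * p + s′ * (h * k) + ⌊ d ²/4⌋) ≡⟨ cong (λ z → 2 * (suc s′ * p + s′ * (h * k) + ⌊ z ²/4⌋)) (sym d≡) ⟩
      2 * (suc s′ * p + s′ * (h * k) + ⌊ p + (h + k) ²/4⌋)
        ≤⟨ *-monoʳ-≤ 2 (weighted-bound s′ p h k (subst (9 ≤_) (sym n≡) 9≤n)) ⟩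
      2 * f (suc s′ + (p + (h + k))) ≡⟨ cong (λ z → 2 * f z) n≡ ⟩
      2 * f (suc n) ∎
      where
      d≡ : p + (h + k) ≡ d
      d≡ = trans (cong (p +_) h+k≡q) p+q≡d
      n≡ : suc s′ + (p + (h + k)) ≡ suc n
      n≡ = trans (cong₂ _+_ (sym s≡) d≡) (trans (+-comm s d) d+s≡n)
      regroup : ∀ s p y r → suc s * (2 * p + y) + r ≡ 2 * (suc s * p) + s * y + (y + r)
      regroup = solve-∀
      halve : ∀ a s x m → 2 * a + s * (2 * x) + 2 * m ≡ 2 * (a + s * x + m)
      halve = solve-∀

-- Subsets with two and with three elements.

_≟ˢ_ : DecidableEquality (Subset n)
_≟ˢ_ = Vecₚ.≡-dec Boolₚ._≟_

_∈L?_ : ∀ (s : Subset n) L → Dec (s ∈ L)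
s ∈L? L = DecMembership._∈?_ _≟ˢ_ s L

set₂ : Fin n → Fin n → Subset n
set₂ x y = ⁅ x ⁆ ∪ ⁅ y ⁆

set₃ : Triple n → Subset n
set₃ (x , y , z) = ⁅ x ⁆ ∪ ⁅ y ⁆ ∪ ⁅ z ⁆

∈-set₂⁺ˡ : ∀ (x y : Fin n) → x ∈ˢ set₂ x y
∈-set₂⁺ˡ x y = x∈p∪q⁺ (inj₁ (x∈⁅x⁆ x))

∈-set₂⁺ʳ : ∀ (x y : Fin n) → y ∈ˢ set₂ x y
∈-set₂⁺ʳ x y = x∈p∪q⁺ (inj₂ (x∈⁅x⁆ y))

∈-set₂⁻ : ∀ {u} (x y : Fin n) → u ∈ˢ set₂ x y → u ≡ x ⊎ u ≡ y
∈-set₂⁻ x y h = Sum.map (x∈⁅y⁆⇒x≡y x) (x∈⁅y⁆⇒x≡y y) (x∈p∪q⁻ ⁅ x ⁆ ⁅ y ⁆ h)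

∈-set₃⁺ : ∀ {u} (t : Triple n) → u ∈ₜ t → u ∈ˢ set₃ t
∈-set₃⁺ (x , y , z) (inj₁ refl) = x∈p∪q⁺ (inj₁ (x∈⁅x⁆ x))
∈-set₃⁺ (x , y , z) (inj₂ (inj₁ refl)) = x∈p∪q⁺ (inj₂ (∈-set₂⁺ˡ y z))
∈-set₃⁺ (x , y , z) (inj₂ (inj₂ refl)) = x∈p∪q⁺ (inj₂ (∈-set₂⁺ʳ y z))

∈-set₃⁻ : ∀ {u} (t : Triple n) → u ∈ˢ set₃ t → u ∈ₜ t
∈-set₃⁻ (x , y , z) h = Sum.map (x∈⁅y⁆⇒x≡y x) (∈-set₂⁻ y z) (x∈p∪q⁻ ⁅ x ⁆ (set₂ y z) h)

set₃-⊆ : ∀ (s t : Triple n) → set₃ s ≡ set₃ t → s ⊆ₜ t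
set₃-⊆ s t eq = go (inj₁ refl) , go (inj₂ (inj₁ refl)) , go (inj₂ (inj₂ refl))
  where
  go : ∀ {u} → u ∈ₜ s → u ∈ₜ t
  go u∈ = ∈-set₃⁻ t (subst (_ ∈ˢ_) eq (∈-set₃⁺ s u∈))

set₃-swap₂₃ : ∀ (x y z : Fin n) → set₃ (x , y , z) ≡ set₃ (x , z , y)
set₃-swap₂₃ x y z = cong (⁅ x ⁆ ∪_) (∪-comm ⁅ y ⁆ ⁅ z ⁆)

set₃-swap₁₂ : ∀ (x y z : Fin n) → set₃ (x , y , z) ≡ set₃ (y , x , z)
set₃-swap₁₂ x y z = trans (sym (∪-assoc ⁅ x ⁆ ⁅ y ⁆ ⁅ z ⁆))
  (trans (cong (_∪ ⁅ z ⁆) (∪-comm ⁅ x ⁆ ⁅ y ⁆)) (∪-assoc ⁅ y ⁆ ⁅ x ⁆ ⁅ z ⁆))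

Distinct : Triple n → Set
Distinct (x , y , z) = x ≢ y × x ≢ z × y ≢ z

suc-≢ : ∀ {x y : Fin n} → x ≢ y → suc x ≢ suc y
suc-≢ h refl = h refl

size-0 : ∀ (t : Subset n) → ∣ t ∣ ≡ 0 → t ≡ ∅
size-0 [] h = refl
size-0 (outside ∷ t) h = cong (outside ∷_) (size-0 t h)

size-1 : ∀ (t : Subset n) → ∣ t ∣ ≡ 1 → ∃[ x ] t ≡ ⁅ x ⁆
size-1 (inside ∷ t) h = zero , cong (inside ∷_) (size-0 t (cong pred h))
size-1 (outside ∷ t) h = let x , eq = size-1 t h in suc x , cong (outside ∷_) eq

size-2 : ∀ (t : Subset n) → ∣ t ∣ ≡ 2 → ∃[ x ] ∃[ y ] x ≢ y × t ≡ set₂ x y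
size-2 (inside ∷ t) h =
  let y , eq = size-1 t (cong pred h)
  in zero , suc y , (λ ()) , cong (inside ∷_) (trans eq (sym (∪-identityˡ ⁅ y ⁆)))
size-2 (outside ∷ t) h =
  let x , y , x≢y , eq = size-2 t h in suc x , suc y , suc-≢ x≢y , cong (outside ∷_) eq

size-3 : ∀ (t : Subset n) → ∣ t ∣ ≡ 3 → ∃[ s ] Distinct s × t ≡ set₃ s
size-3 (inside ∷ t) h =
  let y , z , y≢z , eq = size-2 t (cong pred h)
  in (zero , suc y , suc z) , ((λ ()) , (λ ()) , suc-≢ y≢z) , cong (inside ∷_) (trans eq (sym (∪-identityˡ (set₂ y z))))
size-3 (outside ∷ t) h =
  let (x , y , z) , (xy , xz , yz) , eq = size-3 t h
  in (suc x , suc y , suc z) , (suc-≢ xy , suc-≢ xz , suc-≢ yz) , cong (outside ∷_) eq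

-- The set also has three distinct elements a, b, c. If two coordinates of `s` agreed, then a, b, c
-- would lie among two vertices.
size-3-distinct : ∀ (s : Triple n) → ∣ set₃ s ∣ ≡ 3 → Distinct s
size-3-distinct (x , y , z) h with size-3 _ h
... | t@(a , b , c) , (ab , ac , bc) , eq =
    (λ { refl → no-two x z (λ { (inj₁ e) → inj₁ e ; (inj₂ (inj₁ e)) → inj₁ e ; (inj₂ (inj₂ e)) → inj₂ e }) })
  , (λ { refl → no-two x y (λ { (inj₁ e) → inj₁ e ; (inj₂ (inj₁ e)) → inj₂ e ; (inj₂ (inj₂ e)) → inj₁ e }) })
  , (λ { refl → no-two x y (λ { (inj₁ e) → inj₁ e ; (inj₂ (inj₁ e)) → inj₂ e ; (inj₂ (inj₂ e)) → inj₂ e }) })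
  where
  t⊆ = set₃-⊆ t (x , y , z) (sym eq)
  no-two : ∀ p q → ¬ (∀ {u} → u ∈ₜ (x , y , z) → u ≡ p ⊎ u ≡ q)
  no-two p q two with two (proj₁ t⊆) | two (proj₁ (proj₂ t⊆)) | two (proj₂ (proj₂ t⊆))
  ... | inj₁ a≡ | inj₁ b≡ | _ = ab (trans a≡ (sym b≡))
  ... | inj₂ a≡ | inj₂ b≡ | _ = ab (trans a≡ (sym b≡))
  ... | inj₁ a≡ | inj₂ _ | inj₁ c≡ = ac (trans a≡ (sym c≡))
  ... | inj₁ _ | inj₂ b≡ | inj₂ c≡ = bc (trans b≡ (sym c≡))
  ... | inj₂ _ | inj₁ b≡ | inj₁ c≡ = bc (trans b≡ (sym c≡))
  ... | inj₂ a≡ | inj₁ _ | inj₂ c≡ = ac (trans a≡ (sym c≡))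

-- Double counting of the orderings of sets

two-terms≤sum : ∀ {x y} (g : Fin n → ℕ) → x ≢ y → g x + g y ≤ sum g
two-terms≤sum {suc n} {x} {y} g x≢y = begin
  g x + g y ≡⟨ cong (λ z → g x + g z) (sym (Finₚ.punchIn-punchOut x≢y)) ⟩
  g x + g (punchIn x (punchOut x≢y)) ≤⟨ +-monoʳ-≤ (g x) (term≤sum (punchOut x≢y) (g ∘ punchIn x)) ⟩
  g x + sum (g ∘ punchIn x) ≡⟨ sym (sum-remove g) ⟩
  sum g ∎
  where open ≤-Reasoning

three-terms≤sum : ∀ {x y z} (g : Fin n → ℕ) → Distinct (x , y , z) → g x + (g y + g z) ≤ sum g
three-terms≤sum {suc n} {x} {y} {z} g (xy , xz , yz) = begin
  g x + (g y + g z)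
    ≡⟨ cong₂ (λ u v → g x + (g u + g v)) (sym (Finₚ.punchIn-punchOut xy)) (sym (Finₚ.punchIn-punchOut xz)) ⟩
  g x + (g (punchIn x (punchOut xy)) + g (punchIn x (punchOut xz)))
    ≤⟨ +-monoʳ-≤ (g x) (two-terms≤sum (g ∘ punchIn x) (yz ∘ Finₚ.punchOut-injective xy xz)) ⟩
  g x + sum (g ∘ punchIn x) ≡⟨ sym (sum-remove g) ⟩
  sum g ∎
  where open ≤-Reasoning

δ : Subset n → Subset n → ℕ
δ s t = bit (does (s ≟ˢ t))

δ-≡ : ∀ {s t : Subset n} → s ≡ t → δ s t ≡ 1
δ-≡ {s = s} {t} eq with s ≟ˢ t
... | yes _ = refl
... | no ≢ = contradiction eq ≢

pair-orderings : ∀ (t : Subset n) → ∣ t ∣ ≡ 2 → 2 ≤ sum₂ (λ x y → δ (set₂ x y) t)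
pair-orderings t h with size-2 t h
... | a , b , a≢b , t≡ = begin
  2 ≡⟨ sym (cong₂ _+_ (δ-≡ (sym t≡)) (δ-≡ (trans (∪-comm ⁅ b ⁆ ⁅ a ⁆) (sym t≡)))) ⟩
  δ (set₂ a b) t + δ (set₂ b a) t
    ≤⟨ +-mono-≤ (term≤sum b (λ y → δ (set₂ a y) t)) (term≤sum a (λ y → δ (set₂ b y) t)) ⟩
  sum (λ y → δ (set₂ a y) t) + sum (λ y → δ (set₂ b y) t)
    ≤⟨ two-terms≤sum (λ x → sum (λ y → δ (set₂ x y) t)) a≢b ⟩
  sum₂ (λ x y → δ (set₂ x y) t) ∎
  where open ≤-Reasoning

triple-orderings : ∀ (t : Subset n) → ∣ t ∣ ≡ 3 → 6 ≤ sum₃ (λ x y z → δ (set₃ (x , y , z)) t)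
triple-orderings {n} t h with size-3 t h
... | (a , b , c) , (ab , ac , bc) , t≡ = begin
  6 ≤⟨ +-mono-≤ (from ab bc ac (sym t≡) ) (+-mono-≤ (from (ab ∘ sym) ac bc (trans (set₃-swap₁₂ b a c) (sym t≡)))
          (from (ac ∘ sym) ab (bc ∘ sym) (trans (trans (set₃-swap₁₂ c a b) (set₃-swap₂₃ a c b)) (sym t≡)))) ⟩
  F a + (F b + F c) ≤⟨ three-terms≤sum F (ab , ac , bc) ⟩
  sum F ∎
  where
  open ≤-Reasoning
  F : Fin n → ℕ
  F x = sum₂ (λ y z → δ (set₃ (x , y , z)) t)
  from : ∀ {x y z} → x ≢ y → y ≢ z → x ≢ z → set₃ (x , y , z) ≡ t → 2 ≤ F x
  from {x} {y} {z} xy yz xz eq = begin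
    2 ≡⟨ sym (cong₂ _+_ (δ-≡ eq) (δ-≡ (trans (set₃-swap₂₃ x z y) eq))) ⟩
    δ (set₃ (x , y , z)) t + δ (set₃ (x , z , y)) t
      ≤⟨ +-mono-≤ (term≤sum z (λ u → δ (set₃ (x , y , u)) t)) (term≤sum y (λ u → δ (set₃ (x , z , u)) t)) ⟩
    sum (λ u → δ (set₃ (x , y , u)) t) + sum (λ u → δ (set₃ (x , z , u)) t)
      ≤⟨ two-terms≤sum (λ y → sum (λ u → δ (set₃ (x , y , u)) t)) yz ⟩
    F x ∎

weight-δ≤ : ∀ (s : Subset n) L → Unique L → weight (δ s) L ≤ bit (does (s ∈L? L))
weight-δ≤ s [] u = z≤n
weight-δ≤ s (t ∷ L) (t∉ ∷ u) with s ≟ˢ t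
... | yes refl = s≤s (≤-trans (weight-δ≤ s L u) (≤-reflexive (absent t∉)))
  where
  absent : All (s ≢_) L → bit (does (s ∈L? L)) ≡ 0
  absent h with s ∈L? L
  ... | yes s∈ = contradiction refl (All.lookup h s∈)
  ... | no _ = refl
... | no _ with s ∈L? L | weight-δ≤ s L u
... | yes _ | le = le
... | no _ | le = le

sum-weight : ∀ {A : Set} (g : Fin n → A → ℕ) L → sum (λ x → weight (g x) L) ≡ weight (λ t → sum (λ x → g x t)) L
sum-weight {n} g [] = trans (sum-const n 0) (*-zeroʳ n)
sum-weight g (t ∷ L) = trans (∑-distrib-+ (λ x → g x t) (λ x → weight (g x) L)) (cong (_ +_) (sum-weight g L))

weight-≥ : ∀ {A : Set} c (g : A → ℕ) L → All (λ t → c ≤ g t) L → c * length L ≤ weight g L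
weight-≥ c g [] h = ≤-reflexive (*-zeroʳ c)
weight-≥ c g (t ∷ L) (p ∷ h) = ≤-trans (≤-reflexive (*-suc c (length L))) (+-mono-≤ p (weight-≥ c g L h))

-- Exchange of summation: every pair of `L` arises from two orderings, and every ordering gives at
-- most one entry of the duplicate-free `L`.
count-pairs : ∀ (L : List (Subset n)) → Unique L → All (λ t → ∣ t ∣ ≡ 2) L →
              2 * length L ≤ sum₂ (λ x y → bit (does (set₂ x y ∈L? L)))
count-pairs L u h = begin
  2 * length L ≤⟨ weight-≥ 2 _ L (All.map (λ {t} → pair-orderings t) h) ⟩
  weight (λ t → sum₂ (λ x y → δ (set₂ x y) t)) L
    ≡⟨ sym (sum-weight (λ x t → sum (λ y → δ (set₂ x y) t)) L) ⟩
  sum (λ x → weight (λ t → sum (λ y → δ (set₂ x y) t)) L)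
    ≡⟨ sum-cong-≗ (λ x → sym (sum-weight (λ y t → δ (set₂ x y) t) L)) ⟩
  sum₂ (λ x y → weight (δ (set₂ x y)) L) ≤⟨ sum₂-mono (λ x y → weight-δ≤ (set₂ x y) L u) ⟩
  sum₂ (λ x y → bit (does (set₂ x y ∈L? L))) ∎
  where open ≤-Reasoning

count-triples : ∀ (L : List (Subset n)) → Unique L → All (λ t → ∣ t ∣ ≡ 3) L →
                6 * length L ≤ sum₃ (λ x y z → bit (does (set₃ (x , y , z) ∈L? L)))
count-triples L u h = begin
  6 * length L ≤⟨ weight-≥ 6 _ L (All.map (λ {t} → triple-orderings t) h) ⟩
  weight (λ t → sum₃ (λ x y z → δ (set₃ (x , y , z)) t)) L
    ≡⟨ sym (sum-weight (λ x t → sum₂ (λ y z → δ (set₃ (x , y , z)) t)) L) ⟩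
  sum (λ x → weight (λ t → sum₂ (λ y z → δ (set₃ (x , y , z)) t)) L)
    ≡⟨ sum-cong-≗ (λ x → trans (sym (sum-weight (λ y t → sum (λ z → δ (set₃ (x , y , z)) t)) L))
         (sum-cong-≗ λ y → sym (sum-weight (λ z t → δ (set₃ (x , y , z)) t) L))) ⟩
  sum₃ (λ x y z → weight (δ (set₃ (x , y , z))) L)
    ≤⟨ sum-mono (λ x → sum₂-mono λ y z → weight-δ≤ (set₃ (x , y , z)) L u) ⟩
  sum₃ (λ x y z → bit (does (set₃ (x , y , z) ∈L? L))) ∎
  where open ≤-Reasoning

-- From triple systems to Boolean functions.

pairIndex : Fin 4 → Fin 4 → Fin 6
pairIndex 0F 1F = 0F
pairIndex 0F 2F = 1F
pairIndex 0F 3F = 2F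
pairIndex 1F 2F = 3F
pairIndex 1F 3F = 4F
pairIndex 2F 3F = 5F
-- A default for i ≥ j, where `BergeK₄` puts no constraint on `e`.
pairIndex _ _ = 0F

lo-pairIndex : ∀ i j → i Fin.< j → lo (pairIndex i j) ≡ i
lo-pairIndex = toWitness {a? = Finₚ.all? λ i → Finₚ.all? λ j → (i Finₚ.<? j) →-dec (lo (pairIndex i j) Finₚ.≟ i)} tt

hi-pairIndex : ∀ i j → i Fin.< j → hi (pairIndex i j) ≡ j
hi-pairIndex = toWitness {a? = Finₚ.all? λ i → Finₚ.all? λ j → (i Finₚ.<? j) →-dec (hi (pairIndex i j) Finₚ.≟ j)} tt

toSys : TripleSystem n → Sys n
toSys K x y z = does (set₃ (x , y , z) ∈L? triples K)

does-T : ∀ {P : Set} (d : Dec P) → T (does d) → P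
does-T (yes p) _ = p

T-does : ∀ {P : Set} (d : Dec P) → P → T (does d)
T-does (yes _) _ = tt
T-does (no ¬p) p = ¬p p

toSys-∈ : ∀ (K : TripleSystem n) t → holds (toSys K) t → set₃ t ∈ triples K
toSys-∈ K t = does-T (set₃ t ∈L? triples K)

Berge⇒BergeK₄ : ∀ (K : TripleSystem n) → Berge (toSys K) → BergeK₄ K
Berge⇒BergeK₄ K b = record
  { v = core
  ; v-distinct = core-inj
  ; e = λ i j → set₃ (edge (pairIndex i j))
  ; e-triple = λ {i} {j} _ → toSys-∈ K _ (edge-in (pairIndex i j))
  ; e-distinct = λ {i} {j} {k} {l} i<j k<l eq →
      let s = set₃-⊆ (edge (pairIndex i j)) (edge (pairIndex k l)) eq
          s′ = set₃-⊆ (edge (pairIndex k l)) (edge (pairIndex i j)) (sym eq)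
          same = edge-inj _ _ s s′
      in trans (sym (lo-pairIndex i j i<j)) (trans (cong lo same) (lo-pairIndex k l k<l))
       , trans (sym (hi-pairIndex i j i<j)) (trans (cong hi same) (hi-pairIndex k l k<l))
  ; e-contains = λ {i} {j} i<j →
      subst (λ k → core k ∈ˢ set₃ (edge (pairIndex i j))) (lo-pairIndex i j i<j) (∈-set₃⁺ _ (lo∈ _))
    , subst (λ k → core k ∈ˢ set₃ (edge (pairIndex i j))) (hi-pairIndex i j i<j) (∈-set₃⁺ _ (hi∈ _))
  }
  where open Berge b

toSys-good : ∀ (K : TripleSystem n) → 𝓑-Free K → Good (toSys K)
toSys-good K free = record
  { swap₁₂ = λ x y z → cong (λ s → does (s ∈L? triples K)) (set₃-swap₁₂ x y z)
  ; swap₂₃ = λ x y z → cong (λ s → does (s ∈L? triples K)) (set₃-swap₂₃ x y z)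
  ; irrefl = λ x z h → proj₁ (size-3-distinct (x , x , z)
      (All.lookup (uniform K) (toSys-∈ K (x , x , z) h))) refl
  ; free = free ∘ Berge⇒BergeK₄ K
  }

6*size≤S : ∀ (K : TripleSystem n) → 6 * size K ≤ S (toSys K)
6*size≤S K = count-triples (triples K) (unique K) (uniform K)

-- The auxiliary red-blue graph

Covers : Subset n → Subset n → Set
Covers {n} t p = ∃[ x ] ∃[ y ] x ≢ y × x ∈ˢ t × y ∈ˢ t × set₂ x y ≡ p

covers-escape : ∀ (t : Subset n) P → (∀ p → Covers t p → p ∈ P) ⊎ ∃[ p ] Covers t p × p ∉ P
covers-escape {n} t P with Finₚ.any? (λ x → Finₚ.any? (λ y →
  ¬? (x Finₚ.≟ y) ×-dec (x ∈ˢ? t) ×-dec (y ∈ˢ? t) ×-dec ¬? (set₂ x y ∈L? P)))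
... | yes (x , y , x≢y , x∈ , y∈ , ∉P) = inj₂ (set₂ x y , (x , y , x≢y , x∈ , y∈ , refl) , ∉P)
... | no none = inj₁ λ { _ (x , y , x≢y , x∈ , y∈ , refl) → case set₂ x y ∈L? P of λ
  { (yes ∈P) → ∈P ; (no ∉P) → contradiction (x , y , x≢y , x∈ , y∈ , ∉P) none } }

size-set₂ : ∀ {x y : Fin n} → x ≢ y → ∣ set₂ x y ∣ ≡ 2
size-set₂ {x = zero} {zero} h = contradiction refl h
size-set₂ {x = zero} {suc y} h = cong suc (trans (cong ∣_∣ (∪-identityˡ ⁅ y ⁆)) (∣⁅x⁆∣≡1 y))
size-set₂ {x = suc x} {zero} h = trans (cong ∣_∣ (∪-comm ⁅ suc x ⁆ ⁅ zero ⁆)) (size-set₂ {x = zero} {suc x} λ ())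
size-set₂ {x = suc x} {suc y} h = size-set₂ {x = x} {y} (h ∘ cong suc)

unique-++ˡ : ∀ {A : Set} (xs : List A) {ys} → Unique (xs ++ ys) → Unique xs
unique-++ˡ [] u = []
unique-++ˡ (x ∷ xs) (x∉ ∷ u) = Allₚ.++⁻ˡ xs x∉ ∷ unique-++ˡ xs u

unique-++ʳ : ∀ {A : Set} (xs : List A) {ys} → Unique (xs ++ ys) → Unique ys
unique-++ʳ [] u = u
unique-++ʳ (x ∷ xs) (_ ∷ u) = unique-++ʳ xs u

unique-++-disjoint : ∀ {A : Set} (xs : List A) {ys z} → Unique (xs ++ ys) → z ∈ xs → z ∉ ys
unique-++-disjoint (x ∷ xs) (x∉ ∷ u) (here refl) z∈ys = All.lookup (Allₚ.++⁻ʳ xs x∉) z∈ys refl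
unique-++-disjoint (x ∷ xs) (x∉ ∷ u) (there z∈) z∈ys = unique-++-disjoint xs u z∈ z∈ys

functional : ∀ {A B : Set} (M : List (A × B)) → Unique (map proj₁ M) →
             ∀ {a b c} → (a , b) ∈ M → (a , c) ∈ M → b ≡ c
functional (_ ∷ M) (_ ∷ u) (here refl) (here refl) = refl
functional (_ ∷ M) (a∉ ∷ u) (here refl) (there q) = contradiction refl (All.lookup a∉ (∈-map⁺ proj₁ q))
functional (_ ∷ M) (a∉ ∷ u) (there p) (here refl) = contradiction refl (All.lookup a∉ (∈-map⁺ proj₁ p))
functional (_ ∷ M) (_ ∷ u) (there p) (there q) = functional M u p q

module LargeCase {n} (9≤n : 9 ≤ suc n) (K : TripleSystem (suc n)) (free : 𝓑-Free K) where

  open Matching (Covers {suc n}) _≟ˢ_ covers-escape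
  open Matched (matched (triples K))

  private
    V = Fin (suc n)
    M = blue ++ red
    -- By `closed` these triples have only blue pairs and are counted as blue triangles; the
    -- remaining triples are counted by their red pairs.
    core-triples : List (Subset (suc n))
    core-triples = loose ++ map proj₁ blue

    parts′ : triples K ↭ core-triples ++ map proj₁ red
    parts′ = ↭-trans parts (↭-reflexive (sym (++-assoc loose (map proj₁ blue) (map proj₁ red))))

    parts″ : triples K ↭ loose ++ map proj₁ M
    parts″ = ↭-trans parts (↭-reflexive (cong (loose ++_) (sym (map-++ proj₁ blue red))))

    unique₁ : Unique (map proj₁ M)
    unique₁ = unique-++ʳ loose (Unique-↭ parts″ (unique K))

    R B : V → V → Bool
    R x y = does (set₂ x y ∈L? map proj₂ red)
    B x y = does (set₂ x y ∈L? map proj₂ blue)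

    E⇒∈ : ∀ x y → T (R x y ∨ B x y) → ∃[ t ] (t , set₂ x y) ∈ M
    E⇒∈ x y h with ∨-elim (R x y) h
    ... | inj₁ r = let (t , _) , e∈ , eq = ∈-map⁻ proj₂ (does-T (set₂ x y ∈L? map proj₂ red) r)
                   in t , subst (λ s → (t , s) ∈ M) (sym eq) (∈-++⁺ʳ blue e∈)
    ... | inj₂ b = let (t , _) , e∈ , eq = ∈-map⁻ proj₂ (does-T (set₂ x y ∈L? map proj₂ blue) b)
                   in t , subst (λ s → (t , s) ∈ M) (sym eq) (∈-++⁺ˡ e∈)

    -- The matching knows the pair through some endpoints a, b; equality of the two sets carries
    -- membership in `t` and distinctness over to x, y.
    M-covers : ∀ {t x y} → (t , set₂ x y) ∈ M → x ≢ y × x ∈ˢ t × y ∈ˢ t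
    M-covers {t} {x} {y} e∈ with All.lookup edges e∈
    ... | a , b , a≢b , a∈ , b∈ , eq = distinct′ , member (∈-set₂⁺ˡ x y) , member (∈-set₂⁺ʳ x y)
      where
      member : ∀ {u} → u ∈ˢ set₂ x y → u ∈ˢ t
      member u∈ with ∈-set₂⁻ a b (subst (_ ∈ˢ_) (sym eq) u∈)
      ... | inj₁ refl = a∈
      ... | inj₂ refl = b∈
      distinct′ : x ≢ y
      distinct′ refl = a≢b (trans (is-x (∈-set₂⁺ˡ a b)) (sym (is-x (∈-set₂⁺ʳ a b))))
        where
        is-x : ∀ {u} → u ∈ˢ set₂ a b → u ≡ x
        is-x u∈ with ∈-set₂⁻ x x (subst (_ ∈ˢ_) eq u∈)
        ... | inj₁ u≡x = u≡x
        ... | inj₂ u≡x = u≡x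

    irrefl : ∀ x → ¬ T (R x x ∨ B x x)
    irrefl x h = proj₁ (M-covers (proj₂ (E⇒∈ x x h))) refl

    R-sym : ∀ x y → R x y ≡ R y x
    R-sym x y = cong (λ s → does (s ∈L? map proj₂ red)) (∪-comm ⁅ x ⁆ ⁅ y ⁆)

    B-sym : ∀ x y → B x y ≡ B y x
    B-sym x y = cong (λ s → does (s ∈L? map proj₂ blue)) (∪-comm ⁅ x ⁆ ⁅ y ⁆)

    disjoint : ∀ x y → ¬ (T (R x y) × T (B x y))
    disjoint x y (r , b) = unique-++-disjoint (map proj₂ blue) unique₂
      (does-T (set₂ x y ∈L? map proj₂ blue) b) (does-T (set₂ x y ∈L? map proj₂ red) r)

    -- Four vertices with six matched pairs span a Berge-K₄: each pair uses its own triple, and a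
    -- triple matched to two pairs would make these pairs equal.
    module _ (v : Fin 4 → V) (repr : ∀ p → ∃[ t ] (t , set₂ (v (lo p)) (v (hi p))) ∈ M) where

      repr′ : ∀ {i j} → i Fin.< j → (proj₁ (repr (pairIndex i j)) , set₂ (v i) (v j)) ∈ M
      repr′ {i} {j} i<j = subst₂ (λ k l → (proj₁ (repr (pairIndex i j)) , set₂ (v k) (v l)) ∈ M)
        (lo-pairIndex i j i<j) (hi-pairIndex i j i<j) (proj₂ (repr (pairIndex i j)))

      v-inj : Injective _≡_ _≡_ v
      v-inj {i} {j} eq with Finₚ.<-cmp i j
      ... | tri< i<j _ _ = contradiction eq (proj₁ (M-covers (repr′ i<j)))
      ... | tri≈ _ i≡j _ = i≡j
      ... | tri> _ _ j<i = contradiction (sym eq) (proj₁ (M-covers (repr′ j<i)))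

      same-pair : ∀ {i j k l} → i Fin.< j → k Fin.< l → set₂ (v i) (v j) ≡ set₂ (v k) (v l) → i ≡ k × j ≡ l
      same-pair {i} {j} {k} {l} i<j k<l eq
        with ∈-set₂⁻ (v k) (v l) (subst (v i ∈ˢ_) eq (∈-set₂⁺ˡ (v i) (v j)))
           | ∈-set₂⁻ (v k) (v l) (subst (v j ∈ˢ_) eq (∈-set₂⁺ʳ (v i) (v j)))
      ... | inj₁ p | inj₁ q = contradiction (v-inj (trans p (sym q))) (Finₚ.<⇒≢ i<j)
      ... | inj₁ p | inj₂ q = v-inj p , v-inj q
      ... | inj₂ p | inj₂ q = contradiction (v-inj (trans p (sym q))) (Finₚ.<⇒≢ i<j)
      ... | inj₂ p | inj₁ q = contradiction
        (subst₂ Fin._<_ (sym (v-inj q)) (sym (v-inj p)) k<l) (<-asym i<j)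

      berge : BergeK₄ K
      berge = record
        { v = v
        ; v-distinct = v-inj
        ; e = λ i j → proj₁ (repr (pairIndex i j))
        ; e-triple = λ {i} {j} i<j → ∈-resp-↭ (↭-sym parts″) (∈-++⁺ʳ loose (∈-map⁺ proj₁ (repr′ i<j)))
        ; e-distinct = λ {i} {j} {k} {l} i<j k<l eq → same-pair i<j k<l
            (functional M unique₁ (repr′ i<j) (subst (λ t → (t , set₂ (v k) (v l)) ∈ M) (sym eq) (repr′ k<l)))
        ; e-contains = λ i<j → proj₂ (M-covers (repr′ i<j))
        }

    K₄-free : ∀ w x y z → T (R w x ∨ B w x) → T (R w y ∨ B w y) → T (R w z ∨ B w z) →
              T (R x y ∨ B x y) → T (R x z ∨ B x z) → ¬ T (R y z ∨ B y z)
    K₄-free w x y z wx wy wz xy xz yz = free (berge (vertex (w , x , y , z)) λ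
      { 0F → E⇒∈ w x wx ; 1F → E⇒∈ w y wy ; 2F → E⇒∈ w z wz
      ; 3F → E⇒∈ x y xy ; 4F → E⇒∈ x z xz ; 5F → E⇒∈ y z yz })

    open RedBlue 9≤n R B R-sym B-sym irrefl disjoint K₄-free

    core-uniform : All (λ t → ∣ t ∣ ≡ 3) core-triples
    core-uniform = Allₚ.++⁻ˡ core-triples (All-resp-↭ parts′ (uniform K))

    core⇒tri : ∀ x y z → bit (does (set₃ (x , y , z) ∈L? core-triples)) ≤ tri x y z
    core⇒tri x y z with set₃ (x , y , z) ∈L? core-triples
    ... | no _ = z≤n
    ... | yes t∈ = ≤-reflexive (sym (cong₂ _*_
        (blue-pair xy (inj₁ refl) (inj₂ (inj₁ refl)))
        (cong₂ _*_ (blue-pair xz (inj₁ refl) (inj₂ (inj₂ refl)))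
                   (blue-pair yz (inj₂ (inj₁ refl)) (inj₂ (inj₂ refl))))))
      where
      t = x , y , z
      dist = size-3-distinct t (All.lookup core-uniform t∈)
      xy = proj₁ dist
      xz = proj₁ (proj₂ dist)
      yz = proj₂ (proj₂ dist)
      blue-pair : ∀ {u v} → u ≢ v → u ∈ₜ t → v ∈ₜ t → b u v ≡ 1
      blue-pair {u} {v} u≢v u∈ v∈ = bit-true (T-does (set₂ u v ∈L? map proj₂ blue)
        (closed t∈ (u , v , u≢v , ∈-set₃⁺ t u∈ , ∈-set₃⁺ t v∈ , refl)))

    6*core≤ : 6 * length core-triples ≤ sum₃ tri
    6*core≤ = ≤-trans
      (count-triples core-triples (unique-++ˡ core-triples (Unique-↭ parts′ (unique K))) core-uniform)
      (sum-mono λ x → sum₂-mono (core⇒tri x))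

    6*red≤ : 6 * length red ≤ 3 * sum₂ r
    6*red≤ = begin
      6 * length red ≡⟨ *-assoc 3 2 (length red) ⟩
      3 * (2 * length red) ≡⟨ cong (λ l → 3 * (2 * l)) (sym (length-map proj₂ red)) ⟩
      3 * (2 * length (map proj₂ red))
        ≤⟨ *-monoʳ-≤ 3 (count-pairs (map proj₂ red) (unique-++ʳ (map proj₂ blue) unique₂)
             (Allₚ.map⁺ (All.map (λ { (x , y , x≢y , _ , _ , refl) → size-set₂ x≢y }) (Allₚ.++⁻ʳ blue edges)))) ⟩
      3 * sum₂ r ∎
      where open ≤-Reasoning

  size≤f : size K ≤ f (suc n)
  size≤f = *-cancelˡ-≤ 6 (begin
    6 * size K ≡⟨ cong (6 *_) (↭-length parts′) ⟩
    6 * length (core-triples ++ map proj₁ red)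
      ≡⟨ cong (6 *_) (trans (length-++ core-triples) (cong (length core-triples +_) (length-map proj₁ red))) ⟩
    6 * (length core-triples + length red) ≡⟨ *-distribˡ-+ 6 (length core-triples) (length red) ⟩
    6 * length core-triples + 6 * length red ≤⟨ +-mono-≤ 6*core≤ 6*red≤ ⟩
    sum₃ tri + 3 * sum₂ r ≡⟨ +-comm (sum₃ tri) (3 * sum₂ r) ⟩
    3 * sum₂ r + sum₃ tri ≤⟨ red-blue-bound ⟩
    6 * f (suc n) ∎)
    where open ≤-Reasoning

-- The upper bound.

small-case : ∀ {n} c → (∀ (H : Sys n) → Good H → S H < 6 * c + 1) → ∀ (K : TripleSystem n) → 𝓑-Free K → size K ≤ c
small-case c bound K free = *-cancelˡ-≤ 6 (m<1+n⇒m≤n (begin-strict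
  6 * size K ≤⟨ 6*size≤S K ⟩
  S (toSys K) <⟨ bound (toSys K) (toSys-good K free) ⟩
  6 * c + 1 ≡⟨ +-comm (6 * c) 1 ⟩
  suc (6 * c) ∎))
  where open ≤-Reasoning

upper-bound : ∀ n → 6 ≤ n → ∀ (K : TripleSystem n) → 𝓑-Free K → size K ≤ f n
-- The constants 8, 12 and 18 are the values of `f` at 6, 7 and 8.
upper-bound 6 _ = small-case 8 S-bound-6
upper-bound 7 _ = small-case 12 S-bound-7
upper-bound 8 _ = small-case 18 S-bound-8
upper-bound (suc (suc (suc (suc (suc (suc (suc (suc (suc n))))))))) _ K free = LargeCase.size≤f (m≤m+n 9 n) K free
upper-bound 0 ()
upper-bound 1 (s≤s ())
upper-bound 2 (s≤s (s≤s ()))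
upper-bound 3 (s≤s (s≤s (s≤s ())))
upper-bound 4 (s≤s (s≤s (s≤s (s≤s ()))))
upper-bound 5 (s≤s (s≤s (s≤s (s≤s (s≤s ())))))

-- Complete 3-partite systems and the lower bound.

elements : Subset n → List (Fin n)
elements [] = []
elements (inside ∷ p) = zero ∷ map suc (elements p)
elements (outside ∷ p) = map suc (elements p)

length-elements : ∀ (p : Subset n) → length (elements p) ≡ ∣ p ∣
length-elements [] = refl
length-elements (inside ∷ p) = cong suc (trans (length-map suc (elements p)) (length-elements p))
length-elements (outside ∷ p) = trans (length-map suc (elements p)) (length-elements p)

∈-elements⁺ : ∀ {p : Subset n} {x} → x ∈ˢ p → x ∈ elements p
∈-elements⁺ Vec.here = here refl
∈-elements⁺ {p = inside ∷ p} (Vec.there x∈) = there (∈-map⁺ suc (∈-elements⁺ x∈))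
∈-elements⁺ {p = outside ∷ p} (Vec.there x∈) = ∈-map⁺ suc (∈-elements⁺ x∈)

∈-elements⁻ : ∀ (p : Subset n) {x} → x ∈ elements p → x ∈ˢ p
∈-elements⁻ (inside ∷ p) (here refl) = Vec.here
∈-elements⁻ (inside ∷ p) (there x∈) with ∈-map⁻ suc x∈
... | y , y∈ , refl = Vec.there (∈-elements⁻ p y∈)
∈-elements⁻ (outside ∷ p) x∈ with ∈-map⁻ suc x∈
... | y , y∈ , refl = Vec.there (∈-elements⁻ p y∈)

unique-elements : ∀ (p : Subset n) → Unique (elements p)
unique-elements [] = []
unique-elements (inside ∷ p) =
  All.tabulate (λ x∈ 0≡x → case-zero (∈-map⁻ suc x∈) 0≡x) ∷ Uniqueₚ.map⁺ Finₚ.suc-injective (unique-elements p)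
  where
  case-zero : ∀ {x} → ∃[ y ] y ∈ elements p × x ≡ suc y → ¬ zero ≡ x
  case-zero (_ , _ , refl) ()
unique-elements (outside ∷ p) = Uniqueₚ.map⁺ Finₚ.suc-injective (unique-elements p)

length-cartesianProduct : ∀ {A B : Set} (xs : List A) (ys : List B) →
                          length (cartesianProduct xs ys) ≡ length xs * length ys
length-cartesianProduct [] ys = refl
length-cartesianProduct (x ∷ xs) ys = trans (length-++ (map (x ,_) ys))
  (cong₂ _+_ (length-map (x ,_) ys) (length-cartesianProduct xs ys))

unique-map : ∀ {A B : Set} (g : A → B) xs → (∀ {x y} → x ∈ xs → y ∈ xs → g x ≡ g y → x ≡ y) →
             Unique xs → Unique (map g xs)
unique-map g [] inj u = []
unique-map g (x ∷ xs) inj (x∉ ∷ u) =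
  All.tabulate (λ z∈ gx≡z → let y , y∈ , z≡ = ∈-map⁻ g z∈ in
    All.lookup x∉ y∈ (inj (here refl) (there y∈) (trans gx≡z z≡)))
  ∷ unique-map g xs (λ x∈ y∈ → inj (there x∈) (there y∈)) u

size-set₃ : ∀ (t : Triple n) → Distinct t → ∣ set₃ t ∣ ≡ 3
size-set₃ (zero , zero , z) (xy , _) = contradiction refl xy
size-set₃ (zero , suc y , zero) (_ , xz , _) = contradiction refl xz
size-set₃ (zero , suc y , suc z) (_ , _ , yz) =
  cong suc (trans (cong ∣_∣ (∪-identityˡ (set₂ y z))) (size-set₂ (yz ∘ cong suc)))
size-set₃ (suc x , zero , z) (xy , xz , yz) =
  trans (cong ∣_∣ (set₃-swap₁₂ (suc x) zero z)) (lemma z yz xz)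
  where
  lemma : ∀ z → zero ≢ z → suc x ≢ z → ∣ set₃ (zero , suc x , z) ∣ ≡ 3
  lemma zero h _ = contradiction refl h
  lemma (suc z) _ h = size-set₃ (zero , suc x , suc z) ((λ ()) , (λ ()) , h)
size-set₃ (suc x , suc y , zero) (xy , xz , yz) =
  trans (cong ∣_∣ (trans (set₃-swap₂₃ (suc x) (suc y) zero) (set₃-swap₁₂ (suc x) zero (suc y))))
    (size-set₃ (zero , suc x , suc y) ((λ ()) , (λ ()) , xy))
size-set₃ (suc x , suc y , suc z) (xy , xz , yz) =
  size-set₃ (x , y , z) (xy ∘ cong suc , xz ∘ cong suc , yz ∘ cong suc)

disjoint-≢ : ∀ {p q : Subset n} → p ∩ q ≡ ∅ → ∀ {x y} → x ∈ˢ p → y ∈ˢ q → x ≢ y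
disjoint-≢ eq x∈ y∈ refl = ∉⊥ (subst (_ ∈ˢ_) eq (x∈p∩q⁺ (x∈ , y∈)))

module Tripartite (A B C : Subset n) (A∩B : A ∩ B ≡ ∅) (A∩C : A ∩ C ≡ ∅) (B∩C : B ∩ C ≡ ∅) where

  transversals : List (Triple n)
  transversals = cartesianProduct (elements A) (cartesianProduct (elements B) (elements C))

  ∈-transversals⁻ : ∀ {a b c} → (a , b , c) ∈ transversals → a ∈ˢ A × b ∈ˢ B × c ∈ˢ C
  ∈-transversals⁻ t∈ =
    let a∈ , bc∈ = ∈-cartesianProduct⁻ (elements A) _ t∈
        b∈ , c∈ = ∈-cartesianProduct⁻ (elements B) (elements C) bc∈
    in ∈-elements⁻ A a∈ , ∈-elements⁻ B b∈ , ∈-elements⁻ C c∈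

  -- A vertex of `s` is an entry of `t`, and disjointness of the parts forces it into the coordinate
  -- of its own part.
  set₃-injective : ∀ {s t} → s ∈ transversals → t ∈ transversals → set₃ s ≡ set₃ t → s ≡ t
  set₃-injective {s@(a , b , c)} {t@(a′ , b′ , c′)} s∈ t∈ eq =
    cong₂ _,_ (same-A (proj₁ s⊆t)) (cong₂ _,_ (same-B (proj₁ (proj₂ s⊆t))) (same-C (proj₂ (proj₂ s⊆t))))
    where
    s⊆t = set₃-⊆ s t eq
    a∈ = proj₁ (∈-transversals⁻ s∈)
    b∈ = proj₁ (proj₂ (∈-transversals⁻ s∈))
    c∈ = proj₂ (proj₂ (∈-transversals⁻ s∈))
    a∈′ = proj₁ (∈-transversals⁻ t∈)
    b∈′ = proj₁ (proj₂ (∈-transversals⁻ t∈))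
    c∈′ = proj₂ (proj₂ (∈-transversals⁻ t∈))
    same-A : a ∈ₜ t → a ≡ a′
    same-A (inj₁ e) = e
    same-A (inj₂ (inj₁ e)) = contradiction e (disjoint-≢ A∩B a∈ b∈′)
    same-A (inj₂ (inj₂ e)) = contradiction e (disjoint-≢ A∩C a∈ c∈′)
    same-B : b ∈ₜ t → b ≡ b′
    same-B (inj₁ e) = contradiction (sym e) (disjoint-≢ A∩B a∈′ b∈)
    same-B (inj₂ (inj₁ e)) = e
    same-B (inj₂ (inj₂ e)) = contradiction e (disjoint-≢ B∩C b∈ c∈′)
    same-C : c ∈ₜ t → c ≡ c′
    same-C (inj₁ e) = contradiction (sym e) (disjoint-≢ A∩C a∈′ c∈)
    same-C (inj₂ (inj₁ e)) = contradiction (sym e) (disjoint-≢ B∩C b∈′ c∈)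
    same-C (inj₂ (inj₂ e)) = e

  system₃ : TripleSystem n
  system₃ = record
    { triples = map set₃ transversals
    ; unique = unique-map set₃ transversals set₃-injective
        (Uniqueₚ.cartesianProduct⁺ (unique-elements A)
          (Uniqueₚ.cartesianProduct⁺ (unique-elements B) (unique-elements C)))
    ; uniform = All.tabulate λ s∈ → let t , t∈ , s≡ = ∈-map⁻ set₃ s∈
                                        a∈ , b∈ , c∈ = ∈-transversals⁻ t∈
        in trans (cong ∣_∣ s≡) (size-set₃ t (disjoint-≢ A∩B a∈ b∈ , disjoint-≢ A∩C a∈ c∈ , disjoint-≢ B∩C b∈ c∈))
    }

  system₃-complete : IsComplete3Partite A B C system₃
  system₃-complete t = mk⇔
    (λ t∈ → let (a , b , c) , s∈ , t≡ = ∈-map⁻ set₃ t∈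
                a∈ , b∈ , c∈ = ∈-transversals⁻ s∈
            in a , b , c , a∈ , b∈ , c∈ , t≡)
    (λ { (a , b , c , a∈ , b∈ , c∈ , refl) → ∈-map⁺ set₃
      (∈-cartesianProduct⁺ (∈-elements⁺ a∈) (∈-cartesianProduct⁺ (∈-elements⁺ b∈) (∈-elements⁺ c∈))) })

  size-system₃ : size system₃ ≡ ∣ A ∣ * ∣ B ∣ * ∣ C ∣
  size-system₃ = begin
    length (map set₃ transversals) ≡⟨ length-map set₃ transversals ⟩
    length transversals
      ≡⟨ trans (length-cartesianProduct (elements A) _)
           (cong (length (elements A) *_) (length-cartesianProduct (elements B) (elements C))) ⟩
    length (elements A) * (length (elements B) * length (elements C))
      ≡⟨ cong₂ _*_ (length-elements A) (cong₂ _*_ (length-elements B) (length-elements C)) ⟩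
    ∣ A ∣ * (∣ B ∣ * ∣ C ∣) ≡⟨ sym (*-assoc (∣ A ∣) (∣ B ∣) (∣ C ∣)) ⟩
    ∣ A ∣ * ∣ B ∣ * ∣ C ∣ ∎
    where open ≡-Reasoning

  -- Duplicate-free lists with the same members are permutations of each other.
  size-complete : ∀ K → IsComplete3Partite A B C K → size K ≡ ∣ A ∣ * ∣ B ∣ * ∣ C ∣
  size-complete K complete = trans
    (↭-length (∼bag⇒↭ (unique∧set⇒bag (unique K) (unique system₃) λ {t} →
      mk⇔ (Equivalence.from (system₃-complete t) ∘ Equivalence.to (complete t))
          (Equivalence.from (complete t) ∘ Equivalence.to (system₃-complete t)))))
    size-system₃

  -- Two of the four core vertices lie in the same part, but no triple contains both.
  complete-free : ∀ K → IsComplete3Partite A B C K → 𝓑-Free K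
  complete-free K complete berge =
    let i , j , i<j , same = Finₚ.pigeonhole {3} {4} ≤-refl (part ∘ v)
        a , b , c , a∈ , b∈ , c∈ , e≡ = Equivalence.to (complete (e i j)) (e-triple i<j)
        i∈ , j∈ = e-contains i<j
        i∈′ = ∈-set₃⁻ (a , b , c) (subst (v i ∈ˢ_) e≡ i∈)
        j∈′ = ∈-set₃⁻ (a , b , c) (subst (v j ∈ˢ_) e≡ j∈)
    in Finₚ.<⇒≢ i<j (v-distinct (part-injective (part-A a∈) (part-B b∈) (part-C c∈) i∈′ j∈′ same))
    where
    open BergeK₄ berge
    -- The value `2F` also serves vertices outside all three parts. The pigeonhole needs only three
    -- values, and the two vertices it yields lie in a common triple, hence in the parts.
    part : Fin n → Fin 3
    part x with x ∈ˢ? A | x ∈ˢ? B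
    ... | yes _ | _ = 0F
    ... | no _ | yes _ = 1F
    ... | no _ | no _ = 2F
    part-A : ∀ {x} → x ∈ˢ A → part x ≡ 0F
    part-A {x} x∈ with x ∈ˢ? A | x ∈ˢ? B
    ... | yes _ | _ = refl
    ... | no x∉ | _ = contradiction x∈ x∉
    part-B : ∀ {x} → x ∈ˢ B → part x ≡ 1F
    part-B {x} x∈ with x ∈ˢ? A | x ∈ˢ? B
    ... | yes x∈A | _ = contradiction refl (disjoint-≢ A∩B x∈A x∈)
    ... | no _ | yes _ = refl
    ... | no _ | no x∉ = contradiction x∈ x∉
    part-C : ∀ {x} → x ∈ˢ C → part x ≡ 2F
    part-C {x} x∈ with x ∈ˢ? A | x ∈ˢ? B
    ... | yes x∈A | _ = contradiction refl (disjoint-≢ A∩C x∈A x∈)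
    ... | no _ | yes x∈B = contradiction refl (disjoint-≢ B∩C x∈B x∈)
    ... | no _ | no _ = refl
    part-injective : ∀ {a b c x y} → part a ≡ 0F → part b ≡ 1F → part c ≡ 2F →
      x ∈ₜ (a , b , c) → y ∈ₜ (a , b , c) → part x ≡ part y → x ≡ y
    part-injective pa pb pc (inj₁ refl) (inj₁ refl) h = refl
    part-injective pa pb pc (inj₁ refl) (inj₂ (inj₁ refl)) h = contradiction (trans (sym pa) (trans h pb)) λ ()
    part-injective pa pb pc (inj₁ refl) (inj₂ (inj₂ refl)) h = contradiction (trans (sym pa) (trans h pc)) λ ()
    part-injective pa pb pc (inj₂ (inj₁ refl)) (inj₁ refl) h = contradiction (trans (sym pb) (trans h pa)) λ ()
    part-injective pa pb pc (inj₂ (inj₁ refl)) (inj₂ (inj₁ refl)) h = refl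
    part-injective pa pb pc (inj₂ (inj₁ refl)) (inj₂ (inj₂ refl)) h = contradiction (trans (sym pb) (trans h pc)) λ ()
    part-injective pa pb pc (inj₂ (inj₂ refl)) (inj₁ refl) h = contradiction (trans (sym pc) (trans h pa)) λ ()
    part-injective pa pb pc (inj₂ (inj₂ refl)) (inj₂ (inj₁ refl)) h = contradiction (trans (sym pc) (trans h pb)) λ ()
    part-injective pa pb pc (inj₂ (inj₂ refl)) (inj₂ (inj₂ refl)) h = refl

∣partition∣ : ∀ (A B C : Subset n) → A ∪ B ∪ C ≡ full → A ∩ B ≡ ∅ → A ∩ C ≡ ∅ → B ∩ C ≡ ∅ →
              ∣ A ∣ + ∣ B ∣ + ∣ C ∣ ≡ n
∣partition∣ [] [] [] _ _ _ _ = refl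
∣partition∣ (inside ∷ A) (outside ∷ B) (outside ∷ C) c ab ac bc =
  cong suc (∣partition∣ A B C (Vecₚ.∷-injectiveʳ c) (Vecₚ.∷-injectiveʳ ab)
      (Vecₚ.∷-injectiveʳ ac) (Vecₚ.∷-injectiveʳ bc))
∣partition∣ (outside ∷ A) (inside ∷ B) (outside ∷ C) c ab ac bc =
  trans (cong (_+ ∣ C ∣) (+-suc (∣ A ∣) (∣ B ∣)))
    (cong suc (∣partition∣ A B C (Vecₚ.∷-injectiveʳ c) (Vecₚ.∷-injectiveʳ ab)
      (Vecₚ.∷-injectiveʳ ac) (Vecₚ.∷-injectiveʳ bc)))
∣partition∣ (outside ∷ A) (outside ∷ B) (inside ∷ C) c ab ac bc =
  trans (+-suc (∣ A ∣ + ∣ B ∣) (∣ C ∣))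
    (cong suc (∣partition∣ A B C (Vecₚ.∷-injectiveʳ c) (Vecₚ.∷-injectiveʳ ab)
      (Vecₚ.∷-injectiveʳ ac) (Vecₚ.∷-injectiveʳ bc)))
∣partition∣ (outside ∷ A) (outside ∷ B) (outside ∷ C) () ab ac bc
∣partition∣ (inside ∷ A) (inside ∷ B) (_ ∷ C) c () ac bc
∣partition∣ (inside ∷ A) (outside ∷ B) (inside ∷ C) c ab () bc
∣partition∣ (outside ∷ A) (inside ∷ B) (inside ∷ C) c ab ac ()

balanced-size : ∀ (K : TripleSystem n) → IsBalancedComplete3Partite K → size K ≡ f n
balanced-size {n} K (A , B , C , part , complete) = begin
  size K ≡⟨ Tripartite.size-complete A B C A∩B A∩C B∩C K complete ⟩
  ∣ A ∣ * ∣ B ∣ * ∣ C ∣ ≡⟨ cong₂ _*_ (cong₂ _*_ ∣A∣ ∣B∣) ∣C∣ ⟩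
  f n ∎
  where
  open ≡-Reasoning
  open IsBalancedPartition part
  -- The middle size is what the two prescribed sizes leave of n.
  ∣B∣ : ∣ B ∣ ≡ (n + 1) / 3
  ∣B∣ = +-cancelˡ-≡ (n / 3) _ _ (+-cancelʳ-≡ ((n + 2) / 3) _ _ (begin
    n / 3 + ∣ B ∣ + (n + 2) / 3 ≡⟨ cong₂ (λ a c → a + ∣ B ∣ + c) (sym ∣A∣) (sym ∣C∣) ⟩
    ∣ A ∣ + ∣ B ∣ + ∣ C ∣ ≡⟨ ∣partition∣ A B C cover A∩B A∩C B∩C ⟩
    n ≡⟨ sym (thirds-sum n) ⟩
    n / 3 + (n + 1) / 3 + (n + 2) / 3 ∎))

-- A new vertex joins the smallest part, which then becomes the largest: the sizes shift from the
-- thirds of n to those of n + 1 by a rotation of the parts.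
balanced-partition : ∀ n → ∃[ A ] ∃[ B ] ∃[ C ] IsBalancedPartition {n} A B C × ∣ B ∣ ≡ (n + 1) / 3
balanced-partition zero = [] , [] , [] , record
  { cover = refl ; A∩B = refl ; A∩C = refl ; B∩C = refl ; ∣A∣ = refl ; A≤B = z≤n ; B≤C = z≤n ; ∣C∣ = refl } , refl
balanced-partition (suc n) with balanced-partition n
... | A , B , C , part , ∣B∣ = outside ∷ B , outside ∷ C , inside ∷ A , record
  { cover = cong (inside ∷_) (trans (trans (sym (∪-assoc B C A)) (∪-comm (B ∪ C) A)) cover)
  ; A∩B = cong (outside ∷_) B∩C
  ; A∩C = cong (outside ∷_) (trans (∩-comm B A) A∩B)
  ; B∩C = cong (outside ∷_) (trans (∩-comm C A) A∩C)
  ; ∣A∣ = trans ∣B∣ (cong (_/ 3) (+-comm n 1))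
  ; A≤B = B≤C
  -- The old largest part exceeds the old smallest part by at most one.
  ; B≤C = ≤-trans (≤-reflexive ∣C∣) (≤-trans (/-monoˡ-≤ 3 (n≤1+n (n + 2))) (≤-reflexive ∣A∣+1))
  ; ∣C∣ = sym ∣A∣+1
  } ,
  trans ∣C∣ (cong (_/ 3) (+-suc n 1))
  where
  open IsBalancedPartition part
  ∣A∣+1 : suc (n + 2) / 3 ≡ suc ∣ A ∣
  ∣A∣+1 = trans (cong (λ m → suc m / 3) (+-comm n 2)) (trans (3+n/3 n) (cong suc (sym ∣A∣)))

balanced-system : ∀ n → ∃[ K ] IsBalancedComplete3Partite {n} K × 𝓑-Free K
balanced-system n =
  let A , B , C , part , _ = balanced-partition n
      open IsBalancedPartition part
      open Tripartite A B C A∩B A∩C B∩C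
  in system₃ , (A , B , C , part , system₃-complete) , complete-free system₃ system₃-complete

theorem1 : ∀ (n : ℕ) → n ≥ 6 →
    IsEx₃ n 𝓑-Free (f n)
    × ∃ (λ (K : TripleSystem n) → IsBalancedComplete3Partite K)
    × (∀ (K : TripleSystem n) → IsBalancedComplete3Partite K → size K ≡ f n)
theorem1 n n≥6 =
  let K , balanced , free = balanced-system n
  in record { attained = K , free , balanced-size K balanced ; maximal = upper-bound n n≥6 }
   , (K , balanced)
   , balanced-size
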